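{- Let $q\ge 4$ and let $H_1$ be a hyperplane of $\mathrm{PG}(U_1)$ with $|H_1\cap\mathcal O_1|=q^2-q+1$. Then $H_1\cap\mathcal O_1$ is a $5$-general set of $H_1\cong\mathrm{PG}(6,q)$.
   Context: $q$ is a prime power. Let $U_1\subset\mathbb F_{q^3}^8$ be the set of vectors $(a,b^{q^2},b^{q},c,b,c^{q},c^{q^2},d)$ with $a,d\in\mathbb F_q$, $b,c\in\mathbb F_{q^3}$; it is an $8$-dimensional $\mathbb F_q$-vector space, so $\mathrm{PG}(U_1)\cong\mathrm{PG}(7,q)$. For $(a,b,c,d)\ne 0$ let $P(a,b,c,d)$ be the point of $\mathrm{PG}(U_1)$ spanned by this vector. Let $\mathcal O_1=\{P(1,t,t^{q^2+q},t^{q^2+q+1}) : t\in\mathbb F_{q^3}\}\cup\{P(0,0,0,1)\}$. For integers $r,s$, an $(r,s)$-set of $\mathrm{PG}(n,q)$ is a set $\mathcal X$ of points such that: (i) every $s$-dimensional projective subspace contains at most $r$ points of $\mathcal X$; (ii) $\mathcal X$ spans $\mathrm{PG}(n,q)$; (iii) some $(s+1)$-dimensional projective subspace contains $r+2$ points of $\mathcal X$. A $k$-general set is a $(k-1,k-2)$-set; so a $5$-general set is a $(4,3)$-set. -}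

module Defs where

open import Level using (Level; _⊔_) renaming (suc to lsuc)
open import Data.Nat.Base as ℕ using (ℕ; suc; _∸_)
open import Data.Nat.Primality using (Prime)
open import Data.Fin.Base using (Fin; zero; suc)
open import Data.Fin.Patterns using (0F; 7F)
open import Data.Vec.Functional using (Vector; _∷_; [])
open import Data.Vec.Functional.Relation.Binary.Equality.Setoid as VecEq using ()
open import Data.Product.Base using (Σ; ∃-syntax; _×_; _,_; proj₁; proj₂)
open import Data.Sum.Base using (_⊎_)
open import Relation.Nullary.Negation using (¬_)
open import Relation.Unary using (Pred; _∈_; _⊆_; _∩_)
open import Relation.Binary.Bundles using (Setoid)
open import Relation.Binary.Structures using (IsEquivalence)
open import Relation.Binary.PropositionalEquality using (_≡_)
import Relation.Binary.PropositionalEquality as ≡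
import Relation.Binary.Construct.On as On
open import Function.Bundles using (Inverse; Injection)
open import Algebra.Bundles using (CommutativeRing)
open import Algebra.Apartness.Bundles using (HeytingField; HeytingCommutativeRing)
open import Algebra.Morphism.Structures using (IsRingMonomorphism)
open import Algebra.Module.Bundles using (Module)
open import Algebra.Module.Structures.Biased using (IsModuleFromLeft)
import Algebra.Properties.Monoid.Sum as Sum
import Algebra.Properties.Semiring.Exp as Exp

IsPrimePower : ℕ → Set
IsPrimePower q = ∃[ p ] ∃[ k ] Prime p × q ≡ p ℕ.^ suc k

HasCardinality : ∀ {a ℓ} → Setoid a ℓ → ℕ → Set (a ⊔ ℓ)
HasCardinality S n = Inverse (≡.setoid (Fin n)) S

HasAtLeast : ∀ {a ℓ} → Setoid a ℓ → ℕ → Set (a ⊔ ℓ)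
HasAtLeast S n = Injection (≡.setoid (Fin n)) S

HasAtMost : ∀ {a ℓ} → Setoid a ℓ → ℕ → Set (a ⊔ ℓ)
HasAtMost S n = ¬ HasAtLeast S (suc n)

ringOf : ∀ {c ℓ a} → HeytingField c ℓ a → CommutativeRing c ℓ
ringOf K = HeytingCommutativeRing.commutativeRing (HeytingField.heytingCommutativeRing K)

-- The geometry of the subspaces of a K-vector space V.  For a subspace W of
-- V, PG(W) is the set of points of V lying in W together with the projective
-- subspaces contained in W.
module ProjectiveGeometry {c ℓ a m ℓm : Level}
  (K : HeytingField c ℓ a) (V : Module (ringOf K) m ℓm) where

  open HeytingField K using (Carrier; _≈_; 0#; 1#; _*_)
  open Module V
  open Sum +ᴹ-monoid using (sum)

  linComb : ∀ {n} → Vector Carrier n → Vector Carrierᴹ n → Carrierᴹ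
  linComb x v = sum (λ i → x i *ₗ v i)

  -- Every finite-dimensional subspace is the span of a basis, which is a
  -- predicate at level c ⊔ ℓm; so fixing this level loses no subspaces.
  record Subspace : Set (m ⊔ lsuc (c ⊔ ℓm)) where
    field
      Mem       : Pred Carrierᴹ (c ⊔ ℓm)
      resp      : ∀ {v w} → v ≈ᴹ w → Mem v → Mem w
      0-closed  : Mem 0ᴹ
      +-closed  : ∀ {v w} → Mem v → Mem w → Mem (v +ᴹ w)
      *-closed  : ∀ x {v} → Mem v → Mem (x *ₗ v)

  open Subspace public using (Mem)

  record HasDimension (W : Subspace) (n : ℕ) : Set (c ⊔ ℓ ⊔ m ⊔ ℓm) where
    field
      basis       : Vector Carrierᴹ n
      basis∈      : ∀ i → basis i ∈ Mem W
      independent : ∀ x → linComb x basis ≈ᴹ 0ᴹ → ∀ i → x i ≈ 0#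
      spanning    : ∀ {v} → v ∈ Mem W → ∃[ x ] v ≈ᴹ linComb x basis

  HasProjDimension : Subspace → ℕ → Set (c ⊔ ℓ ⊔ m ⊔ ℓm)
  HasProjDimension W d = HasDimension W (suc d)

  Point : Set (m ⊔ ℓm)
  Point = Σ Carrierᴹ λ v → ¬ v ≈ᴹ 0ᴹ

  -- ⟨ v ⟩ = ⟨ w ⟩
  _∼_ : Point → Point → Set (c ⊔ ℓm)
  (v , _) ∼ (w , _) = (∃[ x ] v ≈ᴹ x *ₗ w) × (∃[ x ] w ≈ᴹ x *ₗ v)

  ∼-isEquivalence : IsEquivalence _∼_
  ∼-isEquivalence = record
    { refl  = (1# , ≈ᴹ-sym (*ₗ-identityˡ _)) , (1# , ≈ᴹ-sym (*ₗ-identityˡ _))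
    ; sym   = λ (p , q) → q , p
    ; trans = λ (p , p′) (q , q′) → comp p q , comp q′ p′
    }
    where
    comp : ∀ {u v w} → ∃[ x ] u ≈ᴹ x *ₗ v → ∃[ y ] v ≈ᴹ y *ₗ w → ∃[ z ] u ≈ᴹ z *ₗ w
    comp (x , u≈xv) (y , v≈yw) =
      x * y , ≈ᴹ-trans u≈xv (≈ᴹ-trans (*ₗ-congˡ v≈yw) (≈ᴹ-sym (*ₗ-assoc x y _)))

  pointSetoid : Setoid (m ⊔ ℓm) (c ⊔ ℓm)
  pointSetoid = record { isEquivalence = ∼-isEquivalence }

  PointSet : ∀ p → Set (m ⊔ ℓm ⊔ lsuc p)
  PointSet p = Pred Point p

  setoidOf : ∀ {p} → PointSet p → Setoid (m ⊔ ℓm ⊔ p) (c ⊔ ℓm)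
  setoidOf X = On.setoid {B = Σ Point X} pointSetoid proj₁

  pointsOf : Subspace → PointSet (c ⊔ ℓm)
  pointsOf W (v , _) = v ∈ Mem W

  LinearSpan : ∀ {p} → PointSet p → Pred Carrierᴹ (c ⊔ m ⊔ ℓm ⊔ p)
  LinearSpan X v = ∃[ n ] Σ (Vector Point n) λ P → (∀ i → P i ∈ X) ×
    ∃[ x ] v ≈ᴹ linComb x (λ i → proj₁ (P i))

  record IsSet⟨_,_⟩ (r s : ℕ) (W : Subspace) {p} (X : PointSet p)
    : Set (ℓ ⊔ m ⊔ p ⊔ lsuc (c ⊔ ℓm)) where
    field
      inside : X ⊆ pointsOf W
      atMost : ∀ S → Mem S ⊆ Mem W → HasProjDimension S s →
               HasAtMost (setoidOf (X ∩ pointsOf S)) r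
      spans  : Mem W ⊆ LinearSpan X
      excess : ∃[ S ] Mem S ⊆ Mem W × HasProjDimension S (suc s) ×
               HasAtLeast (setoidOf (X ∩ pointsOf S)) (2 ℕ.+ r)

  -- Meaningful for k ≥ 2, where the truncated subtractions are exact.
  IsGeneral : ∀ (k : ℕ) (W : Subspace) {p} (X : PointSet p) →
              Set (ℓ ⊔ m ⊔ p ⊔ lsuc (c ⊔ ℓm))
  IsGeneral k = IsSet⟨ k ∸ 1 , k ∸ 2 ⟩

-- The extension 𝔽_q ⊆ 𝔽_{q³}, the inclusion being a ring monomorphism ι.
record CubicExtension (c ℓ a : Level) (q : ℕ) : Set (lsuc (c ⊔ ℓ ⊔ a)) where
  field
    K F     : HeytingField c ℓ a
  module K = CommutativeRing (ringOf K)
  module F = CommutativeRing (ringOf F)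
  field
    K-order : HasCardinality K.setoid q
    F-order : HasCardinality F.setoid (q ℕ.^ 3)
    ι       : K.Carrier → F.Carrier
    ι-mono  : IsRingMonomorphism K.rawRing F.rawRing ι

module Twisted {c ℓ a : Level} {q : ℕ} (E : CubicExtension c ℓ a q) where

  open CubicExtension E
  open F using (_≈_; _+_; _*_; -_; 0#; 1#)
  open Exp F.semiring using (_^_)
  open VecEq F.setoid using (_≋_; ≋-isEquivalence)
  open IsRingMonomorphism ι-mono

  F^_ : ℕ → Module (ringOf K) c ℓ
  F^ n = record
    { Carrierᴹ = Vector F.Carrier n
    ; _≈ᴹ_     = _≋_
    ; _+ᴹ_     = λ v w i → v i + w i
    ; _*ₗ_     = λ x v i → ι x * v i
    ; 0ᴹ       = λ _ → 0#
    ; -ᴹ_      = λ v i → - v i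
    ; isModule = IsModuleFromLeft.isModule {commutativeRing = ringOf K} record
      { isLeftModule = record
        { isLeftSemimodule = record
          { +ᴹ-isCommutativeMonoid = record
            { isMonoid = record
              { isSemigroup = record
                { isMagma = record
                  { isEquivalence = ≋-isEquivalence n
                  ; ∙-cong        = λ p r i → F.+-cong (p i) (r i)
                  }
                ; assoc = λ u v w i → F.+-assoc (u i) (v i) (w i)
                }
              ; identity = (λ v i → F.+-identityˡ (v i)) , (λ v i → F.+-identityʳ (v i))
              }
            ; comm = λ v w i → F.+-comm (v i) (w i)
            }
          ; isPreleftSemimodule = record
            { *ₗ-cong      = λ p r i → F.*-cong (⟦⟧-cong p) (r i)
            ; *ₗ-zeroˡ     = λ v i → F.trans (F.*-congʳ 0#-homo) (F.zeroˡ (v i))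
            ; *ₗ-distribʳ  = λ v x y i →
                F.trans (F.*-congʳ (+-homo x y)) (F.distribʳ (v i) (ι x) (ι y))
            ; *ₗ-identityˡ = λ v i → F.trans (F.*-congʳ 1#-homo) (F.*-identityˡ (v i))
            ; *ₗ-assoc     = λ x y v i →
                F.trans (F.*-congʳ (*-homo x y)) (F.*-assoc (ι x) (ι y) (v i))
            ; *ₗ-zeroʳ     = λ x i → F.zeroʳ (ι x)
            ; *ₗ-distribˡ  = λ x v w i → F.distribˡ (ι x) (v i) (w i)
            }
          }
        ; -ᴹ‿cong    = λ p i → F.-‿cong (p i)
        ; -ᴹ‿inverse = (λ v i → F.-‿inverseˡ (v i)) , (λ v i → F.-‿inverseʳ (v i))
        }
      }
    }

  V : Module (ringOf K) c ℓ
  V = F^ 8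

  open Module V using (Carrierᴹ; _≈ᴹ_; 0ᴹ)
  open ProjectiveGeometry K V public

  -- a and d range over all of 𝔽_{q³} here, so that the norm t^{q²+q+1} can
  -- be supplied as an element of 𝔽_{q³}; U₁ asks for a, d ∈ 𝔽_q.
  vec : (a b c d : F.Carrier) → Carrierᴹ
  vec a b c d =
    a ∷ b ^ (q ℕ.^ 2) ∷ b ^ q ∷ c ∷ b ∷ c ^ q ∷ c ^ (q ℕ.^ 2) ∷ d ∷ []

  U₁ : Pred Carrierᴹ (c ⊔ ℓ)
  U₁ v = ∃[ a ] ∃[ b ] ∃[ c ] ∃[ d ] v ≈ᴹ vec (ι a) b c (ι d)

  private
    1≉0 : ¬ 1# ≈ 0#
    1≉0 1≈0 = HeytingField.#-irrefl F F.refl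
      (HeytingField.invertible⇒# F {0#} {0#} (0# , trivial _ , trivial _))
      where
      trivial : ∀ x → x ≈ 1#
      trivial x = F.trans (F.sym (F.*-identityʳ x)) (F.trans (F.*-congˡ 1≈0)
                    (F.trans (F.zeroʳ x) (F.sym 1≈0)))

  P₁ : F.Carrier → Point
  P₁ t = vec 1# t (t ^ (q ℕ.^ 2 ℕ.+ q)) (t ^ (q ℕ.^ 2 ℕ.+ q ℕ.+ 1)) , λ v≈0 → 1≉0 (v≈0 0F)

  P∞ : Point
  P∞ = vec 0# 0# 0# 1# , λ v≈0 → 1≉0 (v≈0 7F)

  O₁ : PointSet (c ⊔ ℓ)
  O₁ P = (∃[ t ] P ∼ P₁ t) ⊎ P ∼ P∞

  -- U₁ is 8-dimensional over K, so the hyperplanes of PG(U₁) ≅ PG(7,q) are its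
  -- subspaces of projective dimension 6.
  IsHyperplane : Subspace → Set (c ⊔ ℓ)
  IsHyperplane H = Mem H ⊆ U₁ × HasProjDimension H 6

{-# OPTIONS --safe #-}
module Submission where

-- Write P(v) = v ⊗ v^q ⊗ v^{q²} for v in 𝔽_{q³}², so that 𝒪₁ is the set of all P(v) and H₁ is the kernel of a
-- cubic form f(v).  In a basis e₁, e₂ of zeros, f(x e₁ + y e₂) = Tr (B x y^{q+q²}) + Tr (C y x^{q+q²}); if the
-- section contained the 𝔽_q-subline of e₁, e₂, both traces of B and C would vanish, and counting the zeros
-- along the cosets t + 𝔽_q would give more than q² - q + 1 of them.  Hence no four points of the section have
-- a cross ratio in 𝔽_q, whereas five dependent points would have such cross ratios (contract the dependency with
-- product functionals).  If the section did not span H₁, some hyperplane would meet 𝒪₁ in more than q² + q + 1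
-- points, the degree of a functional as a polynomial in t.  Finally, if any six points were independent, then
-- for q ≥ 5 the combinations of at most three points would be distinct, but there are more than q⁷ of them; for
-- q = 4 the relations between ten points would form a (10,3)-arc in PG(2,4), which does not exist.

-- One bound serves every count: along the parameter t, a functional on 𝔽_{q³}⁸ is a polynomial with
-- exponents i + jq + kq², where i, j, k are 0 or 1, so a nonzero one has at most q² + q + 1 zeros.
-- Once the traces of B and C vanish, s ↦ f((t + s) e₁ + e₂) is affine on 𝔽_q with slope -Tr (C t);
-- each of the at least q³ - q² - q - 1 values t with nonzero slope then yields a zero in its coset,
-- which is too much for q² - q + 1 points. The hyperplane is given by seven vectors over 𝔽_q rather
-- than by a form: a functional over 𝔽_{q³} that kills them is turned into f by a trace, after a
-- rescaling that keeps the trace from vanishing. The split at q = 4 is forced by the numbers. With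
-- 13 points the combinations of at most three number 8464, below 4⁷ = 16384, whereas for q = 5
-- those of exactly three out of 21 points are already 1330 · 64 = 85120, above 5⁷ = 78125.

import Defs

open import Algebra.Bundles using (CommutativeRing)

-- A ring solver with integer coefficients.

-- Coefficients are formal differences of naturals, so that the solver sees
-- cancellations in a ring whose own operations do not compute.
module DifferenceSolver {c ℓ} (R : CommutativeRing c ℓ) where

  open import Algebra.Bundles using (RawRing)
  open import Algebra.Solver.Ring.AlmostCommutativeRing
    using (fromCommutativeRing; _-Raw-AlmostCommutative⟶_)
  open import Data.Maybe.Base using (Maybe; just; nothing)
  open import Data.Nat.Base as ℕ using (ℕ)
  import Data.Nat.Properties as ℕ
  open import Data.Product.Base using (_×_; _,_)
  open import Data.Product.Properties using (≡-dec)
  open import Level using (0ℓ)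
  open import Relation.Binary.PropositionalEquality as ≡ using (_≡_)
  open import Relation.Nullary.Decidable using (yes; no)
  open CommutativeRing R hiding (zero)
  open import Algebra.Properties.Ring ring using (-0#≈0#; -‿distribˡ-*; -‿distribʳ-*; -‿involutive)
  open import Algebra.Properties.AbelianGroup +-abelianGroup using (⁻¹-∙-comm)
  open import Algebra.Properties.Semiring.Mult semiring
    using (×-homo-+; ×1-homo-*) renaming (_×_ to _·_)
  import Algebra.Properties.CommutativeSemigroup as CS
  open import Relation.Binary.Reasoning.Setoid setoid

  private
    module +S = CS (CommutativeRing.+-commutativeSemigroup R)

    -- Leaves a difference with a zero component, so that equal integers become equal pairs and
    -- `_≟_` recognises them.
    cancel : ℕ × ℕ → ℕ × ℕ
    cancel (ℕ.suc a , ℕ.suc b) = cancel (a , b)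
    cancel d                   = d

    Diff : RawRing 0ℓ 0ℓ
    Diff = record
      { Carrier = ℕ × ℕ
      ; _≈_ = _≡_
      ; _+_ = λ (a , b) (c , d) → cancel (a ℕ.+ c , b ℕ.+ d)
      ; _*_ = λ (a , b) (c , d) → cancel (a ℕ.* c ℕ.+ b ℕ.* d , a ℕ.* d ℕ.+ b ℕ.* c)
      ; -_  = λ (a , b) → b , a
      ; 0#  = 0 , 0
      ; 1#  = 1 , 0
      }

    ⟦_⟧ : ℕ × ℕ → Carrier
    ⟦ a , b ⟧ = a · 1# - b · 1#

    -‿+ : ∀ x y → - (x + y) ≈ - x - y
    -‿+ x y = sym (⁻¹-∙-comm x y)

    ⟦cancel⟧ : ∀ d → ⟦ cancel d ⟧ ≈ ⟦ d ⟧
    ⟦cancel⟧ (ℕ.zero , b)          = refl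
    ⟦cancel⟧ (ℕ.suc a , ℕ.zero)    = refl
    ⟦cancel⟧ (ℕ.suc a , ℕ.suc b) = begin
      ⟦ cancel (a , b) ⟧                    ≈⟨ ⟦cancel⟧ (a , b) ⟩
      a · 1# - b · 1#                       ≈⟨ +-identityˡ _ ⟨
      0# + ⟦ a , b ⟧                        ≈⟨ +-congʳ (-‿inverseʳ 1#) ⟨
      (1# - 1#) + (a · 1# - b · 1#)         ≈⟨ +S.interchange _ _ _ _ ⟩
      (1# + a · 1#) + (- 1# - b · 1#)       ≈⟨ +-congˡ (-‿+ _ _) ⟨
      ⟦ ℕ.suc a , ℕ.suc b ⟧                 ∎

    +-homo : ∀ x y → ⟦ RawRing._+_ Diff x y ⟧ ≈ ⟦ x ⟧ + ⟦ y ⟧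
    +-homo (a , b) (c , d) = begin
      ⟦ cancel (a ℕ.+ c , b ℕ.+ d) ⟧   ≈⟨ ⟦cancel⟧ (a ℕ.+ c , b ℕ.+ d) ⟩
      (a ℕ.+ c) · 1# - (b ℕ.+ d) · 1#
        ≈⟨ +-cong (×-homo-+ 1# a c) (trans (-‿cong (×-homo-+ 1# b d)) (-‿+ _ _)) ⟩
      (a · 1# + c · 1#) + (- (b · 1#) - d · 1#)
        ≈⟨ +S.interchange _ _ _ _ ⟩
      ⟦ a , b ⟧ + ⟦ c , d ⟧ ∎

    -‿homo : ∀ x → ⟦ RawRing.-_ Diff x ⟧ ≈ - ⟦ x ⟧
    -‿homo (a , b) = begin
      b · 1# - a · 1#        ≈⟨ +-comm _ _ ⟩
      - (a · 1#) + b · 1#    ≈⟨ +-congˡ (-‿involutive _) ⟨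
      - (a · 1#) - - (b · 1#) ≈⟨ -‿+ _ _ ⟨
      - ⟦ a , b ⟧ ∎

    expand : ∀ a b c d → (a - b) * (c - d) ≈ (a * c + b * d) - (a * d + b * c)
    expand a b c d = begin
      (a - b) * (c - d)                             ≈⟨ distribʳ _ _ _ ⟩
      a * (c - d) + - b * (c - d)                   ≈⟨ +-cong (distribˡ _ _ _) (distribˡ _ _ _) ⟩
      (a * c + a * - d) + (- b * c + - b * - d)     ≈⟨ +-congˡ (+-comm _ _) ⟩
      (a * c + a * - d) + (- b * - d + - b * c)     ≈⟨ +S.interchange _ _ _ _ ⟩
      (a * c + - b * - d) + (a * - d + - b * c)     ≈⟨ +-cong
        (+-congˡ (trans (sym (-‿distribˡ-* _ _)) (trans (-‿cong (sym (-‿distribʳ-* _ _))) (-‿involutive _))))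
        (trans (+-cong (sym (-‿distribʳ-* _ _)) (sym (-‿distribˡ-* _ _))) (sym (-‿+ _ _))) ⟩
      (a * c + b * d) - (a * d + b * c)             ∎

    *-homo : ∀ x y → ⟦ RawRing._*_ Diff x y ⟧ ≈ ⟦ x ⟧ * ⟦ y ⟧
    *-homo (a , b) (c , d) = begin
      ⟦ cancel (a ℕ.* c ℕ.+ b ℕ.* d , a ℕ.* d ℕ.+ b ℕ.* c) ⟧
        ≈⟨ ⟦cancel⟧ (a ℕ.* c ℕ.+ b ℕ.* d , a ℕ.* d ℕ.+ b ℕ.* c) ⟩
      (a ℕ.* c ℕ.+ b ℕ.* d) · 1# - (a ℕ.* d ℕ.+ b ℕ.* c) · 1#
        ≈⟨ +-cong (sum-of-products a c b d) (-‿cong (sum-of-products a d b c)) ⟩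
      (a · 1# * c · 1# + b · 1# * d · 1#) - (a · 1# * d · 1# + b · 1# * c · 1#)
        ≈⟨ expand _ _ _ _ ⟨
      ⟦ a , b ⟧ * ⟦ c , d ⟧ ∎
      where
      sum-of-products : ∀ m n k l → (m ℕ.* n ℕ.+ k ℕ.* l) · 1# ≈ m · 1# * n · 1# + k · 1# * l · 1#
      sum-of-products m n k l =
        trans (×-homo-+ 1# (m ℕ.* n) (k ℕ.* l)) (+-cong (×1-homo-* m n) (×1-homo-* k l))

    -- Makes the constants 0 and 1 of a solved equation the ring's own.
    ⟦_⟧₀₁ : ℕ × ℕ → Carrier
    ⟦ 0 , 0 ⟧₀₁ = 0#
    ⟦ 1 , 0 ⟧₀₁ = 1#
    ⟦ d     ⟧₀₁ = ⟦ d ⟧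

    ⟦⟧₀₁≈⟦⟧ : ∀ d → ⟦ d ⟧₀₁ ≈ ⟦ d ⟧
    ⟦⟧₀₁≈⟦⟧ (0 , 0)                   = sym (-‿inverseʳ 0#)
    ⟦⟧₀₁≈⟦⟧ (1 , 0)                   = sym (trans (+-cong (+-identityʳ 1#) -0#≈0#) (+-identityʳ 1#))
    ⟦⟧₀₁≈⟦⟧ (0 , ℕ.suc _)             = refl
    ⟦⟧₀₁≈⟦⟧ (1 , ℕ.suc _)             = refl
    ⟦⟧₀₁≈⟦⟧ (ℕ.suc (ℕ.suc _) , _)     = refl

    morphism : Diff -Raw-AlmostCommutative⟶ fromCommutativeRing R
    morphism = record
      { ⟦_⟧    = ⟦_⟧₀₁
      ; +-homo = λ x y → trans (⟦⟧₀₁≈⟦⟧ (RawRing._+_ Diff x y)) (trans (+-homo x y) (sym (+-cong (⟦⟧₀₁≈⟦⟧ x) (⟦⟧₀₁≈⟦⟧ y))))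
      ; *-homo = λ x y → trans (⟦⟧₀₁≈⟦⟧ (RawRing._*_ Diff x y)) (trans (*-homo x y) (sym (*-cong (⟦⟧₀₁≈⟦⟧ x) (⟦⟧₀₁≈⟦⟧ y))))
      ; -‿homo = λ x → trans (⟦⟧₀₁≈⟦⟧ (RawRing.-_ Diff x)) (trans (-‿homo x) (sym (-‿cong (⟦⟧₀₁≈⟦⟧ x))))
      ; 0-homo = refl
      ; 1-homo = refl
      }

    _≟_ : ∀ x y → Maybe (⟦ x ⟧₀₁ ≈ ⟦ y ⟧₀₁)
    x ≟ y with ≡-dec ℕ._≟_ ℕ._≟_ x y
    ... | yes ≡.refl = just refl
    ... | no  _      = nothing

  open import Algebra.Solver.Ring Diff (fromCommutativeRing R) morphism _≟_ public
    using (solve; _:=_; _:+_; _:*_; _:-_; :-_; con; Polynomial)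

  :0 :1 : ∀ {n} → Polynomial n
  :0 = con (0 , 0)
  :1 = con (1 , 0)

-- Injections, enumerated subsets and the pigeonhole principle.

module Counting where

  open import Data.Fin.Base as Fin using (Fin; zero; suc; splitAt; join; inject≤; punchOut)
  import Data.Fin.Properties as Fin
  open import Data.Nat.Base
  open import Data.Nat.Properties
  open import Data.Product.Base using (Σ; ∃-syntax; _×_; _,_; proj₁; proj₂)
  open import Data.Sum.Base using (_⊎_; inj₁; inj₂; [_,_]′)
  open import Function.Base using (_∘_)
  open import Relation.Binary.PropositionalEquality
  open import Relation.Nullary using (Dec; ¬_; yes; no; contradiction; ¬?)
  open import Relation.Unary using (Pred; Decidable)

  Inj : ∀ {a b} {A : Set a} {B : Set b} → (A → B) → Set _
  Inj f = ∀ {x y} → f x ≡ f y → x ≡ y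

  _⊕_ : ∀ {a} {A : Set a} {m n} → (Fin m → A) → (Fin n → A) → Fin (m + n) → A
  _⊕_ {m = m} f g i = [ f , g ]′ (splitAt m i)

  splitAt-injective : ∀ m {n} → Inj (splitAt m {n})
  splitAt-injective m {n} {i} {j} eq =
    trans (sym (Fin.join-splitAt m n i)) (trans (cong (join m n) eq) (Fin.join-splitAt m n j))

  join-injective : ∀ m n → Inj (join m n)
  join-injective m n {x} {y} eq =
    trans (sym (Fin.splitAt-join m n x)) (trans (cong (splitAt m) eq) (Fin.splitAt-join m n y))

  ⊕-injective : ∀ {a} {A : Set a} {m n} {f : Fin m → A} {g : Fin n → A} →
                Inj f → Inj g → (∀ i j → f i ≢ g j) → Inj (f ⊕ g)
  ⊕-injective {m = m} {f = f} {g} f-inj g-inj disjoint eq = splitAt-injective m (lemma _ _ eq)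
    where
    lemma : ∀ x y → [ f , g ]′ x ≡ [ f , g ]′ y → x ≡ y
    lemma (inj₁ i) (inj₁ j) e = cong inj₁ (f-inj e)
    lemma (inj₁ i) (inj₂ j) e = contradiction e (disjoint i j)
    lemma (inj₂ i) (inj₁ j) e = contradiction (sym e) (disjoint j i)
    lemma (inj₂ i) (inj₂ j) e = cong inj₂ (g-inj e)

  ⊕-all : ∀ {a p} {A : Set a} (P : Pred A p) {m n} {f : Fin m → A} {g : Fin n → A} →
          (∀ i → P (f i)) → (∀ j → P (g j)) → ∀ k → P ((f ⊕ g) k)
  ⊕-all P {m} pf pg k with splitAt m k
  ... | inj₁ i = pf i
  ... | inj₂ j = pg j

  -- A missed value, placed in front of the values of `f`, would give an injection of `suc n`
  -- elements into `n`.
  injective⇒surjective : ∀ {n} {f : Fin n → Fin n} → Inj f → ∀ y → ∃[ x ] f x ≡ y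
  injective⇒surjective {n} {f} f-inj y with Fin.any? (λ x → f x Fin.≟ y)
  ... | yes found = found
  ... | no  missed = contradiction (Fin.injective⇒≤ g-inj) 1+n≰n
    where
    g : Fin (suc n) → Fin n
    g zero    = y
    g (suc x) = f x
    g-inj : Inj g
    g-inj {zero}  {zero}  e = refl
    g-inj {zero}  {suc x} e = contradiction (x , sym e) missed
    g-inj {suc x} {zero}  e = contradiction (x , e) missed
    g-inj {suc x} {suc y} e = cong suc (f-inj e)

  -- Sizes are compared by building injections between `Fin` types, so a decidable subset is kept as
  -- an injective list and not merely as a number.
  record Enumeration {n p} (P : Pred (Fin n) p) : Set p where
    field
      size      : ℕ
      elem      : Fin size → Fin n
      injective : Inj elem
      sound     : ∀ i → P (elem i)
      complete  : ∀ {j} → P j → ∃[ i ] elem i ≡ j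

  open Enumeration public

  enumerate : ∀ {n p} {P : Pred (Fin n) p} → Decidable P → Enumeration P
  enumerate {zero} P? = record
    { size = 0 ; elem = λ () ; injective = λ { {()} } ; sound = λ () ; complete = λ { {()} } }
  enumerate {suc n} {P = P} P? with P? zero | enumerate (P? ∘ suc)
  ... | no ¬p0 | E = record
    { size = size E
    ; elem = suc ∘ elem E
    ; injective = injective E ∘ Fin.suc-injective
    ; sound = sound E
    ; complete = λ { {zero} p → contradiction p ¬p0
                   ; {suc j} p → let i , e = complete E p in i , cong suc e }
    }
  ... | yes p0 | E = record
    { size = suc (size E)
    ; elem = el
    ; injective = λ {x} {y} → el-inj x y
    ; sound = λ { zero → p0 ; (suc i) → sound E i }
    ; complete = λ { {zero} p → zero , refl
                   ; {suc j} p → let i , e = complete E p in suc i , cong suc e }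
    }
    where
    el : Fin (suc (size E)) → Fin (suc n)
    el zero    = zero
    el (suc i) = suc (elem E i)
    el-inj : ∀ x y → el x ≡ el y → x ≡ y
    el-inj zero    zero    e = refl
    el-inj (suc x) (suc y) e = cong suc (injective E (Fin.suc-injective e))

  n≤size+size : ∀ {n p q} {P : Pred (Fin n) p} {Q : Pred (Fin n) q}
                (E : Enumeration P) (E′ : Enumeration Q) → (∀ i → P i ⊎ Q i) → n ≤ size E + size E′
  n≤size+size {n} {P = P} {Q} E E′ cover = Fin.injective⇒≤ {f = f} f-inj
    where
    f′ : ∀ {i} → P i ⊎ Q i → Fin (size E) ⊎ Fin (size E′)
    f′ (inj₁ p) = inj₁ (proj₁ (complete E p))
    f′ (inj₂ q) = inj₂ (proj₁ (complete E′ q))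
    f′-elem : ∀ {i} (x : P i ⊎ Q i) → [ elem E , elem E′ ]′ (f′ x) ≡ i
    f′-elem (inj₁ p) = proj₂ (complete E p)
    f′-elem (inj₂ q) = proj₂ (complete E′ q)
    f : Fin n → Fin (size E + size E′)
    f i = join _ _ (f′ (cover i))
    f-inj : Inj f
    f-inj {i} {j} e = trans (sym (f′-elem (cover i)))
      (trans (cong [ elem E , elem E′ ]′ (join-injective (size E) (size E′) {f′ (cover i)} {f′ (cover j)} e)) (f′-elem (cover j)))

  -- All but at most one element (those satisfying Q) are mapped injectively into P.
  n≤1+size : ∀ {n N p q} {P : Pred (Fin N) p} (E : Enumeration P) {Q : Pred (Fin n) q} → Decidable Q →
             (∀ {i j} → Q i → Q j → i ≡ j) → (t : ∀ i → ¬ Q i → Fin N) → (∀ i ¬q → P (t i ¬q)) →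
             (∀ i j ¬qᵢ ¬qⱼ → t i ¬qᵢ ≡ t j ¬qⱼ → i ≡ j) → n ≤ suc (size E)
  n≤1+size {n} E {Q} Q? unique t t∈P t-inj = Fin.injective⇒≤ {f = λ i → f i (Q? i)} (λ {i} {j} → f-inj i j (Q? i) (Q? j))
    where
    f : ∀ i → Dec (Q i) → Fin (suc (size E))
    f i (yes _) = zero
    f i (no ¬q) = suc (proj₁ (complete E (t∈P i ¬q)))
    f-inj : ∀ i j dᵢ dⱼ → f i dᵢ ≡ f j dⱼ → i ≡ j
    f-inj i j (yes qᵢ) (yes qⱼ) _ = unique qᵢ qⱼ
    f-inj i j (no ¬qᵢ) (no ¬qⱼ) e = t-inj i j ¬qᵢ ¬qⱼ (trans (sym (proj₂ (complete E (t∈P i ¬qᵢ))))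
      (trans (cong (elem E) (Fin.suc-injective e)) (proj₂ (complete E (t∈P j ¬qⱼ)))))

  LargeFibre : ∀ {m n} → (Fin m → Fin n) → ℕ → Set
  LargeFibre {m} f k = ∃[ y ] Σ (Fin k → Fin m) λ g → Inj g × (∀ i → f (g i) ≡ y)

  -- Either the fibre over `zero` already has more than `k` elements, or dropping it costs at most
  -- `k` elements and one value; `punchOut` renumbers the values that remain.
  large-fibre : ∀ n k {m} (f : Fin m → Fin n) → n * k < m → LargeFibre f (suc k)
  large-fibre zero    k {suc m} f _ with () ← f zero
  large-fibre (suc n) k {m} f nk<m = go (enumerate (λ i → f i Fin.≟ zero)) (enumerate (λ i → ¬? (f i Fin.≟ zero)))
    where
    go : Enumeration (λ i → f i ≡ zero) → Enumeration (λ i → ¬ f i ≡ zero) → LargeFibre f (suc k)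
    go E E′ with suc k ≤? size E
    ... | yes k<E = zero , elem E ∘ (λ i → inject≤ i k<E) ,
          (λ e → Fin.inject≤-injective k<E k<E _ _ (injective E e)) , λ i → sound E _
    ... | no k≮E =
      let y , g , g-inj , g-fib = large-fibre n k f′ rest
      in suc y , elem E′ ∘ g , g-inj ∘ injective E′ ,
         λ i → trans (sym (Fin.punchIn-punchOut (sound E′ (g i) ∘ sym))) (cong suc (g-fib i))
      where
      f′ : Fin (size E′) → Fin n
      f′ i = punchOut (sound E′ i ∘ sym)
      cover : ∀ i → f i ≡ zero ⊎ ¬ f i ≡ zero
      cover i with f i Fin.≟ zero
      ... | yes p = inj₁ p
      ... | no ¬p = inj₂ ¬p
      rest : n * k < size E′
      rest = +-cancelˡ-< k _ _ (<-≤-trans nk<m (≤-trans (n≤size+size E E′ cover)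
               (+-monoˡ-≤ (size E′) (s≤s⁻¹ (≰⇒> k≮E)))))

-- Finite fields: linear algebra, roots of polynomials, Frobenius.

module FiniteFields where

  open Counting
  open import Algebra.Bundles using (CommutativeRing)
  open import Algebra.Structures using (IsCommutativeRing)
  open import Data.Fin.Base as Fin using (Fin; zero; suc; punchIn; toℕ; fromℕ)
  open import Data.Fin.Properties as Fin using (any?)
  import Data.Fin.Permutation as Perm
  open import Data.Nat.Base as ℕ using (ℕ; zero; suc; z≤n; s≤s; _<_; _≤_)
  import Data.Nat.Properties as ℕ
  open import Data.Nat.Combinatorics using (_C_; nCn≡1; nCk≡n!/k![n-k]!; k![n∸k]!∣n!)
  open import Data.Nat.Divisibility using (_∣_; divides; m∣m*n; ∣⇒≤; >⇒∤)
  open import Data.Nat.DivMod using (m/n*n≡m)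
  open import Data.Nat.Primality using (Prime; euclidsLemma; prime⇒nonTrivial; prime⇒nonZero)
  open import Data.Product.Base using (Σ; ∃-syntax; _×_; _,_; proj₁; proj₂)
  open import Data.Sum.Base using (_⊎_; inj₁; inj₂; [_,_]′)
  open import Data.Vec.Base as Vec using (Vec; []; _∷_)
  open import Data.Vec.Relation.Unary.All as All using (All; []; _∷_)
  open import Data.Vec.Functional using (insertAt)
  open import Data.Vec.Functional.Properties using (insertAt-lookup; insertAt-punchIn)
  open import Function.Base using (_∘_)
  open import Level using (0ℓ)
  open import Relation.Binary.PropositionalEquality
  open import Relation.Nullary using (yes; no; contradiction; ¬?)
  open import Relation.Nullary.Decidable using (decidable-stable)

  -- Finite fields live on Fin N, where equality is decidable and propositional.
  record FiniteField (N : ℕ) : Set where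
    infixl 6 _+_
    infixl 7 _*_
    infix  8 -_
    field
      _+_ _*_  : Fin N → Fin N → Fin N
      -_       : Fin N → Fin N
      0# 1#    : Fin N
      isCommutativeRing : IsCommutativeRing _≡_ _+_ _*_ -_ 0# 1#
      1≢0      : 1# ≢ 0#
      inverse  : ∀ x → x ≢ 0# → ∃[ y ] x * y ≡ 1#

    commutativeRing : CommutativeRing 0ℓ 0ℓ
    commutativeRing = record { isCommutativeRing = isCommutativeRing }

  module FieldTheory {N} (𝔽 : FiniteField N) where

    open FiniteField 𝔽 public using (1≢0; inverse; commutativeRing)
    open CommutativeRing commutativeRing public
      using ( Carrier; _+_; _*_; -_; _-_; 0#; 1#; semiring; commutativeSemiring; *-commutativeMonoid
            ; +-comm; +-assoc; +-identityˡ; +-identityʳ; *-comm; *-assoc; *-identityˡ; *-identityʳ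
            ; zeroˡ; zeroʳ; distribˡ; distribʳ; -‿inverseʳ; -‿inverseˡ)
    open DifferenceSolver commutativeRing public
    open import Algebra.Properties.Semiring.Sum semiring public
      using (sum; sum-cong-≗; sum-remove; ∑-distrib-+; ∑-comm; sum-permute; *-distribˡ-sum; *-distribʳ-sum; sum-replicate; sum-replicate-zero)
    open import Algebra.Properties.Semiring.Exp semiring public using (_^_; ^-homo-*; ^-assocʳ)
    open import Algebra.Properties.CommutativeMonoid.Mult *-commutativeMonoid public
      renaming (×-distrib-+ to ^-distrib-*) using ()
    open import Algebra.Properties.Semiring.Mult semiring
      using (×1-homo-*; ×-assoc-*; ×-comm-*; ×-assocˡ) renaming (_×_ to _·_)
    import Algebra.Properties.CommutativeMonoid.Sum *-commutativeMonoid as Π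
    open ≡-Reasoning

    -- Field arithmetic

    infix 4 _≟_
    _≟_ : (x y : Carrier) → _
    _≟_ = Fin._≟_

    *-cancelˡ : ∀ {x y z} → x ≢ 0# → x * y ≡ x * z → y ≡ z
    *-cancelˡ {x} {y} {z} x≢0 xy≡xz = let x⁻¹ , xx⁻¹≡1 = inverse x x≢0 in begin
      y               ≡⟨ *-identityˡ y ⟨
      1# * y          ≡⟨ cong (_* y) xx⁻¹≡1 ⟨
      x * x⁻¹ * y     ≡⟨ solve 3 (λ x i y → x :* i :* y := i :* (x :* y)) refl x x⁻¹ y ⟩
      x⁻¹ * (x * y)   ≡⟨ cong (x⁻¹ *_) xy≡xz ⟩
      x⁻¹ * (x * z)   ≡⟨ solve 3 (λ x i y → x :* i :* y := i :* (x :* y)) refl x x⁻¹ z ⟨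
      x * x⁻¹ * z     ≡⟨ cong (_* z) xx⁻¹≡1 ⟩
      1# * z          ≡⟨ *-identityˡ z ⟩
      z               ∎

    *-≢0 : ∀ {x y} → x ≢ 0# → y ≢ 0# → x * y ≢ 0#
    *-≢0 {x} x≢0 y≢0 xy≡0 = y≢0 (*-cancelˡ x≢0 (trans xy≡0 (sym (zeroʳ x))))

    *≡0ʳ : ∀ {x y} → x ≢ 0# → x * y ≡ 0# → y ≡ 0#
    *≡0ʳ {x} x≢0 xy≡0 = *-cancelˡ x≢0 (trans xy≡0 (sym (zeroʳ x)))

    x-y≡0⇒x≡y : ∀ {x y} → x - y ≡ 0# → x ≡ y
    x-y≡0⇒x≡y {x} {y} x-y≡0 = begin
      x           ≡⟨ solve 2 (λ x y → x := x :- y :+ y) refl x y ⟩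
      x - y + y   ≡⟨ cong (_+ y) x-y≡0 ⟩
      0# + y      ≡⟨ +-identityˡ y ⟩
      y           ∎

    x≡y⇒x-y≡0 : ∀ {x y} → x ≡ y → x - y ≡ 0#
    x≡y⇒x-y≡0 {x} refl = -‿inverseʳ x

    inverse-≢0 : ∀ {x y} → x * y ≡ 1# → y ≢ 0#
    inverse-≢0 {x} xy≡1 y≡0 = 1≢0 (trans (sym xy≡1) (trans (cong (x *_) y≡0) (zeroʳ x)))

    -- Finite sums

    sum-zero : ∀ {n} {f : Fin n → Carrier} → (∀ i → f i ≡ 0#) → sum f ≡ 0#
    sum-zero {n} f≡0 = trans (sum-cong-≗ f≡0) (sum-replicate-zero n)

    sum-+* : ∀ {n} c (f g : Fin n → Carrier) → sum (λ i → f i + c * g i) ≡ sum f + c * sum g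
    sum-+* c f g = trans (∑-distrib-+ f (λ i → c * g i)) (cong (sum f +_) (sym (*-distribˡ-sum c g)))

    sum-single : ∀ {n} {f : Fin n → Carrier} i → (∀ j → j ≢ i → f j ≡ 0#) → sum f ≡ f i
    sum-single {suc n} {f} i f≡0 = trans (sum-remove {i = i} f)
      (trans (cong (f i +_) (sum-zero λ k → f≡0 _ (Fin.punchInᵢ≢i i k))) (+-identityʳ (f i)))

    sum-pair : ∀ {n} {f : Fin n → Carrier} {i j} → i ≢ j →
               (∀ k → k ≢ i → k ≢ j → f k ≡ 0#) → sum f ≡ f i + f j
    sum-pair {suc n} {f} {i} {j} i≢j f≡0 = trans (sum-remove {i = i} f) (cong (f i +_)
      (trans (sum-single (Fin.punchOut i≢j) λ k k≢ → f≡0 _ (Fin.punchInᵢ≢i i k)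
               λ e → k≢ (Fin.punchIn-injective i _ _ (trans e (sym (Fin.punchIn-punchOut i≢j)))))
             (cong f (Fin.punchIn-punchOut i≢j))))

    -- Linear algebra

    NonZeroVector : ∀ {n} → (Fin n → Carrier) → Set
    NonZeroVector x = ∃[ i ] x i ≢ 0#

    nonzero? : ∀ {n} (x : Fin n → Carrier) → NonZeroVector x ⊎ (∀ i → x i ≡ 0#)
    nonzero? x with any? (λ i → ¬? (x i ≟ 0#))
    ... | yes found = inj₁ found
    ... | no  none  = inj₂ λ i → decidable-stable (x i ≟ 0#) λ ≢0 → none (i , ≢0)

    infix 7 _∙_
    _∙_ : ∀ {n} → (Fin n → Carrier) → (Fin n → Carrier) → Carrier
    x ∙ y = sum (λ i → x i * y i)

    combination : ∀ {n m} → (Fin n → Carrier) → (Fin n → Fin m → Carrier) → Fin m → Carrier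
    combination x p j = x ∙ (λ i → p i j)

    Annihilated : ∀ {n m} → (Fin n → Fin m → Carrier) → Set
    Annihilated {n} {m} p = Σ (Fin m → Carrier) λ α → NonZeroVector α × (∀ i → α ∙ p i ≡ 0#)

    Spanning : ∀ {n m} → (Fin n → Fin m → Carrier) → Set
    Spanning {n} {m} p = ∀ (v : Fin m → Carrier) → Σ (Fin n → Carrier) λ x → ∀ j → v j ≡ combination x p j

    -- Gaussian elimination, one coordinate at a time. The inequality is carried along in the
    -- spanning case because it yields both corollaries: too few vectors have a common annihilator,
    -- and, read on the transposed matrix, too many vectors are dependent.
    annihilated-or-spanning : ∀ n m (p : Fin n → Fin m → Carrier) →
                              Annihilated p ⊎ (m ≤ n × Spanning p)
    annihilated-or-spanning n zero p = inj₂ (z≤n , λ v → (λ _ → 0#) , λ ())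
    annihilated-or-spanning n (suc m) p with any? (λ i → ¬? (p i zero ≟ 0#))
    ... | no none = inj₁ (e₀ , (zero , 1≢0) , λ i → trans (sum-single {f = λ j → e₀ j * p i j} zero
              λ { zero 0≢0 → contradiction refl 0≢0 ; (suc j) _ → zeroˡ _ })
              (trans (*-identityˡ _) (head≡0 i)))
      where
      e₀ : Fin (suc m) → Carrier
      e₀ zero    = 1#
      e₀ (suc _) = 0#
      head≡0 : ∀ i → p i zero ≡ 0#
      head≡0 i with p i zero ≟ 0#
      ... | yes e = e
      ... | no ≢0 = contradiction (i , ≢0) none
    annihilated-or-spanning (suc n) (suc m) p | yes (i , pᵢ₀≢0) = extend (annihilated-or-spanning n m p′)
      where
      c = proj₁ (inverse (p i zero) pᵢ₀≢0)
      pᵢ₀c≡1 = proj₂ (inverse (p i zero) pᵢ₀≢0)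
      p′ : Fin n → Fin m → Carrier
      p′ k j = p (punchIn i k) (suc j) + - (p (punchIn i k) zero * c) * p i (suc j)

      extend : Annihilated p′ ⊎ (m ≤ n × Spanning p′) → Annihilated p ⊎ (suc m ≤ suc n × Spanning p)
      extend (inj₁ (α′ , (j₀ , α′≢0) , kills)) = inj₁ (α , (suc j₀ , α′≢0) , α-kills)
        where
        S = α′ ∙ (p i ∘ suc)
        α : Fin (suc m) → Carrier
        -- Forced by the requirement that `α` kill the pivot `p i`. Every other vector differs from
        -- its reduced form by a multiple of the pivot.
        α zero    = - (c * S)
        α (suc j) = α′ j
        α-kills : ∀ l → α ∙ p l ≡ 0#
        α-kills l with l Fin.≟ i
        ... | yes refl = begin
          - (c * S) * p i zero + S   ≡⟨ solve 3 (λ c S x → :- (c :* S) :* x :+ S := S :* (:1 :- x :* c)) refl c S (p i zero) ⟩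
          S * (1# - p i zero * c)    ≡⟨ cong (λ z → S * (1# - z)) pᵢ₀c≡1 ⟩
          S * (1# - 1#)              ≡⟨ solve 1 (λ S → S :* (:1 :- :1) := :0) refl S ⟩
          0#                         ∎
        ... | no l≢i = begin
          - (c * S) * p l zero + T   ≡⟨ solve 4 (λ c S x T → :- (c :* S) :* x :+ T := T :+ :- (x :* c) :* S) refl c S (p l zero) T ⟩
          T + - (p l zero * c) * S   ≡⟨ cong (λ z → α′ ∙ (p z ∘ suc) + - (p z zero * c) * S) k≡l ⟨
          α′ ∙ (p (punchIn i k) ∘ suc) + - (p (punchIn i k) zero * c) * S
            ≡⟨ sum-+* _ (λ j → α′ j * p (punchIn i k) (suc j)) (λ j → α′ j * p i (suc j)) ⟨
          sum (λ j → α′ j * p (punchIn i k) (suc j) + - (p (punchIn i k) zero * c) * (α′ j * p i (suc j)))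
            ≡⟨ sum-cong-≗ (λ j → solve 4 (λ a x y z → a :* x :+ y :* (a :* z) := a :* (x :+ y :* z)) refl
                 (α′ j) (p (punchIn i k) (suc j)) (- (p (punchIn i k) zero * c)) (p i (suc j))) ⟩
          α′ ∙ p′ k                  ≡⟨ kills k ⟩
          0#                         ∎
          where
          T = α′ ∙ (p l ∘ suc)
          k = Fin.punchOut (l≢i ∘ sym)
          k≡l : punchIn i k ≡ l
          k≡l = Fin.punchIn-punchOut (l≢i ∘ sym)
      extend (inj₂ (m≤n , spans)) = inj₂ (s≤s m≤n , span)
        where
        span : Spanning p
        span v = x , λ j → sym (trans (pivot-first j) (span-at j))
          where
          v′ : Fin m → Carrier
          v′ j = v (suc j) + - (v zero * c) * p i (suc j)
          x′ = proj₁ (spans v′)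
          S₀ = sum (λ k → x′ k * p (punchIn i k) zero)
          -- The reduced system determines the other coefficients; this one corrects coordinate
          -- zero. The later coordinates come out right because `v′` was reduced by the same pivot.
          xᵢ = c * (v zero - S₀)
          x = insertAt x′ i xᵢ
          rest : Fin (suc m) → Carrier
          rest j = sum (λ k → x′ k * p (punchIn i k) j)
          pivot-first : ∀ j → combination x p j ≡ xᵢ * p i j + rest j
          pivot-first j = trans (sum-remove {i = i} (λ l → x l * p l j)) (cong₂ _+_
            (cong (_* p i j) (insertAt-lookup x′ i xᵢ))
            (sum-cong-≗ λ k → cong (_* p (punchIn i k) j) (insertAt-punchIn x′ i xᵢ k)))
          span-at : ∀ j → xᵢ * p i j + rest j ≡ v j
          span-at zero = begin
            c * (v zero - S₀) * p i zero + S₀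
              ≡⟨ solve 4 (λ c v S x → c :* (v :- S) :* x :+ S := (v :- S) :* (x :* c) :+ S) refl c (v zero) S₀ (p i zero) ⟩
            (v zero - S₀) * (p i zero * c) + S₀ ≡⟨ cong (λ z → (v zero - S₀) * z + S₀) pᵢ₀c≡1 ⟩
            (v zero - S₀) * 1# + S₀ ≡⟨ solve 2 (λ v S → (v :- S) :* :1 :+ S := v) refl (v zero) S₀ ⟩
            v zero ∎
          span-at (suc j) = begin
            c * (v zero - S₀) * y + R
              ≡⟨ solve 5 (λ c v S y R → c :* (v :- S) :* y :+ R := (R :+ :- (c :* y) :* S) :+ v :* c :* y) refl c (v zero) S₀ y R ⟩
            (R + - (c * y) * S₀) + v zero * c * y ≡⟨ cong (λ z → z + v zero * c * y) reduced ⟨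
            v′ j + v zero * c * y
              ≡⟨ solve 4 (λ v c y w → w :+ :- (v :* c) :* y :+ v :* c :* y := w) refl (v zero) c y (v (suc j)) ⟩
            v (suc j) ∎
            where
            y = p i (suc j)
            R = rest (suc j)
            reduced : v′ j ≡ R + - (c * y) * S₀
            reduced = begin
              v′ j ≡⟨ proj₂ (spans v′) j ⟩
              sum (λ k → x′ k * p′ k j)
                ≡⟨ sum-cong-≗ (λ k → solve 5 (λ x z w c y → x :* (w :+ :- (z :* c) :* y) := x :* w :+ :- (c :* y) :* (x :* z)) refl
                     (x′ k) (p (punchIn i k) zero) (p (punchIn i k) (suc j)) c y) ⟩
              sum (λ k → x′ k * p (punchIn i k) (suc j) + - (c * y) * (x′ k * p (punchIn i k) zero))
                ≡⟨ sum-+* _ (λ k → x′ k * p (punchIn i k) (suc j)) (λ k → x′ k * p (punchIn i k) zero) ⟩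
              R + - (c * y) * S₀ ∎

    fewer-annihilated : ∀ {n m} → n < m → (p : Fin n → Fin m → Carrier) → Annihilated p
    fewer-annihilated {n} {m} n<m p with annihilated-or-spanning n m p
    ... | inj₁ ann        = ann
    ... | inj₂ (m≤n , _)  = contradiction (ℕ.<-≤-trans n<m m≤n) (ℕ.<-irrefl refl)

    more-dependent : ∀ {n m} → m < n → (p : Fin n → Fin m → Carrier) →
                     ∃[ x ] NonZeroVector x × (∀ j → combination x p j ≡ 0#)
    more-dependent m<n p = fewer-annihilated m<n (λ j i → p i j)

    -- Polynomials

    eval : ∀ {m} → Vec Carrier m → Carrier → Carrier
    eval []       t = 0#
    eval (c ∷ cs) t = c + t * eval cs t

    private
      quotient : ∀ {m} → Vec Carrier (suc m) → Carrier → Vec Carrier m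
      quotient (c ∷ [])     r = []
      quotient (c ∷ d ∷ ds) r = eval (d ∷ ds) r ∷ quotient (d ∷ ds) r

      quotient-eval : ∀ {m} (c : Vec Carrier (suc m)) r t →
                      eval c t ≡ eval c r + (t - r) * eval (quotient c r) t
      quotient-eval (c ∷ []) r t =
        solve 3 (λ c r t → c :+ t :* :0 := (c :+ r :* :0) :+ (t :- r) :* :0) refl c r t
      quotient-eval (c ∷ d ∷ ds) r t = begin
        c + t * D t ≡⟨ cong (λ z → c + t * z) (quotient-eval (d ∷ ds) r t) ⟩
        c + t * (D r + (t - r) * Q)
          ≡⟨ solve 5 (λ c t r D Q → c :+ t :* (D :+ (t :- r) :* Q) := (c :+ r :* D) :+ (t :- r) :* (D :+ t :* Q)) refl c t r (D r) Q ⟩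
        (c + r * D r) + (t - r) * (D r + t * Q) ∎
        where
        D = eval (d ∷ ds)
        Q = eval (quotient (d ∷ ds) r) t

      quotient-zero : ∀ {m} (c : Vec Carrier (suc m)) r → eval c r ≡ 0# →
                      All (_≡ 0#) (quotient c r) → All (_≡ 0#) c
      quotient-zero (c ∷ []) r c≡0 [] =
        trans (solve 2 (λ c r → c := c :+ r :* :0) refl c r) c≡0 ∷ []
      quotient-zero (c ∷ d ∷ ds) r c≡0 (D≡0 ∷ Q≡0) =
        trans (solve 2 (λ c r → c := c :+ r :* :0) refl c r) (trans (cong (λ z → c + r * z) (sym D≡0)) c≡0)
        ∷ quotient-zero (d ∷ ds) r D≡0 Q≡0

    -- A vector of `m` coefficients is a polynomial of degree below `m`. Division by the factor of
    -- the first root leaves one coefficient fewer and keeps all other roots, as they differ from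
    -- the first.
    roots⇒zero : ∀ {m} (c : Vec Carrier m) (r : Fin m → Carrier) → Inj r →
                 (∀ i → eval c (r i) ≡ 0#) → All (_≡ 0#) c
    roots⇒zero [] r _ _ = []
    roots⇒zero c@(_ ∷ _) r r-inj roots = quotient-zero c (r zero) (roots zero)
      (roots⇒zero (quotient c (r zero)) (r ∘ suc) (Fin.suc-injective ∘ r-inj) λ i →
        *≡0ʳ (λ e → contradiction (r-inj (x-y≡0⇒x≡y e)) λ ()) (begin
          (r (suc i) - r zero) * Q i                      ≡⟨ +-identityˡ _ ⟨
          0# + (r (suc i) - r zero) * Q i                 ≡⟨ cong (λ z → z + (r (suc i) - r zero) * Q i) (roots zero) ⟨
          eval c (r zero) + (r (suc i) - r zero) * Q i    ≡⟨ quotient-eval c (r zero) (r (suc i)) ⟨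
          eval c (r (suc i))                              ≡⟨ roots (suc i) ⟩
          0#                                              ∎))
      where
      Q = λ i → eval (quotient c (r zero)) (r (suc i))

    eval-++ : ∀ {m n} (c : Vec Carrier m) (d : Vec Carrier n) t →
              eval (c Vec.++ d) t ≡ eval c t + t ^ m * eval d t
    eval-++ []       d t = solve 1 (λ x → x := :0 :+ :1 :* x) refl (eval d t)
    eval-++ {suc m} (c ∷ cs) d t = trans (cong (λ z → c + t * z) (eval-++ cs d t))
      (solve 5 (λ c t x p y → c :+ t :* (x :+ p :* y) := (c :+ t :* x) :+ t :* p :* y) refl
        c t (eval cs t) (t ^ m) (eval d t))

    eval-zeros : ∀ m t → eval (Vec.replicate m 0#) t ≡ 0#
    eval-zeros zero    t = refl
    eval-zeros (suc m) t = trans (cong (λ z → 0# + t * z) (eval-zeros m t))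
      (solve 1 (λ t → :0 :+ t :* :0 := :0) refl t)

    -- The Frobenius endomorphism

    -- With h(0) = 1 and h(y) = y otherwise, x h(y) = h(xy) for y ≠ 0; multiply over all y.
    x^N≡x : ∀ x → x ^ N ≡ x
    x^N≡x x with x ≟ 0#
    ... | yes refl = 0^n≡0 0#
      where
      0^n≡0 : ∀ {n} → Fin n → 0# ^ n ≡ 0#
      0^n≡0 {suc n} _ = zeroˡ _
    ... | no x≢0 = *-cancelˡ Πh≢0 (trans (*-comm _ _) (trans eq (*-comm _ _)))
      where
      h h′ : Carrier → Carrier
      h y with y ≟ 0#
      ... | yes _ = 1#
      ... | no  _ = y
      h′ y with y ≟ 0#
      ... | yes _ = x
      ... | no  _ = 1#
      x⁻¹ = proj₁ (inverse x x≢0)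
      cancel : ∀ y → x * (x⁻¹ * y) ≡ y
      cancel y = trans (sym (*-assoc _ _ _)) (trans (cong (_* y) (proj₂ (inverse x x≢0))) (*-identityˡ y))
      π : Perm.Permutation N N
      π = Perm.permutation (x *_) (x⁻¹ *_) cancel
            λ y → trans (solve 3 (λ x i y → i :* (x :* y) := x :* (i :* y)) refl x x⁻¹ y) (cancel y)
      pointwise : ∀ y → x * h y ≡ h (x * y) * h′ y
      pointwise y with y ≟ 0# | x * y ≟ 0#
      ... | yes _    | yes _   = trans (*-comm _ _) refl
      ... | yes refl | no ≢0   = contradiction (zeroʳ x) ≢0
      ... | no y≢0   | yes xy≡0 = contradiction xy≡0 (*-≢0 x≢0 y≢0)
      ... | no _     | no _    = sym (*-identityʳ _)
      h≢0 : ∀ y → h y ≢ 0#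
      h≢0 y with y ≟ 0#
      ... | yes _  = 1≢0
      ... | no y≢0 = y≢0
      Π-≢0 : ∀ {n} (f : Fin n → Carrier) → (∀ i → f i ≢ 0#) → Π.sum f ≢ 0#
      Π-≢0 {zero}  f _ = 1≢0
      Π-≢0 {suc n} f f≢0 = *-≢0 (f≢0 zero) (Π-≢0 (f ∘ suc) (f≢0 ∘ suc))
      Πh≢0 = Π-≢0 h h≢0
      h′-single : ∀ {n} (f : Fin n → Carrier) i → (∀ j → j ≢ i → f j ≡ 1#) → Π.sum f ≡ f i
      h′-single {suc n} f i f≡1 = trans (Π.sum-remove {i = i} f) (trans (cong (f i *_)
        (trans (Π.sum-cong-≗ λ k → f≡1 _ (Fin.punchInᵢ≢i i k)) (Π.sum-replicate-zero n))) (*-identityʳ (f i)))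
      Πh′≡x : Π.sum h′ ≡ x
      Πh′≡x = trans (h′-single h′ 0# h′≡1) h′0≡x
        where
        h′≡1 : ∀ j → j ≢ 0# → h′ j ≡ 1#
        h′≡1 j j≢0 with j ≟ 0#
        ... | yes e = contradiction e j≢0
        ... | no _  = refl
        h′0≡x : h′ 0# ≡ x
        h′0≡x with 0# ≟ 0#
        ... | yes _ = refl
        ... | no ≢0 = contradiction refl ≢0
      eq : x ^ N * Π.sum h ≡ x * Π.sum h
      eq = begin
        x ^ N * Π.sum h                        ≡⟨ cong (_* Π.sum h) (Π.sum-replicate N) ⟨
        Π.sum {N} (λ _ → x) * Π.sum h          ≡⟨ Π.∑-distrib-+ {N} (λ _ → x) h ⟨
        Π.sum (λ y → x * h y)                  ≡⟨ Π.sum-cong-≗ pointwise ⟩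
        Π.sum (λ y → h (x * y) * h′ y)         ≡⟨ Π.∑-distrib-+ (λ y → h (x * y)) h′ ⟩
        Π.sum (λ y → h (x * y)) * Π.sum h′     ≡⟨ cong₂ _*_ (sym (Π.sum-permute h π)) Πh′≡x ⟩
        Π.sum h * x                            ≡⟨ *-comm _ _ ⟩
        x * Π.sum h                            ∎

    -- Translation by `1#` permutes the field, so the sum of all elements is unchanged when `1#` is
    -- added to each of the `N` summands.
    N·1≡0 : N · 1# ≡ 0#
    N·1≡0 = begin
      N · 1#                                   ≡⟨ solve 2 (λ a s → a := (s :+ a) :- s) refl (N · 1#) (sum {N} (λ y → y)) ⟩
      (sum {N} (λ y → y) + N · 1#) - sum {N} (λ y → y)
        ≡⟨ cong (λ z → (sum {N} (λ y → y) + z) - sum {N} (λ y → y)) (sum-replicate N) ⟨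
      (sum {N} (λ y → y) + sum {N} (λ _ → 1#)) - sum {N} (λ y → y)
        ≡⟨ cong (_- sum {N} (λ y → y)) (∑-distrib-+ {N} (λ y → y) (λ _ → 1#)) ⟨
      sum {N} (λ y → y + 1#) - sum {N} (λ y → y) ≡⟨ x≡y⇒x-y≡0 (sym (sum-permute {N} (λ y → y) π)) ⟩
      0#                                       ∎
      where
      π : Perm.Permutation N N
      π = Perm.permutation (_+ 1#) (_- 1#)
            (λ y → solve 1 (λ y → y :- :1 :+ :1 := y) refl y) (λ y → solve 1 (λ y → y :+ :1 :- :1 := y) refl y)

    module PrimePower {p e} (p-prime : Prime p) (N≡p^e : N ≡ p ℕ.^ e) where

      -- `N · 1#` is a power of `p · 1#`, and a field has no nilpotent elements besides zero.
      p·1≡0 : p · 1# ≡ 0#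
      p·1≡0 = root e (trans (cong (_· 1#) (sym N≡p^e)) N·1≡0)
        where
        root : ∀ k → (p ℕ.^ k) · 1# ≡ 0# → p · 1# ≡ 0#
        root zero    1·1≡0 = contradiction (trans (sym (+-identityʳ 1#)) 1·1≡0) 1≢0
        root (suc k) eq with p · 1# ≟ 0#
        ... | yes p≡0 = p≡0
        ... | no  p≢0 = root k (*≡0ʳ p≢0 (trans (sym (×1-homo-* p (p ℕ.^ k))) eq))

      p∣m⇒m·x≡0 : ∀ {m} x → p ∣ m → m · x ≡ 0#
      p∣m⇒m·x≡0 x (divides k refl) = begin
        (k ℕ.* p) · x            ≡⟨ cong ((k ℕ.* p) ·_) (*-identityˡ x) ⟨
        (k ℕ.* p) · (1# * x)     ≡⟨ ×-assoc-* (k ℕ.* p) 1# x ⟨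
        ((k ℕ.* p) · 1#) * x     ≡⟨ cong (_* x) (trans (×1-homo-* k p) (trans (cong (k · 1# *_) p·1≡0) (zeroʳ _))) ⟩
        0# * x                   ≡⟨ zeroˡ x ⟩
        0#                       ∎

      -- `p` divides the factorial of `p` but neither factorial of the denominator, both being taken
      -- at numbers below `p`.
      p∣pCk : ∀ {k} → 0 < k → k < p → p ∣ p C k
      p∣pCk {k} 0<k k<p with euclidsLemma (p C k) (k ℕ.! ℕ.* (p ℕ.∸ k) ℕ.!) p-prime p∣product
        where
        instance _ = prime⇒nonZero p-prime
        instance _ = k ℕ.!* (p ℕ.∸ k) !≢0
        p∣p! : ∀ m .{{_ : ℕ.NonZero m}} → m ∣ m ℕ.!
        p∣p! (suc m) = m∣m*n (m ℕ.!)
        p∣product : p ∣ (p C k) ℕ.* (k ℕ.! ℕ.* (p ℕ.∸ k) ℕ.!)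
        p∣product = subst (p ∣_) (sym (trans (cong (λ z → z ℕ.* (k ℕ.! ℕ.* (p ℕ.∸ k) ℕ.!)) (nCk≡n!/k![n-k]! (ℕ.<⇒≤ k<p)))
          (m/n*n≡m (k![n∸k]!∣n! (ℕ.<⇒≤ k<p))))) (p∣p! p)
      ... | inj₁ p∣C = p∣C
      ... | inj₂ p∣!! = [ p∤m! k<p , p∤m! p∸k<p ]′ (euclidsLemma (k ℕ.!) ((p ℕ.∸ k) ℕ.!) p-prime p∣!!)
        where
        p∸k<p : p ℕ.∸ k < p
        p∸k<p = ℕ.∸-monoʳ-< 0<k (ℕ.<⇒≤ k<p)
        p∤m! : ∀ {m ℓ} {A : Set ℓ} → m < p → p ∣ m ℕ.! → A
        p∤m! {zero}  _ p∣1 = contradiction (∣⇒≤ p∣1) (ℕ.<⇒≱ (ℕ.nonTrivial⇒n>1 p {{prime⇒nonTrivial p-prime}}))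
        p∤m! {suc m} m<p p∣ with euclidsLemma (suc m) (m ℕ.!) p-prime p∣
        ... | inj₁ p∣m  = contradiction p∣m (>⇒∤ m<p)
        ... | inj₂ p∣m! = p∤m! (ℕ.<-trans ℕ.≤-refl m<p) p∣m!

      open import Algebra.Properties.CommutativeSemiring.Binomial commutativeSemiring using (theorem)
      open import Algebra.Properties.Semiring.Binomial semiring using (binomialTerm)

      ^p-homo-+ : ∀ x y → (x + y) ^ p ≡ x ^ p + y ^ p
      ^p-homo-+ x y = begin
        (x + y) ^ p                            ≡⟨ theorem p x y ⟩
        sum (binomialTerm x y p)               ≡⟨ sum-pair {i = fromℕ p} {j = zero} top≢0 middle ⟩
        binomialTerm x y p (fromℕ p) + binomialTerm x y p zero ≡⟨ cong₂ _+_ top bottom ⟩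
        x ^ p + y ^ p                          ∎
        where
        0<p : 0 < p
        0<p = ℕ.>-nonZero⁻¹ p {{prime⇒nonZero p-prime}}
        top≢0 : fromℕ p ≢ zero
        top≢0 e = ℕ.<-irrefl (trans (sym (cong toℕ e)) (Fin.toℕ-fromℕ p)) 0<p
        middle : ∀ k → k ≢ fromℕ p → k ≢ zero → binomialTerm x y p k ≡ 0#
        middle k k≢p k≢0 = p∣m⇒m·x≡0 _ (p∣pCk
          (ℕ.n≢0⇒n>0 λ e → k≢0 (Fin.toℕ-injective e))
          (ℕ.≤∧≢⇒< (ℕ.s≤s⁻¹ (Fin.toℕ<n k)) λ e → k≢p (Fin.toℕ-injective (trans e (sym (Fin.toℕ-fromℕ p))))))
        top : binomialTerm x y p (fromℕ p) ≡ x ^ p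
        top = trans (cong (λ k → (p C k) · (x ^ k * y ^ (p ℕ.∸ k))) (Fin.toℕ-fromℕ p))
          (trans (cong₂ (λ a b → a · (x ^ p * y ^ b)) (nCn≡1 p) (ℕ.n∸n≡0 p))
            (solve 1 (λ z → z :* :1 :+ :0 := z) refl (x ^ p)))
        bottom : binomialTerm x y p zero ≡ y ^ p
        bottom = trans (cong (_· (1# * y ^ p)) (pC0≡1)) (solve 1 (λ z → :1 :* z :+ :0 := z) refl (y ^ p))
          where
          open import Data.Nat.Combinatorics using (nCk≡nC[n∸k])
          pC0≡1 : p C 0 ≡ 1
          pC0≡1 = trans (nCk≡nC[n∸k] {0} {p} z≤n) (nCn≡1 p)

      ^p^k-homo-+ : ∀ k x y → (x + y) ^ (p ℕ.^ k) ≡ x ^ (p ℕ.^ k) + y ^ (p ℕ.^ k)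
      ^p^k-homo-+ zero x y = solve 2 (λ x y → (x :+ y) :* :1 := x :* :1 :+ y :* :1) refl x y
      ^p^k-homo-+ (suc k) x y = begin
        (x + y) ^ (p ℕ.* p ℕ.^ k)                    ≡⟨ ^-assocʳ (x + y) p (p ℕ.^ k) ⟨
        ((x + y) ^ p) ^ (p ℕ.^ k)                    ≡⟨ cong (_^ (p ℕ.^ k)) (^p-homo-+ x y) ⟩
        (x ^ p + y ^ p) ^ (p ℕ.^ k)                  ≡⟨ ^p^k-homo-+ k (x ^ p) (y ^ p) ⟩
        (x ^ p) ^ (p ℕ.^ k) + (y ^ p) ^ (p ℕ.^ k)    ≡⟨ cong₂ _+_ (^-assocʳ x p (p ℕ.^ k)) (^-assocʳ y p (p ℕ.^ k)) ⟩
        x ^ (p ℕ.* p ℕ.^ k) + y ^ (p ℕ.* p ℕ.^ k)    ∎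

-- The cubic extension: trace, norm, tensors and the cubic form.

module CubicExtensions where

  open Counting
  open FiniteFields
  open import Data.Fin.Base as Fin using (Fin; zero; suc)
  open import Data.Fin.Patterns using (0F; 1F; 2F; 3F; 4F; 5F; 6F; 7F)
  open import Data.Fin.Properties as Fin using (any?)
  import Data.Fin.Permutation as Perm
  open import Data.Nat.Base as ℕ using (ℕ; zero; suc; _≤_; s≤s; z≤n)
  import Data.Nat.Properties as ℕ
  open import Data.Nat.Primality using (Prime)
  open import Data.Product.Base using (∃-syntax; _×_; _,_; proj₂)
  open import Data.Vec.Base as Vec using (Vec; []; _∷_)
  open import Data.Vec.Relation.Unary.All as All using (All; []; _∷_)
  open import Data.Vec.Relation.Unary.All.Properties using (++⁻)
  import Data.Vec.Functional as V
  open import Function.Base using (_∘_)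
  open import Relation.Binary.PropositionalEquality
  open import Relation.Nullary using (yes; no; contradiction)

  record FiniteCubicExtension (q : ℕ) : Set where
    field
      {p k}   : ℕ
      p-prime : Prime p
      q≡p^1+k : q ≡ p ℕ.^ suc k
      4≤q     : 4 ≤ q
      K       : FiniteField q
      F       : FiniteField (q ℕ.^ 3)
      ι       : Fin q → Fin (q ℕ.^ 3)
    module 𝕂 = FiniteField K
    module 𝔽 = FiniteField F
    field
      ι-injective : Inj ι
      ι-+ : ∀ x y → ι (x 𝕂.+ y) ≡ ι x 𝔽.+ ι y
      ι-* : ∀ x y → ι (x 𝕂.* y) ≡ ι x 𝔽.* ι y
      ι-0 : ι 𝕂.0# ≡ 𝔽.0#
      ι-1 : ι 𝕂.1# ≡ 𝔽.1#

  module Theory {q} (E : FiniteCubicExtension q) where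

    open FiniteCubicExtension E using (p; k; p-prime; q≡p^1+k)
    open FiniteCubicExtension E public using (4≤q; ι; ι-injective; ι-+; ι-*; ι-0; ι-1)
    module K = FieldTheory (FiniteCubicExtension.K E)
    open FieldTheory (FiniteCubicExtension.F E) public
    open ≡-Reasoning

    -- The automorphism of order three

    σ : Carrier → Carrier
    σ x = x ^ q

    private
      q^3≡p^e : q ℕ.^ 3 ≡ p ℕ.^ (suc k ℕ.* 3)
      q^3≡p^e = trans (cong (ℕ._^ 3) q≡p^1+k) (ℕ.^-*-assoc p (suc k) 3)

    open PrimePower {e = suc k ℕ.* 3} p-prime q^3≡p^e using (^p^k-homo-+)

    σ-+ : ∀ x y → σ (x + y) ≡ σ x + σ y
    σ-+ x y = subst (λ n → (x + y) ^ n ≡ x ^ n + y ^ n) (sym q≡p^1+k) (^p^k-homo-+ (suc k) x y)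

    σ-* : ∀ x y → σ (x * y) ≡ σ x * σ y
    σ-* x y = ^-distrib-* x y q

    σ-0 : σ 0# ≡ 0#
    σ-0 = begin
      σ 0#                       ≡⟨ solve 1 (λ x → x := (x :+ x) :- x) refl (σ 0#) ⟩
      (σ 0# + σ 0#) - σ 0#       ≡⟨ x≡y⇒x-y≡0 (trans (sym (σ-+ 0# 0#)) (cong σ (+-identityˡ 0#))) ⟩
      0#                         ∎

    σ-neg : ∀ x → σ (- x) ≡ - σ x
    σ-neg x = begin
      σ (- x)                    ≡⟨ solve 2 (λ a b → b := (a :+ b) :- a) refl (σ x) (σ (- x)) ⟩
      (σ x + σ (- x)) - σ x      ≡⟨ cong (_- σ x) (trans (sym (σ-+ x (- x))) (trans (cong σ (-‿inverseʳ x)) σ-0)) ⟩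
      0# - σ x                   ≡⟨ +-identityˡ _ ⟩
      - σ x                      ∎

    σσ≡^q*q : ∀ x → σ (σ x) ≡ x ^ (q ℕ.* q)
    σσ≡^q*q x = ^-assocʳ x q q

    σ³ : ∀ x → σ (σ (σ x)) ≡ x
    σ³ x = begin
      ((x ^ q) ^ q) ^ q    ≡⟨ cong (_^ q) (σσ≡^q*q x) ⟩
      (x ^ (q ℕ.* q)) ^ q  ≡⟨ ^-assocʳ x (q ℕ.* q) q ⟩
      x ^ (q ℕ.* q ℕ.* q)  ≡⟨ cong (x ^_) (trans (ℕ.*-assoc q q q) (cong (λ n → q ℕ.* (q ℕ.* n)) (sym (ℕ.*-identityʳ q)))) ⟩
      x ^ (q ℕ.^ 3)        ≡⟨ x^N≡x x ⟩
      x                    ∎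

    σ-injective : Inj σ
    σ-injective {x} {y} σx≡σy = trans (sym (σ³ x)) (trans (cong (σ ∘ σ) σx≡σy) (σ³ y))

    σ-≢0 : ∀ {x} → x ≢ 0# → σ x ≢ 0#
    σ-≢0 x≢0 σx≡0 = x≢0 (σ-injective (trans σx≡0 (sym σ-0)))

    σ-sum : ∀ {n} (f : Fin n → Carrier) → σ (sum f) ≡ sum (σ ∘ f)
    σ-sum {zero}  f = σ-0
    σ-sum {suc n} f = trans (σ-+ _ _) (cong (σ (f zero) +_) (σ-sum (f ∘ suc)))

    Fixed : Carrier → Set
    Fixed x = σ x ≡ x

    fixed-* : ∀ {x y} → Fixed x → Fixed y → Fixed (x * y)
    fixed-* σx σy = trans (σ-* _ _) (cong₂ _*_ σx σy)

    ι-^ : ∀ x n → ι (x K.^ n) ≡ ι x ^ n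
    ι-^ x zero    = ι-1
    ι-^ x (suc n) = trans (ι-* x (x K.^ n)) (cong (ι x *_) (ι-^ x n))

    σ-ι : ∀ x → Fixed (ι x)
    σ-ι x = trans (sym (ι-^ x q)) (cong ι (K.x^N≡x x))

    σ-1 : Fixed 1#
    σ-1 = trans (cong σ (sym ι-1)) (trans (σ-ι _) ι-1)

    fixed-inverse : ∀ {x y} → x * y ≡ 1# → Fixed x → Fixed y
    fixed-inverse {x} {y} xy≡1 σx = *-cancelˡ x≢0 (begin
      x * σ y      ≡⟨ cong (_* σ y) σx ⟨
      σ x * σ y    ≡⟨ σ-* x y ⟨
      σ (x * y)    ≡⟨ cong σ xy≡1 ⟩
      σ 1#         ≡⟨ σ-1 ⟩
      1#           ≡⟨ xy≡1 ⟨
      x * y        ∎)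
      where
      x≢0 : x ≢ 0#
      x≢0 refl = 1≢0 (trans (sym xy≡1) (zeroˡ y))

    ι-sum : ∀ {n} (f : Fin n → K.Carrier) → ι (K.sum f) ≡ sum (ι ∘ f)
    ι-sum {zero}  f = ι-0
    ι-sum {suc n} f = trans (ι-+ _ _) (cong (ι (f zero) +_) (ι-sum (f ∘ suc)))

    ι-≢0 : ∀ {x} → x ≢ K.0# → ι x ≢ 0#
    ι-≢0 x≢0 ιx≡0 = x≢0 (ι-injective (trans ιx≡0 (sym ι-0)))

    private
      m : ℕ
      m = q ℕ.∸ 2
      q≡2+m : q ≡ 2 ℕ.+ m
      q≡2+m = sym (ℕ.m+[n∸m]≡n (ℕ.≤-trans (s≤s (s≤s z≤n)) 4≤q))

      -- A run of `q` coefficients of which only the two lowest may be nonzero. With `q` written as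
      -- `2 + m` it is an explicit vector.
      block : Carrier → Carrier → Vec Carrier (2 ℕ.+ m)
      block a b = a ∷ b ∷ Vec.replicate m 0#

      eval-block : ∀ a b t → eval (block a b) t ≡ a + b * t
      eval-block a b t = trans (cong (λ z → a + t * (b + t * z)) (eval-zeros m t))
        (solve 3 (λ a b t → a :+ t :* (b :+ t :* :0) := a :+ b :* t) refl a b t)

    -- x^q - x has at most q roots, and the elements of K are such.
    fixed⇒ι : ∀ x → Fixed x → ∃[ y ] ι y ≡ x
    fixed⇒ι x σx≡x with any? (λ y → ι y ≟ x)
    ... | yes found = found
    ... | no  missed = contradiction (All.head (proj₂ (++⁻ (block 0# (- 1#)) zero-poly))) 1≢0
      where
      r : Fin (suc q) → Carrier
      r zero    = x
      r (suc y) = ι y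
      r-inj : Inj r
      r-inj {zero}  {zero}  e = refl
      r-inj {zero}  {suc y} e = contradiction (y , sym e) missed
      r-inj {suc y} {zero}  e = contradiction (y , e) missed
      r-inj {suc y} {suc z} e = cong suc (ι-injective e)
      r-fixed : ∀ i → Fixed (r i)
      r-fixed zero    = σx≡x
      r-fixed (suc y) = σ-ι y
      poly : Vec Carrier (2 ℕ.+ m ℕ.+ 1)
      poly = block 0# (- 1#) Vec.++ (1# ∷ [])
      length≤ : 2 ℕ.+ m ℕ.+ 1 ≤ suc q
      length≤ = ℕ.≤-reflexive (trans (ℕ.+-comm _ 1) (cong suc (sym q≡2+m)))
      poly-root : ∀ t → Fixed t → eval poly t ≡ 0#
      poly-root t σt≡t = begin
        eval poly t                                        ≡⟨ eval-++ (block 0# (- 1#)) (1# ∷ []) t ⟩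
        eval (block 0# (- 1#)) t + t ^ (2 ℕ.+ m) * (1# + t * 0#)
          ≡⟨ cong₂ (λ a n → a + t ^ n * (1# + t * 0#)) (eval-block 0# (- 1#) t) (sym q≡2+m) ⟩
        (0# + - 1# * t) + σ t * (1# + t * 0#)              ≡⟨ cong (λ s → (0# + - 1# * t) + s * (1# + t * 0#)) σt≡t ⟩
        (0# + - 1# * t) + t * (1# + t * 0#)
          ≡⟨ solve 1 (λ t → (:0 :+ :- :1 :* t) :+ t :* (:1 :+ t :* :0) := :0) refl t ⟩
        0#                                                 ∎
      zero-poly : All (_≡ 0#) poly
      zero-poly = roots⇒zero poly (λ i → r (Fin.inject≤ i length≤))
        (λ {i} {j} e → Fin.inject≤-injective length≤ length≤ i j (r-inj e))
        (λ i → poly-root _ (r-fixed (Fin.inject≤ i length≤)))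

    Tr : Carrier → Carrier
    Tr x = x + σ x + σ (σ x)

    Nm : Carrier → Carrier
    Nm x = x * σ x * σ (σ x)

    Tr-fixed : ∀ x → Fixed (Tr x)
    Tr-fixed x = begin
      σ (x + σ x + σ (σ x))             ≡⟨ trans (σ-+ _ _) (cong₂ _+_ (σ-+ _ _) (σ³ x)) ⟩
      σ x + σ (σ x) + x                 ≡⟨ solve 3 (λ a b c → b :+ c :+ a := a :+ b :+ c) refl x (σ x) (σ (σ x)) ⟩
      Tr x                              ∎

    Nm-fixed : ∀ x → Fixed (Nm x)
    Nm-fixed x = begin
      σ (x * σ x * σ (σ x))             ≡⟨ trans (σ-* _ _) (cong₂ _*_ (σ-* _ _) (σ³ x)) ⟩
      σ x * σ (σ x) * x                 ≡⟨ solve 3 (λ a b c → b :* c :* a := a :* b :* c) refl x (σ x) (σ (σ x)) ⟩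
      Nm x                              ∎

    Nm-≢0 : ∀ {x} → x ≢ 0# → Nm x ≢ 0#
    Nm-≢0 x≢0 = *-≢0 (*-≢0 x≢0 (σ-≢0 x≢0)) (σ-≢0 (σ-≢0 x≢0))

    Tr-+ : ∀ x y → Tr (x + y) ≡ Tr x + Tr y
    Tr-+ x y = trans (cong₂ (λ a b → x + y + a + b) (σ-+ x y) (trans (cong σ (σ-+ x y)) (σ-+ _ _)))
      (solve 6 (λ a b c a′ b′ c′ → a :+ a′ :+ (b :+ b′) :+ (c :+ c′) := (a :+ b :+ c) :+ (a′ :+ b′ :+ c′)) refl
        x (σ x) (σ (σ x)) y (σ y) (σ (σ y)))

    Tr-*-fixed : ∀ x {c} → Fixed c → Tr (c * x) ≡ c * Tr x
    Tr-*-fixed x {c} σc = trans (cong₂ (λ a b → c * x + a + b) σcx (trans (cong σ σcx) (trans (σ-* _ _) (cong (_* _) σc))))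
      (solve 4 (λ c x y z → c :* x :+ c :* y :+ c :* z := c :* (x :+ y :+ z)) refl c x (σ x) (σ (σ x)))
      where
      σcx : σ (c * x) ≡ c * σ x
      σcx = trans (σ-* _ _) (cong (_* _) σc)

    -- Tensors of the projective line.  The vector (y , x) carries the
    -- parameter t = x / y, and entry 4i + 2j + k of tensor u v w is uᵢ vⱼ wₖ.

    F² : Set
    F² = Carrier × Carrier

    F⁸ : Set
    F⁸ = Fin 8 → Carrier

    infixl 6 _⊞_
    infixl 7 _⊡_
    _⊞_ : F² → F² → F²
    (a , b) ⊞ (c , d) = a + c , b + d

    _⊡_ : Carrier → F² → F²
    x ⊡ (a , b) = x * a , x * b

    σ₂ : F² → F²
    σ₂ (a , b) = σ a , σ b

    σ₂-⊞ : ∀ u v → σ₂ (u ⊞ v) ≡ σ₂ u ⊞ σ₂ v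
    σ₂-⊞ _ _ = cong₂ _,_ (σ-+ _ _) (σ-+ _ _)

    σ₂-⊡ : ∀ x v → σ₂ (x ⊡ v) ≡ σ x ⊡ σ₂ v
    σ₂-⊡ _ _ = cong₂ _,_ (σ-* _ _) (σ-* _ _)

    σ₂³ : ∀ v → σ₂ (σ₂ (σ₂ v)) ≡ v
    σ₂³ _ = cong₂ _,_ (σ³ _) (σ³ _)

    tensor : F² → F² → F² → F⁸
    tensor (a₀ , a₁) (b₀ , b₁) (c₀ , c₁) =
      a₀ * b₀ * c₀ V.∷ a₀ * b₀ * c₁ V.∷ a₀ * b₁ * c₀ V.∷ a₀ * b₁ * c₁ V.∷
      a₁ * b₀ * c₀ V.∷ a₁ * b₀ * c₁ V.∷ a₁ * b₁ * c₀ V.∷ a₁ * b₁ * c₁ V.∷ V.[]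

    private
      every : {P : Fin 8 → Set} → P 0F → P 1F → P 2F → P 3F → P 4F → P 5F → P 6F → P 7F → ∀ j → P j
      every p₀ p₁ p₂ p₃ p₄ p₅ p₆ p₇ = λ { 0F → p₀ ; 1F → p₁ ; 2F → p₂ ; 3F → p₃ ; 4F → p₄ ; 5F → p₅ ; 6F → p₆ ; 7F → p₇ }

    tensor-linear₁ : ∀ x u y v b c j →
      tensor (x ⊡ u ⊞ y ⊡ v) b c j ≡ x * tensor u b c j + y * tensor v b c j
    tensor-linear₁ x (u₀ , u₁) y (v₀ , v₁) (b₀ , b₁) (c₀ , c₁) = every
      (lin u₀ v₀ b₀ c₀) (lin u₀ v₀ b₀ c₁) (lin u₀ v₀ b₁ c₀) (lin u₀ v₀ b₁ c₁)
      (lin u₁ v₁ b₀ c₀) (lin u₁ v₁ b₀ c₁) (lin u₁ v₁ b₁ c₀) (lin u₁ v₁ b₁ c₁)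
      where
      lin : ∀ u v b c → (x * u + y * v) * b * c ≡ x * (u * b * c) + y * (v * b * c)
      lin = solve 6 (λ x y u v b c → (x :* u :+ y :* v) :* b :* c := x :* (u :* b :* c) :+ y :* (v :* b :* c)) refl x y

    tensor-linear₂ : ∀ x u y v a c j →
      tensor a (x ⊡ u ⊞ y ⊡ v) c j ≡ x * tensor a u c j + y * tensor a v c j
    tensor-linear₂ x (u₀ , u₁) y (v₀ , v₁) (a₀ , a₁) (c₀ , c₁) = every
      (lin u₀ v₀ a₀ c₀) (lin u₀ v₀ a₀ c₁) (lin u₁ v₁ a₀ c₀) (lin u₁ v₁ a₀ c₁)
      (lin u₀ v₀ a₁ c₀) (lin u₀ v₀ a₁ c₁) (lin u₁ v₁ a₁ c₀) (lin u₁ v₁ a₁ c₁)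
      where
      lin : ∀ u v a c → a * (x * u + y * v) * c ≡ x * (a * u * c) + y * (a * v * c)
      lin = solve 6 (λ x y u v a c → a :* (x :* u :+ y :* v) :* c := x :* (a :* u :* c) :+ y :* (a :* v :* c)) refl x y

    tensor-linear₃ : ∀ x u y v a b j →
      tensor a b (x ⊡ u ⊞ y ⊡ v) j ≡ x * tensor a b u j + y * tensor a b v j
    tensor-linear₃ x (u₀ , u₁) y (v₀ , v₁) (a₀ , a₁) (b₀ , b₁) = every
      (lin u₀ v₀ a₀ b₀) (lin u₁ v₁ a₀ b₀) (lin u₀ v₀ a₀ b₁) (lin u₁ v₁ a₀ b₁)
      (lin u₀ v₀ a₁ b₀) (lin u₁ v₁ a₁ b₀) (lin u₀ v₀ a₁ b₁) (lin u₁ v₁ a₁ b₁)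
      where
      lin : ∀ u v a b → a * b * (x * u + y * v) ≡ x * (a * b * u) + y * (a * b * v)
      lin = solve 6 (λ x y u v a b → a :* b :* (x :* u :+ y :* v) := x :* (a :* b :* u) :+ y :* (a :* b :* v)) refl x y

    tensor-scale : ∀ x y z a b c j → tensor (x ⊡ a) (y ⊡ b) (z ⊡ c) j ≡ x * y * z * tensor a b c j
    tensor-scale x y z (a₀ , a₁) (b₀ , b₁) (c₀ , c₁) = every
      (s a₀ b₀ c₀) (s a₀ b₀ c₁) (s a₀ b₁ c₀) (s a₀ b₁ c₁) (s a₁ b₀ c₀) (s a₁ b₀ c₁) (s a₁ b₁ c₀) (s a₁ b₁ c₁)
      where
      s : ∀ a b c → (x * a) * (y * b) * (z * c) ≡ x * y * z * (a * b * c)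
      s = solve 6 (λ x y z a b c → (x :* a) :* (y :* b) :* (z :* c) := x :* y :* z :* (a :* b :* c)) refl x y z

    ∙-linear : ∀ {n} (ψ : Fin n → Carrier) x u y v →
               ψ ∙ (λ j → x * u j + y * v j) ≡ x * (ψ ∙ u) + y * (ψ ∙ v)
    ∙-linear ψ x u y v = begin
      sum (λ j → ψ j * (x * u j + y * v j))
        ≡⟨ sum-cong-≗ (λ j → solve 5 (λ p x u y v → p :* (x :* u :+ y :* v) := x :* (p :* u) :+ y :* (p :* v)) refl (ψ j) x (u j) y (v j)) ⟩
      sum (λ j → x * (ψ j * u j) + y * (ψ j * v j)) ≡⟨ sum-+* y (λ j → x * (ψ j * u j)) (λ j → ψ j * v j) ⟩
      sum (λ j → x * (ψ j * u j)) + y * (ψ ∙ v) ≡⟨ cong (_+ y * (ψ ∙ v)) (*-distribˡ-sum x (λ j → ψ j * u j)) ⟨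
      x * (ψ ∙ u) + y * (ψ ∙ v) ∎

    ∙-combination : ∀ {n m} (ψ : Fin m → Carrier) (x : Fin n → Carrier) u →
                    ψ ∙ combination x u ≡ sum (λ i → x i * (ψ ∙ u i))
    ∙-combination ψ x u = begin
      sum (λ j → ψ j * sum (λ i → x i * u i j))
        ≡⟨ sum-cong-≗ (λ j → *-distribˡ-sum (ψ j) (λ i → x i * u i j)) ⟩
      sum (λ j → sum (λ i → ψ j * (x i * u i j))) ≡⟨ ∑-comm (λ j i → ψ j * (x i * u i j)) ⟩
      sum (λ i → sum (λ j → ψ j * (x i * u i j)))
        ≡⟨ sum-cong-≗ (λ i → trans (sum-cong-≗ λ j → solve 3 (λ a b c → a :* (b :* c) := b :* (a :* c)) refl (ψ j) (x i) (u i j))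
             (sym (*-distribˡ-sum (x i) (λ j → ψ j * u i j)))) ⟩
      sum (λ i → x i * (ψ ∙ u i)) ∎

    ∙-congʳ : ∀ {n} (ψ : Fin n → Carrier) {u v : Fin n → Carrier} → u ≗ v → ψ ∙ u ≡ ψ ∙ v
    ∙-congʳ ψ u≗v = sum-cong-≗ (λ j → cong (ψ j *_) (u≗v j))

    det : F² → F² → Carrier
    det (a₀ , a₁) (b₀ , b₁) = a₀ * b₁ - a₁ * b₀

    infix 30 _ᗮ
    -- As the coefficients of a functional, `b ᗮ` sends `a` to `det a b`, so it kills exactly the
    -- multiples of a nonzero `b`.
    _ᗮ : F² → F²
    (b₀ , b₁) ᗮ = b₁ , - b₀

    tensor-ᗮ : ∀ a b c a′ b′ c′ → tensor (a′ ᗮ) (b′ ᗮ) (c′ ᗮ) ∙ tensor a b c ≡ det a a′ * det b b′ * det c c′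
    tensor-ᗮ (a₀ , a₁) (b₀ , b₁) (c₀ , c₁) (a₀′ , a₁′) (b₀′ , b₁′) (c₀′ , c₁′) =
      solve 12 (λ a₀ a₁ b₀ b₁ c₀ c₁ a₀′ a₁′ b₀′ b₁′ c₀′ c₁′ →
        a₁′ :* b₁′ :* c₁′ :* (a₀ :* b₀ :* c₀) :+ (a₁′ :* b₁′ :* :- c₀′ :* (a₀ :* b₀ :* c₁) :+
        (a₁′ :* :- b₀′ :* c₁′ :* (a₀ :* b₁ :* c₀) :+ (a₁′ :* :- b₀′ :* :- c₀′ :* (a₀ :* b₁ :* c₁) :+
        (:- a₀′ :* b₁′ :* c₁′ :* (a₁ :* b₀ :* c₀) :+ (:- a₀′ :* b₁′ :* :- c₀′ :* (a₁ :* b₀ :* c₁) :+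
        (:- a₀′ :* :- b₀′ :* c₁′ :* (a₁ :* b₁ :* c₀) :+ (:- a₀′ :* :- b₀′ :* :- c₀′ :* (a₁ :* b₁ :* c₁) :+ :0)))))))
        := (a₀ :* a₁′ :- a₁ :* a₀′) :* (b₀ :* b₁′ :- b₁ :* b₀′) :* (c₀ :* c₁′ :- c₁ :* c₀′)) refl
        a₀ a₁ b₀ b₁ c₀ c₁ a₀′ a₁′ b₀′ b₁′ c₀′ c₁′

    σ-det : ∀ u v → σ (det u v) ≡ det (σ₂ u) (σ₂ v)
    σ-det (a , b) (c , d) = trans (σ-+ _ _) (cong₂ _+_ (σ-* _ _) (trans (σ-neg _) (cong -_ (σ-* _ _))))

    point : F² → F⁸
    point v = tensor v (σ₂ v) (σ₂ (σ₂ v))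

    -- The three factors are scaled by the three conjugates of `x`. As norms lie in `K`,
    -- proportional vectors yield the same point of PG(U₁).
    point-scale : ∀ x v j → point (x ⊡ v) j ≡ Nm x * point v j
    point-scale x v j = trans (cong₂ (λ b c → tensor (x ⊡ v) b c j) (σ₂-⊡ x v) (trans (cong σ₂ (σ₂-⊡ x v)) (σ₂-⊡ (σ x) (σ₂ v))))
      (tensor-scale x (σ x) (σ (σ x)) v (σ₂ v) (σ₂ (σ₂ v)) j)

    affine : Carrier → F²
    affine t = 1# , t

    private
      -- Entry 4i + 2j + k of `ψ` is the coefficient of t to the power i + jq + kq². In ascending
      -- order, blocks begin at the exponents 0, q and q², the `m * (2 + m)` zeros fill the gap from
      -- 2q to q², and the last two coefficients belong to q² + q and q² + q + 1.
      poly : F⁸ → Vec Carrier ((2 ℕ.+ m ℕ.+ (2 ℕ.+ m ℕ.+ m ℕ.* (2 ℕ.+ m))) ℕ.+ (2 ℕ.+ m ℕ.+ 2))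
      poly ψ = (block (ψ 0F) (ψ 4F) Vec.++ (block (ψ 2F) (ψ 6F) Vec.++ Vec.replicate (m ℕ.* (2 ℕ.+ m)) 0#))
               Vec.++ (block (ψ 1F) (ψ 5F) Vec.++ (ψ 3F ∷ ψ 7F ∷ []))

      eval-poly : ∀ ψ t → eval (poly ψ) t ≡ ψ ∙ point (affine t)
      eval-poly ψ t = begin
        eval (poly ψ) t ≡⟨ eval-++ (block (ψ 0F) (ψ 4F) Vec.++ (block (ψ 2F) (ψ 6F) Vec.++ zs)) _ t ⟩
        eval (block (ψ 0F) (ψ 4F) Vec.++ (block (ψ 2F) (ψ 6F) Vec.++ zs)) t + t ^ n * eval (block (ψ 1F) (ψ 5F) Vec.++ (ψ 3F ∷ ψ 7F ∷ [])) t
          ≡⟨ cong₂ (λ a b → a + t ^ n * b)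
               (trans (eval-++ (block (ψ 0F) (ψ 4F)) _ t) (cong₂ (λ a b → a + t ^ Q * b) (eval-block _ _ t)
                 (trans (eval-++ (block (ψ 2F) (ψ 6F)) zs t) (cong₂ (λ a b → a + t ^ Q * b) (eval-block _ _ t) (eval-zeros (m ℕ.* Q) t)))))
               (trans (eval-++ (block (ψ 1F) (ψ 5F)) _ t) (cong (_+ t ^ Q * (ψ 3F + t * (ψ 7F + t * 0#))) (eval-block _ _ t))) ⟩
        ((ψ 0F + ψ 4F * t) + t ^ Q * ((ψ 2F + ψ 6F * t) + t ^ Q * 0#))
          + t ^ n * ((ψ 1F + ψ 5F * t) + t ^ Q * (ψ 3F + t * (ψ 7F + t * 0#)))
          ≡⟨ cong₂ (λ s r → ((ψ 0F + ψ 4F * t) + s * ((ψ 2F + ψ 6F * t) + s * 0#))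
               + r * ((ψ 1F + ψ 5F * t) + s * (ψ 3F + t * (ψ 7F + t * 0#)))) t^Q t^n ⟩
        ((ψ 0F + ψ 4F * t) + s * ((ψ 2F + ψ 6F * t) + s * 0#)) + r * ((ψ 1F + ψ 5F * t) + s * (ψ 3F + t * (ψ 7F + t * 0#)))
          ≡⟨ solve 11 (λ p₀ p₁ p₂ p₃ p₄ p₅ p₆ p₇ t s r →
               ((p₀ :+ p₄ :* t) :+ s :* ((p₂ :+ p₆ :* t) :+ s :* :0)) :+ r :* ((p₁ :+ p₅ :* t) :+ s :* (p₃ :+ t :* (p₇ :+ t :* :0)))
               := p₀ :* (:1 :* :1 :* :1) :+ (p₁ :* (:1 :* :1 :* r) :+ (p₂ :* (:1 :* s :* :1) :+ (p₃ :* (:1 :* s :* r) :+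
                  (p₄ :* (t :* :1 :* :1) :+ (p₅ :* (t :* :1 :* r) :+ (p₆ :* (t :* s :* :1) :+ (p₇ :* (t :* s :* r) :+ :0))))))))
               refl (ψ 0F) (ψ 1F) (ψ 2F) (ψ 3F) (ψ 4F) (ψ 5F) (ψ 6F) (ψ 7F) t s r ⟩
        ψ ∙ tensor (1# , t) (1# , s) (1# , r)
          ≡⟨ cong₂ (λ a b → ψ ∙ tensor (1# , t) (a , s) (b , r)) σ-1 (trans (cong σ σ-1) σ-1) ⟨
        ψ ∙ point (affine t) ∎
        where
        Q n : ℕ
        Q = 2 ℕ.+ m
        n = Q ℕ.+ (Q ℕ.+ m ℕ.* Q)
        zs = Vec.replicate (m ℕ.* Q) 0#
        s = σ t
        r = σ (σ t)
        t^Q : t ^ Q ≡ s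
        t^Q = cong (t ^_) (sym q≡2+m)
        t^n : t ^ n ≡ r
        t^n = trans (cong (λ a → t ^ (a ℕ.* a)) (sym q≡2+m)) (sym (σσ≡^q*q t))

    functional-zero : ∀ (ψ : F⁸) {n} → q ℕ.* q ℕ.+ q ℕ.+ 2 ≤ n → (r : Fin n → Carrier) → Inj r →
                      (∀ i → ψ ∙ point (affine (r i)) ≡ 0#) → ∀ j → ψ j ≡ 0#
    functional-zero ψ {n} len≤n r r-inj roots =
      let low , high = ++⁻ (block (ψ 0F) (ψ 4F) Vec.++ (block (ψ 2F) (ψ 6F) Vec.++ zs)) all-zero
          b₀₄ , low′ = ++⁻ (block (ψ 0F) (ψ 4F)) low
          b₂₆ , _    = ++⁻ (block (ψ 2F) (ψ 6F)) low′
          b₁₅ , b₃₇  = ++⁻ (block (ψ 1F) (ψ 5F)) high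
      in every {λ j → ψ j ≡ 0#} (All.head b₀₄) (All.head b₁₅) (All.head b₂₆) (All.head b₃₇)
           (second b₀₄) (second b₁₅) (second b₂₆) (second b₃₇)
      where
      zs = Vec.replicate (m ℕ.* (2 ℕ.+ m)) 0#
      second : ∀ {n a b} {cs : Vec Carrier n} → All (_≡ 0#) (a ∷ b ∷ cs) → b ≡ 0#
      second zs = All.head (All.tail zs)
      len≡ : q ℕ.* q ℕ.+ q ℕ.+ 2 ≡ (2 ℕ.+ m ℕ.+ (2 ℕ.+ m ℕ.+ m ℕ.* (2 ℕ.+ m))) ℕ.+ (2 ℕ.+ m ℕ.+ 2)
      len≡ = trans (cong (λ a → a ℕ.* a ℕ.+ a ℕ.+ 2) q≡2+m) (ℕ.+-assoc ((2 ℕ.+ m) ℕ.* (2 ℕ.+ m)) (2 ℕ.+ m) 2)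
      len≤ = subst (_≤ n) len≡ len≤n
      all-zero : All (_≡ 0#) (poly ψ)
      all-zero = roots⇒zero (poly ψ) (λ i → r (Fin.inject≤ i len≤))
        (λ {i} {j} e → Fin.inject≤-injective len≤ len≤ i j (r-inj e))
        (λ i → trans (eval-poly ψ _) (roots _))

    -- The 𝔽_q-space U₁ and invariant functionals

    rotate : Fin 8 → Fin 8
    rotate = λ { 0F → 0F ; 1F → 4F ; 2F → 1F ; 3F → 5F ; 4F → 2F ; 5F → 6F ; 6F → 3F ; 7F → 7F }

    rotate³ : ∀ j → rotate (rotate (rotate j)) ≡ j
    rotate³ = every refl refl refl refl refl refl refl refl

    -- Since rotate moves index (i , j , k) to (k , i , j), the invariant vectors form U₁.
    Invariant : F⁸ → Set
    Invariant u = ∀ j → σ (u j) ≡ u (rotate j)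

    sum-rotate : ∀ f → sum (f ∘ rotate) ≡ sum f
    sum-rotate f = sym (sum-permute f (Perm.permutation rotate (rotate ∘ rotate) rotate³ rotate³))

    σ-tensor : ∀ a b c j → σ (tensor a b c j) ≡ tensor (σ₂ c) (σ₂ a) (σ₂ b) (rotate j)
    σ-tensor (a₀ , a₁) (b₀ , b₁) (c₀ , c₁) = every
      (s a₀ b₀ c₀) (s a₀ b₀ c₁) (s a₀ b₁ c₀) (s a₀ b₁ c₁) (s a₁ b₀ c₀) (s a₁ b₀ c₁) (s a₁ b₁ c₀) (s a₁ b₁ c₁)
      where
      s : ∀ a b c → σ (a * b * c) ≡ σ c * σ a * σ b
      s a b c = trans (σ-* _ _) (trans (cong (_* σ c) (σ-* a b))
        (solve 3 (λ a b c → a :* b :* c := c :* a :* b) refl (σ a) (σ b) (σ c)))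

    -- Applying `σ` only renumbers the summands along `rotate`. When `u` and `v` are the same
    -- invariant vector, the product is therefore fixed by `σ` and comes from `K`.
    invariant-∙ : ∀ {w} u v → Invariant w → (∀ j → σ (u j) ≡ v (rotate j)) → σ (w ∙ u) ≡ w ∙ v
    invariant-∙ {w} u v w-inv σu = begin
      σ (w ∙ u)                                       ≡⟨ σ-sum (λ j → w j * u j) ⟩
      sum (λ j → σ (w j * u j))                       ≡⟨ sum-cong-≗ (λ j → trans (σ-* _ _) (cong₂ _*_ (w-inv j) (σu j))) ⟩
      sum (λ j → w (rotate j) * v (rotate j))         ≡⟨ sum-rotate (λ j → w j * v j) ⟩
      w ∙ v                                           ∎

    σ-form : ∀ {w} → Invariant w → ∀ a b c → σ (w ∙ tensor a b c) ≡ w ∙ tensor (σ₂ c) (σ₂ a) (σ₂ b)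
    σ-form w-inv a b c = invariant-∙ (tensor a b c) (tensor (σ₂ c) (σ₂ a) (σ₂ b)) w-inv (σ-tensor a b c)

    point-invariant : ∀ v → Invariant (point v)
    point-invariant v j = trans (σ-tensor v (σ₂ v) (σ₂ (σ₂ v)) j)
      (cong (λ u → tensor u (σ₂ v) (σ₂ (σ₂ v)) (rotate j)) (σ₂³ v))

    -- The orbit sum of `χ` under the semilinear map of order three whose fixed vectors are the
    -- invariant ones; the inverse of `rotate` appears as its square.
    symmetrize : F⁸ → F⁸
    symmetrize χ j = χ j + σ (χ (rotate (rotate j))) + σ (σ (χ (rotate j)))

    symmetrize-invariant : ∀ χ → Invariant (symmetrize χ)
    symmetrize-invariant χ j = begin
      σ (χ j + σ (χ (rotate (rotate j))) + σ (σ (χ (rotate j))))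
        ≡⟨ trans (σ-+ _ _) (cong₂ _+_ (σ-+ _ _) (σ³ _)) ⟩
      σ (χ j) + σ (σ (χ (rotate (rotate j)))) + χ (rotate j)
        ≡⟨ solve 3 (λ a b c → a :+ b :+ c := c :+ a :+ b) refl (σ (χ j)) (σ (σ (χ (rotate (rotate j))))) (χ (rotate j)) ⟩
      χ (rotate j) + σ (χ j) + σ (σ (χ (rotate (rotate j))))
        ≡⟨ cong (λ i → χ (rotate j) + σ (χ i) + σ (σ (χ (rotate (rotate j))))) (rotate³ j) ⟨
      symmetrize χ (rotate j) ∎

    symmetrize-∙ : ∀ χ {u} → Invariant u → symmetrize χ ∙ u ≡ Tr (χ ∙ u)
    symmetrize-∙ χ {u} u-inv = begin
      sum (λ j → (χ j + χ′ j + χ″ j) * u j)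
        ≡⟨ sum-cong-≗ (λ j → solve 4 (λ a b c u → (a :+ b :+ c) :* u := (a :* u :+ b :* u) :+ c :* u) refl (χ j) (χ′ j) (χ″ j) (u j)) ⟩
      sum (λ j → (χ j * u j + χ′ j * u j) + χ″ j * u j)
        ≡⟨ trans (∑-distrib-+ (λ j → χ j * u j + χ′ j * u j) (λ j → χ″ j * u j)) (cong (_+ χ″ ∙ u) (∑-distrib-+ (λ j → χ j * u j) (λ j → χ′ j * u j))) ⟩
      χ ∙ u + χ′ ∙ u + χ″ ∙ u ≡⟨ cong₂ (λ a b → χ ∙ u + a + b) once twice ⟨
      Tr (χ ∙ u) ∎
      where
      χ′ χ″ : F⁸
      χ′ j = σ (χ (rotate (rotate j)))
      χ″ j = σ (σ (χ (rotate j)))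
      once : σ (χ ∙ u) ≡ χ′ ∙ u
      once = trans (σ-sum (λ j → χ j * u j)) (trans (sum-cong-≗ λ j → trans (σ-* _ _) (cong₂ _*_ (cong (σ ∘ χ) (sym (rotate³ j))) (u-inv j)))
        (sum-rotate (λ j → χ′ j * u j)))
      twice : σ (σ (χ ∙ u)) ≡ χ″ ∙ u
      twice = trans (cong σ once) (trans (σ-sum (λ j → χ′ j * u j)) (trans (sum-cong-≗ λ j → trans (σ-* _ _) (cong (σ (χ′ j) *_) (u-inv j)))
        (sum-rotate (λ j → χ″ j * u j))))

    module Form (w : F⁸) (w-inv : Invariant w) where

      f : F² → Carrier
      f v = w ∙ point v

      f-scale : ∀ x v → f (x ⊡ v) ≡ Nm x * f v
      f-scale x v = trans (∙-congʳ w (point-scale x v)) (trans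
        (sum-cong-≗ λ j → solve 3 (λ a b c → a :* (b :* c) := b :* (a :* c)) refl (w j) (Nm x) (point v j))
        (sym (*-distribˡ-sum (Nm x) (λ j → w j * point v j))))

      private
        T : F² → F² → F² → Carrier
        T a b c = w ∙ tensor a b c
        T₁ : ∀ x u y v b c → T (x ⊡ u ⊞ y ⊡ v) b c ≡ x * T u b c + y * T v b c
        T₁ x u y v b c = trans (∙-congʳ w (tensor-linear₁ x u y v b c)) (∙-linear w x (tensor u b c) y (tensor v b c))
        T₂ : ∀ x u y v a c → T a (x ⊡ u ⊞ y ⊡ v) c ≡ x * T a u c + y * T a v c
        T₂ x u y v a c = trans (∙-congʳ w (tensor-linear₂ x u y v a c)) (∙-linear w x (tensor a u c) y (tensor a v c))
        T₃ : ∀ x u y v a b → T a b (x ⊡ u ⊞ y ⊡ v) ≡ x * T a b u + y * T a b v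
        T₃ x u y v a b = trans (∙-congʳ w (tensor-linear₃ x u y v a b)) (∙-linear w x (tensor a b u) y (tensor a b v))

      B C : F² → F² → Carrier
      B e₁ e₂ = w ∙ tensor e₁ (σ₂ e₂) (σ₂ (σ₂ e₂))
      C e₁ e₂ = B e₂ e₁

      -- The tensor is trilinear, which gives eight terms: two pure ones, scaled by norms, and six
      -- mixed ones. Invariance of `w` makes the mixed terms two orbits of `σ` of length three, and
      -- each orbit adds up to a trace.
      expand : ∀ e₁ e₂ x y → f (x ⊡ e₁ ⊞ y ⊡ e₂) ≡
        Nm x * f e₁ + Nm y * f e₂ + Tr (B e₁ e₂ * (x * σ y * σ (σ y))) + Tr (C e₁ e₂ * (y * σ x * σ (σ x)))
      expand e₁ e₂ x y = begin
        T (x ⊡ e₁ ⊞ y ⊡ e₂) (σ₂ (x ⊡ e₁ ⊞ y ⊡ e₂)) (σ₂ (σ₂ (x ⊡ e₁ ⊞ y ⊡ e₂)))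
          ≡⟨ cong₂ (T (x ⊡ e₁ ⊞ y ⊡ e₂)) (σ₂-comb x e₁ y e₂) (trans (cong σ₂ (σ₂-comb x e₁ y e₂)) (σ₂-comb x′ e₁′ y′ e₂′)) ⟩
        T (x ⊡ e₁ ⊞ y ⊡ e₂) (x′ ⊡ e₁′ ⊞ y′ ⊡ e₂′) (x″ ⊡ e₁″ ⊞ y″ ⊡ e₂″)
          ≡⟨ trans (T₁ x e₁ y e₂ _ _) (cong₂ (λ a b → x * a + y * b) (T₂₃ e₁) (T₂₃ e₂)) ⟩
        x * (x′ * (x″ * T e₁ e₁′ e₁″ + y″ * T e₁ e₁′ e₂″) + y′ * (x″ * T e₁ e₂′ e₁″ + y″ * T e₁ e₂′ e₂″))
          + y * (x′ * (x″ * T e₂ e₁′ e₁″ + y″ * T e₂ e₁′ e₂″) + y′ * (x″ * T e₂ e₂′ e₁″ + y″ * T e₂ e₂′ e₂″))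
          ≡⟨ solve 14 (λ x x′ x″ y y′ y″ f₁ f₂ b b′ b″ c c′ c″ →
               x :* (x′ :* (x″ :* f₁ :+ y″ :* c″) :+ y′ :* (x″ :* c′ :+ y″ :* b))
               :+ y :* (x′ :* (x″ :* c :+ y″ :* b′) :+ y′ :* (x″ :* b″ :+ y″ :* f₂))
               := x :* x′ :* x″ :* f₁ :+ y :* y′ :* y″ :* f₂
               :+ (b :* (x :* y′ :* y″) :+ b′ :* (x′ :* y″ :* y) :+ b″ :* (x″ :* y :* y′))
               :+ (c :* (y :* x′ :* x″) :+ c′ :* (y′ :* x″ :* x) :+ c″ :* (y″ :* x :* x′)))
               refl x x′ x″ y y′ y″ (f e₁) (f e₂) (B e₁ e₂) (T e₂ e₁′ e₂″) (T e₂ e₂′ e₁″)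
               (C e₁ e₂) (T e₁ e₂′ e₁″) (T e₁ e₁′ e₂″) ⟩
        Nm x * f e₁ + Nm y * f e₂
          + (B e₁ e₂ * (x * y′ * y″) + T e₂ e₁′ e₂″ * (x′ * y″ * y) + T e₂ e₂′ e₁″ * (x″ * y * y′))
          + (C e₁ e₂ * (y * x′ * x″) + T e₁ e₂′ e₁″ * (y′ * x″ * x) + T e₁ e₁′ e₂″ * (y″ * x * x′))
          ≡⟨ cong₂ (λ a b → Nm x * f e₁ + Nm y * f e₂ + a + b) (conjugates e₁ e₂ x y) (conjugates e₂ e₁ y x) ⟩
        Nm x * f e₁ + Nm y * f e₂ + Tr (B e₁ e₂ * (x * y′ * y″)) + Tr (C e₁ e₂ * (y * x′ * x″)) ∎
        where
        x′ = σ x ; x″ = σ (σ x) ; y′ = σ y ; y″ = σ (σ y)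
        e₁′ = σ₂ e₁ ; e₁″ = σ₂ (σ₂ e₁) ; e₂′ = σ₂ e₂ ; e₂″ = σ₂ (σ₂ e₂)
        σ₂-comb : ∀ x u y v → σ₂ (x ⊡ u ⊞ y ⊡ v) ≡ σ x ⊡ σ₂ u ⊞ σ y ⊡ σ₂ v
        σ₂-comb x u y v = trans (σ₂-⊞ _ _) (cong₂ _⊞_ (σ₂-⊡ x u) (σ₂-⊡ y v))
        T₂₃ : ∀ a → T a (x′ ⊡ e₁′ ⊞ y′ ⊡ e₂′) (x″ ⊡ e₁″ ⊞ y″ ⊡ e₂″) ≡
              x′ * (x″ * T a e₁′ e₁″ + y″ * T a e₁′ e₂″) + y′ * (x″ * T a e₂′ e₁″ + y″ * T a e₂′ e₂″)
        T₂₃ a = trans (T₂ x′ e₁′ y′ e₂′ a _) (cong₂ (λ r s → x′ * r + y′ * s)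
          (T₃ x″ e₁″ y″ e₂″ a e₁′) (T₃ x″ e₁″ y″ e₂″ a e₂′))
        conjugates : ∀ d e x y →
          B d e * (x * σ y * σ (σ y)) + T e (σ₂ d) (σ₂ (σ₂ e)) * (σ x * σ (σ y) * y) + T e (σ₂ e) (σ₂ (σ₂ d)) * (σ (σ x) * y * σ y)
          ≡ Tr (B d e * (x * σ y * σ (σ y)))
        conjugates d e x y = sym (cong₂ (λ a b → B d e * (x * σ y * σ (σ y)) + a + b) once
          (trans (cong σ once) (trans (σ-* _ _) (cong₂ _*_
            (trans (σ-form w-inv e (σ₂ d) (σ₂ (σ₂ e))) (cong (λ a → T a (σ₂ e) (σ₂ (σ₂ d))) (σ₂³ e)))
            (trans (σ-3 (σ x) (σ (σ y)) y) (cong (λ a → σ (σ x) * a * σ y) (σ³ y)))))))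
          where
          σ-3 : ∀ a b c → σ (a * b * c) ≡ σ a * σ b * σ c
          σ-3 a b c = trans (σ-* _ _) (cong (_* σ c) (σ-* a b))
          once : σ (B d e * (x * σ y * σ (σ y))) ≡ T e (σ₂ d) (σ₂ (σ₂ e)) * (σ x * σ (σ y) * y)
          once = trans (σ-* _ _) (cong₂ _*_
            (trans (σ-form w-inv d (σ₂ e) (σ₂ (σ₂ e))) (cong (λ a → T a (σ₂ d) (σ₂ (σ₂ e))) (σ₂³ e)))
            (trans (σ-3 x (σ y) (σ (σ y))) (cong (σ x * σ (σ y) *_) (σ³ y))))

-- The numerical inequalities behind the counts.

module Arithmetic where

  open import Data.Empty using (⊥)
  open import Data.Nat.Base
  open import Data.Nat.Properties
  open import Data.Nat.Tactic.RingSolver using (solve-∀)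
  open import Data.Product.Base using (∃-syntax; _×_; _,_)
  open import Relation.Binary.PropositionalEquality
  open import Relation.Nullary using (contradiction)
  open import Relation.Nullary.Decidable using (toWitness)

  -- Polynomial inequalities in q ≥ a are checked by writing q = a + r, where
  -- the difference of the two sides has natural coefficients.
  shift : ∀ a {q} → a ≤ q → ∃[ r ] q ≡ a + r
  shift a {q} a≤q = q ∸ a , sym (m+[n∸m]≡n a≤q)

  ≤-gap : ∀ {a b} c → a + c ≡ b → a ≤ b
  ≤-gap {a} c refl = m≤m+n a c

  q²+q+1<q³ : ∀ {q} → 4 ≤ q → q * q + q + 1 < q ^ 3
  q²+q+1<q³ {q} 4≤q with r , refl ← shift 4 4≤q = ≤-gap _ (identity r)
    where
    identity : ∀ r → 1 + ((4 + r) * (4 + r) + (4 + r) + 1) + (42 + 39 * r + 11 * (r * r) + r * (r * r)) ≡ (4 + r) * ((4 + r) * ((4 + r) * 1))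
    identity = solve-∀

  -- Here `a` counts the t with Tr (c t) = 0 and `b` the others. The hypotheses would give q³ - 1 ≤
  -- n q = q³ - q² + q. The term `suc q * q` is due to the q + 1 points of the subline, each taken
  -- with every element of `K`.
  subline-count : ∀ {q n a b} → 4 ≤ q → n + q ≡ q * q + 1 →
                  q ^ 3 ≤ a + b → a ≤ q * q + q + 1 → b + suc q * q ≤ n * q → ⊥
  subline-count {q} {n} {a} {b} 4≤q n+q≡ q³≤ a≤ b≤ with r , refl ← shift 4 4≤q =
    contradiction (≤-gap _ (sym (identity r))) (<⇒≱ (s≤s (begin
      q ^ 3 + suc q * q + q * q                    ≤⟨ +-monoˡ-≤ (q * q) (+-monoˡ-≤ (suc q * q) q³≤) ⟩
      a + b + suc q * q + q * q                    ≡⟨ cong (_+ q * q) (+-assoc a b (suc q * q)) ⟩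
      a + (b + suc q * q) + q * q                  ≤⟨ +-monoˡ-≤ (q * q) (+-mono-≤ a≤ b≤) ⟩
      q * q + q + 1 + n * q + q * q                ≡⟨ +-assoc (q * q + q + 1) (n * q) (q * q) ⟩
      q * q + q + 1 + (n * q + q * q)              ≡⟨ cong (q * q + q + 1 +_) (trans (sym (*-distribʳ-+ q n q)) (cong (_* q) n+q≡)) ⟩
      q * q + q + 1 + (q * q + 1) * q              ∎)))
    where
    open ≤-Reasoning
    identity : ∀ r → (4 + r) * ((4 + r) * ((4 + r) * 1)) + (1 + (4 + r)) * (4 + r) + (4 + r) * (4 + r) ≡
      1 + ((4 + r) * (4 + r) + (4 + r) + 1 + ((4 + r) * (4 + r) + 1) * (4 + r)) + (10 + 7 * r + r * r)
    identity = solve-∀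

  -- Since 5N ≥ 4q, it is enough that 4⁴ k (k + 2) > 5⁴ 6 q², where k (k + 2) + 1 = q² N² ≥ 16 q².
  6q⁷<triples : ∀ {q N k} → 4 ≤ N → q ≡ suc N → 1 + k ≡ q * N →
                6 * q ^ 7 < (2 + k) * (1 + k) * k * (N * N * N)
  6q⁷<triples {q} {N} {k} 4≤N q≡1+N 1+k≡qN = begin-strict
    6 * q ^ 7                              ≡⟨ left q ⟩
    q * (q⁴ * q² * 6)                      <⟨ *-monoʳ-< q (*-cancelʳ-< 625 (q⁴ * q² * 6) (N⁴ * w) scaled) ⟩
    q * (N⁴ * w)                           ≡⟨ right q N k ⟩
    (2 + k) * (q * N) * k * (N * N * N)    ≡⟨ cong (λ m → (2 + k) * m * k * (N * N * N)) 1+k≡qN ⟨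
    (2 + k) * (1 + k) * k * (N * N * N)    ∎
    where
    open ≤-Reasoning
    instance
      q≢0 : NonZero q
      q≢0 = subst NonZero (sym q≡1+N) _
    q² = q * q
    q⁴ = q * q * (q * q)
    N⁴ = N * N * (N * N)
    w = k * (2 + k)
    instance
      q²≢0 : NonZero q²
      q²≢0 = m*n≢0 q q
      q⁴≢0 : NonZero q⁴
      q⁴≢0 = m*n≢0 q² q²
    left : ∀ q → 6 * (q * (q * (q * (q * (q * (q * (q * 1))))))) ≡ q * (q * q * (q * q) * (q * q) * 6)
    left = solve-∀
    right : ∀ q N k → q * (N * N * (N * N) * (k * (2 + k))) ≡ (2 + k) * (q * N) * k * (N * N * N)
    right = solve-∀
    fourth-power : ∀ x a → x * a * (x * a) * (x * a * (x * a)) ≡ x * x * (x * x) * (a * a * (a * a))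
    fourth-power = solve-∀
    4q≤5N : q * 4 ≤ N * 5
    4q≤5N = begin
      q * 4       ≡⟨ cong (_* 4) q≡1+N ⟩
      4 + N * 4   ≤⟨ +-monoˡ-≤ (N * 4) 4≤N ⟩
      N + N * 4   ≡⟨ *-suc N 4 ⟨
      N * 5       ∎
    4⁴q⁴≤5⁴N⁴ : q⁴ * 256 ≤ N⁴ * 625
    4⁴q⁴≤5⁴N⁴ = subst₂ _≤_ (fourth-power q 4) (fourth-power N 5)
      (*-mono-≤ (*-mono-≤ 4q≤5N 4q≤5N) (*-mono-≤ 4q≤5N 4q≤5N))
    square : ∀ k → k * (2 + k) + 1 ≡ (1 + k) * (1 + k)
    square = solve-∀
    square-qN : ∀ q N → q * N * (q * N) ≡ q * q * (N * N)
    square-qN = solve-∀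
    w-large : q² * 3750 < w * 256
    w-large = +-cancelʳ-< 256 (q² * 3750) (w * 256) (begin-strict
      -- 3750 is 6 · 5⁴ and 4096 is 16 · 4⁴, the 16 bounding `N * N` from below; 346 is their
      -- difference. The 256 makes up for the 1 in k (k + 2) + 1 = (k + 1)².
      q² * 3750 + 256           <⟨ +-monoʳ-< (q² * 3750) (<-≤-trans (toWitness {a? = 256 <? 346} _) (m≤n*m 346 q²)) ⟩
      q² * 3750 + q² * 346      ≡⟨ *-distribˡ-+ q² 3750 346 ⟨
      q² * 4096                 ≡⟨ *-assoc q² 16 256 ⟨
      q² * 16 * 256             ≤⟨ *-monoˡ-≤ 256 (*-monoʳ-≤ q² (*-mono-≤ 4≤N 4≤N)) ⟩
      q² * (N * N) * 256        ≡⟨ cong (_* 256) (trans (square k) (trans (cong₂ _*_ 1+k≡qN 1+k≡qN) (square-qN q N))) ⟨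
      (w + 1) * 256             ≡⟨ *-distribʳ-+ 256 w 1 ⟩
      w * 256 + 256             ∎)
    scaled : q⁴ * q² * 6 * 625 < N⁴ * w * 625
    scaled = begin-strict
      q⁴ * q² * 6 * 625         ≡⟨ trans (*-assoc (q⁴ * q²) 6 625) (*-assoc q⁴ q² 3750) ⟩
      q⁴ * (q² * 3750)          <⟨ *-monoʳ-< q⁴ w-large ⟩
      q⁴ * (w * 256)            ≡⟨ trans (cong (q⁴ *_) (*-comm w 256)) (sym (*-assoc q⁴ 256 w)) ⟩
      q⁴ * 256 * w              ≤⟨ *-monoˡ-≤ w 4⁴q⁴≤5⁴N⁴ ⟩
      N⁴ * 625 * w              ≡⟨ trans (*-assoc N⁴ 625 w) (trans (cong (N⁴ *_) (*-comm 625 w)) (sym (*-assoc N⁴ w 625))) ⟩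
      N⁴ * w * 625              ∎

  -- The size q² - q + 1 equals `q * N + 1`. Naming it `2 + k` lets the falling product (2 + k)(1 +
  -- k)k be written without subtraction, and `4 ≤ k` guarantees six points.
  section-size : ∀ {q N n} → 4 ≤ N → q ≡ suc N → n + q ≡ q * q + 1 → ∃[ k ] n ≡ 2 + k × 1 + k ≡ q * N × 4 ≤ k
  section-size {q} {N} {n} 4≤N refl n+q≡ = pred (q * N) ,
    +-cancelʳ-≡ q n _ (trans n+q≡ (trans (identity N) (cong (λ m → 1 + m + q) (sym qN≡)))) , qN≡ ,
    s≤s⁻¹ (subst (5 ≤_) (sym qN≡) (≤-trans (≤-trans (s≤s 4≤N) (m≤m*n q 4)) (*-monoʳ-≤ q 4≤N)))
    where
    identity : ∀ N → (1 + N) * (1 + N) + 1 ≡ 1 + (1 + N) * N + (1 + N)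
    identity = solve-∀
    qN≡ : 1 + pred (q * N) ≡ q * N
    qN≡ = suc-pred (q * N) {{m*n≢0 q N {{_}} {{>-nonZero (≤-trans (s≤s z≤n) 4≤N)}}}}

  -- Let d = q² + q + 1 - a. Since a ≥ q² - q, it is at most 2q + 1, so a + q d = q² + q + 1 + (q -
  -- 1) d is at most 3q², which is below q³ for q ≥ 4.
  pencil-count : ∀ {q n a b} → 4 ≤ q → n + q ≡ q * q + 1 → n ≤ suc a → a ≤ q * q + q + 1 → q ^ 3 ≤ a + b →
                 q * (q * q + q + 1 ∸ a) < b
  pencil-count {q} {n} {a} {b} 4≤q n+q≡ n≤1+a a≤M q³≤a+b = +-cancelʳ-< a (q * d) b (begin-strict
    q * d + a                    ≡⟨ cong (_+ a) (cong (_* d) (sym q≡)) ⟩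
    d + pred q * d + a           ≡⟨ trans (+-comm (d + pred q * d) a) (sym (+-assoc a d (pred q * d))) ⟩
    a + d + pred q * d           ≡⟨ cong (_+ pred q * d) a+d≡M ⟩
    q * q + q + 1 + pred q * d   ≤⟨ +-monoʳ-≤ (q * q + q + 1) (*-monoʳ-≤ (pred q) d≤) ⟩
    q * q + q + 1 + pred q * (q + q + 1) ≡⟨ cong (λ q → q * q + q + 1 + pred q * (q + q + 1)) q≡ ⟨
    suc (pred q) * suc (pred q) + suc (pred q) + 1 + pred q * (suc (pred q) + suc (pred q) + 1) ≡⟨ identity (pred q) ⟩
    3 * (suc (pred q) * suc (pred q)) ≡⟨ cong (λ q → 3 * (q * q)) q≡ ⟩
    3 * (q * q)                  <⟨ *-monoˡ-< (q * q) {{m*n≢0 q q}} 4≤q ⟩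
    q * (q * q)                  ≡⟨ cong (λ m → q * (q * m)) (*-identityʳ q) ⟨
    q ^ 3                        ≤⟨ q³≤a+b ⟩
    a + b                        ≡⟨ +-comm a b ⟩
    b + a                        ∎)
    where
    open ≤-Reasoning
    instance
      q≢0 : NonZero q
      q≢0 = >-nonZero (≤-trans (s≤s z≤n) 4≤q)
    d = q * q + q + 1 ∸ a
    q≡ : suc (pred q) ≡ q
    q≡ = suc-pred q
    a+d≡M : a + d ≡ q * q + q + 1
    a+d≡M = m+[n∸m]≡n a≤M
    identity : ∀ r → (1 + r) * (1 + r) + (1 + r) + 1 + r * ((1 + r) + (1 + r) + 1) ≡ 3 * ((1 + r) * (1 + r))
    identity = solve-∀
    q²≤a+q : q * q ≤ a + q
    q²≤a+q = s≤s⁻¹ (≤-trans (≤-reflexive (trans (+-comm 1 (q * q)) (sym n+q≡))) (+-monoˡ-≤ q n≤1+a))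
    rearrange : ∀ a q d → a + q + d ≡ a + d + q
    rearrange = solve-∀
    rearrange′ : ∀ q → q * q + q + 1 + q ≡ q * q + (q + q + 1)
    rearrange′ = solve-∀
    d≤ : d ≤ q + q + 1
    d≤ = +-cancelˡ-≤ (q * q) d (q + q + 1) (≤-trans (+-monoˡ-≤ d q²≤a+q)
      (≤-reflexive (trans (rearrange a q d) (trans (cong (_+ q) a+d≡M) (rearrange′ q)))))

  q²∸q+1+q : ∀ {q} → 4 ≤ q → q ^ 2 ∸ q + 1 + q ≡ q * q + 1
  q²∸q+1+q {q} 4≤q = trans (rearrange (q ^ 2 ∸ q) q) (cong (_+ 1) (trans
    (m∸n+n≡m {q ^ 2} {q} (≤-trans (m≤m*n q q {{>-nonZero (≤-trans (s≤s z≤n) 4≤q)}}) (≤-reflexive (sym q²≡)))) q²≡))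
    where
    q²≡ : q ^ 2 ≡ q * q
    q²≡ = cong (q *_) (*-identityʳ q)
    rearrange : ∀ a q → a + 1 + q ≡ a + q + 1
    rearrange = solve-∀

  q⁸≡ : ∀ q → q ^ 8 ≡ q * (q ^ 3 * (q ^ 3 * q))
  q⁸≡ q = identity q
    where
    identity : ∀ q → q * (q * (q * (q * (q * (q * (q * (q * 1))))))) ≡ q * (q * (q * (q * 1)) * (q * (q * (q * 1)) * q))
    identity = solve-∀

-- The projective line over `F`, and why a section contains no subline.

module HyperplaneSections where

  open Counting
  open CubicExtensions
  open Arithmetic
  open import Data.Empty using (⊥)
  open import Data.Fin.Base as Fin using (Fin; zero; suc; combine; remQuot)
  open import Data.Fin.Patterns using (4F)
  import Data.Fin.Properties as Fin
  open import Data.Nat.Base as ℕ using (ℕ; zero; suc; _≤_)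
  import Data.Nat.Properties as ℕ
  open import Data.Product.Base using (∃-syntax; _×_; _,_; proj₁; proj₂)
  open import Data.Sum.Base using (_⊎_; [_,_]′)
  import Data.Vec.Functional as V
  open import Function.Base using (_∘_)
  open import Relation.Binary.PropositionalEquality
  open import Relation.Nullary using (Dec; yes; no; contradiction; ¬?)
  open import Relation.Nullary.Decidable using (toSum)

  module Projective {q} (E : FiniteCubicExtension q) where

    open Theory E
    open ≡-Reasoning

    0₂ : F²
    0₂ = 0# , 0#

    -- Cramer's rule: the expansion of `p` in terms of `u` and `v`, cleared of the denominator
    -- `det u v`.
    plücker : ∀ u v p → proj₁ p * det u v ≡ det p v * proj₁ u + det u p * proj₁ v
                      × proj₂ p * det u v ≡ det p v * proj₂ u + det u p * proj₂ v
    plücker (u₀ , u₁) (v₀ , v₁) (p₀ , p₁) =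
      solve 6 (λ a b c d p r → p :* (a :* d :- b :* c) := (p :* d :- r :* c) :* a :+ (a :* r :- b :* p) :* c) refl u₀ u₁ v₀ v₁ p₀ p₁ ,
      solve 6 (λ a b c d p r → r :* (a :* d :- b :* c) := (p :* d :- r :* c) :* b :+ (a :* r :- b :* p) :* d) refl u₀ u₁ v₀ v₁ p₀ p₁

    det-self : ∀ v → det v v ≡ 0#
    det-self (a , b) = solve 2 (λ a b → a :* b :- b :* a := :0) refl a b

    det-swap : ∀ u v → det u v ≡ - det v u
    det-swap (a , b) (c , d) = solve 4 (λ a b c d → a :* d :- b :* c := :- (c :* b :- d :* a)) refl a b c d

    det-sym : ∀ {u v} → det u v ≡ 0# → det v u ≡ 0#
    det-sym {u} {v} uv≡0 = trans (det-swap v u) (trans (cong -_ uv≡0) (solve 0 (:- :0 := :0) refl))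

    det-≢0-sym : ∀ {u v} → det u v ≢ 0# → det v u ≢ 0#
    det-≢0-sym {u} {v} uv≢0 = uv≢0 ∘ det-sym {v} {u}

    det-trans : ∀ {u v p} → p ≢ 0₂ → det u p ≡ 0# → det v p ≡ 0# → det u v ≡ 0#
    det-trans {u} {v} {p@(p₀ , p₁)} p≢0 up≡0 vp≡0 with p₀ ≟ 0# | p₁ ≟ 0#
    ... | yes refl | yes refl = contradiction refl p≢0
    ... | no p₀≢0 | _ = *≡0ʳ p₀≢0 (trans (proj₁ (plücker u v p)) (trans
            (cong₂ (λ a b → a * proj₁ u + b * proj₁ v) (det-sym {v} {p} vp≡0) up≡0) (solve 2 (λ a b → :0 :* a :+ :0 :* b := :0) refl _ _)))
    ... | _ | no p₁≢0 = *≡0ʳ p₁≢0 (trans (proj₂ (plücker u v p)) (trans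
            (cong₂ (λ a b → a * proj₂ u + b * proj₂ v) (det-sym {v} {p} vp≡0) up≡0) (solve 2 (λ a b → :0 :* a :+ :0 :* b := :0) refl _ _)))

    det-combination : ∀ x y x′ y′ e₁ e₂ →
      det (x ⊡ e₁ ⊞ y ⊡ e₂) (x′ ⊡ e₁ ⊞ y′ ⊡ e₂) ≡ (x * y′ - y * x′) * det e₁ e₂
    det-combination x y x′ y′ (a , b) (c , d) = solve 8 (λ x y x′ y′ a b c d →
      (x :* a :+ y :* c) :* (x′ :* b :+ y′ :* d) :- (x :* b :+ y :* d) :* (x′ :* a :+ y′ :* c)
      := (x :* y′ :- y :* x′) :* (a :* d :- b :* c)) refl x y x′ y′ a b c d

    combination-≢0 : ∀ {e₁ e₂} x y → det e₁ e₂ ≢ 0# → y ≢ 0# → x ⊡ e₁ ⊞ y ⊡ e₂ ≢ 0₂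
    combination-≢0 {e₁} {e₂} x y det≢0 y≢0 comb≡0 = *-≢0 y≢0 det≢0 (begin
      y * det e₁ e₂                                   ≡⟨ solve 3 (λ x y d → y :* d := (:1 :* y :- :0 :* x) :* d) refl x y _ ⟩
      (1# * y - 0# * x) * det e₁ e₂                   ≡⟨ det-combination 1# 0# x y e₁ e₂ ⟨
      det (1# ⊡ e₁ ⊞ 0# ⊡ e₂) (x ⊡ e₁ ⊞ y ⊡ e₂)       ≡⟨ cong (det _) comb≡0 ⟩
      det (1# ⊡ e₁ ⊞ 0# ⊡ e₂) 0₂                      ≡⟨ solve 2 (λ a b → a :* :0 :- b :* :0 := :0) refl _ _ ⟩
      0#                                              ∎)

    det≢0⇒≢0ˡ : ∀ {u v} → det u v ≢ 0# → u ≢ 0₂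
    det≢0⇒≢0ˡ det≢0 refl = det≢0 (solve 2 (λ a b → :0 :* a :- :0 :* b := :0) refl _ _)

    ratio : ∀ v → proj₁ v ≢ 0# → Carrier
    ratio v v₀≢0 = proj₂ v * proj₁ (inverse (proj₁ v) v₀≢0)

    ⊡-ratio : ∀ v v₀≢0 → proj₁ v ⊡ affine (ratio v v₀≢0) ≡ v
    ⊡-ratio v v₀≢0 = cong₂ _,_ (*-identityʳ (proj₁ v))
      (trans (solve 3 (λ a b i → a :* (b :* i) := b :* (a :* i)) refl (proj₁ v) (proj₂ v) i)
        (trans (cong (proj₂ v *_) (proj₂ (inverse (proj₁ v) v₀≢0))) (*-identityʳ (proj₂ v))))
      where i = proj₁ (inverse (proj₁ v) v₀≢0)

    same-ratio⇒parallel : ∀ u v u₀≢0 v₀≢0 → ratio u u₀≢0 ≡ ratio v v₀≢0 → det u v ≡ 0#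
    same-ratio⇒parallel u v u₀≢0 v₀≢0 e = begin
      det u v ≡⟨ cong₂ det (⊡-ratio u u₀≢0) (⊡-ratio v v₀≢0) ⟨
      det (proj₁ u ⊡ affine (ratio u u₀≢0)) (proj₁ v ⊡ affine (ratio v v₀≢0))
        ≡⟨ cong (λ t → det (proj₁ u ⊡ affine (ratio u u₀≢0)) (proj₁ v ⊡ affine t)) e ⟨
      det (proj₁ u ⊡ affine (ratio u u₀≢0)) (proj₁ v ⊡ affine (ratio u u₀≢0))
        ≡⟨ solve 3 (λ a b t → (a :* :1) :* (b :* t) :- (a :* t) :* (b :* :1) := :0) refl (proj₁ u) (proj₁ v) (ratio u u₀≢0) ⟩
      0# ∎

    heads-zero⇒parallel : ∀ u v → proj₁ u ≡ 0# → proj₁ v ≡ 0# → det u v ≡ 0#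
    heads-zero⇒parallel (_ , a) (_ , b) refl refl = solve 2 (λ a b → :0 :* b :- a :* :0 := :0) refl a b

    -- Writes t ↦ Tr (c t) as a functional on points, so that the general degree bound also limits
    -- the zeros of a trace; the sharper bound q² is not called for.
    trace-functional : Carrier → F⁸
    trace-functional c = 0# V.∷ σ (σ c) V.∷ σ c V.∷ 0# V.∷ c V.∷ 0# V.∷ 0# V.∷ 0# V.∷ V.[]

    trace-functional-∙ : ∀ c t → trace-functional c ∙ point (affine t) ≡ Tr (c * t)
    trace-functional-∙ c t = begin
      trace-functional c ∙ tensor (1# , t) (σ 1# , σ t) (σ (σ 1#) , σ (σ t))
        ≡⟨ cong₂ (λ a b → trace-functional c ∙ tensor (1# , t) (a , σ t) (b , σ (σ t))) σ-1 (trans (cong σ σ-1) σ-1) ⟩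
      trace-functional c ∙ tensor (1# , t) (1# , σ t) (1# , σ (σ t))
        ≡⟨ solve 6 (λ c c′ c″ t t′ t″ →
             :0 :* (:1 :* :1 :* :1) :+ (c″ :* (:1 :* :1 :* t″) :+ (c′ :* (:1 :* t′ :* :1) :+ (:0 :* (:1 :* t′ :* t″) :+
             (c :* (t :* :1 :* :1) :+ (:0 :* (t :* :1 :* t″) :+ (:0 :* (t :* t′ :* :1) :+ (:0 :* (t :* t′ :* t″) :+ :0)))))))
             := c :* t :+ c′ :* t′ :+ c″ :* t″) refl c (σ c) (σ (σ c)) t (σ t) (σ (σ t)) ⟩
      c * t + σ c * σ t + σ (σ c) * σ (σ t)
        ≡⟨ cong₂ (λ a b → c * t + a + b) (σ-* c t) (trans (cong σ (σ-* c t)) (σ-* _ _)) ⟨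
      Tr (c * t) ∎

    zeros-bounded : ∀ (ψ : F⁸) j → ψ j ≢ 0# → ∀ {n} (r : Fin n → Carrier) → Inj r →
                    (∀ i → ψ ∙ point (affine (r i)) ≡ 0#) → n ≤ q ℕ.* q ℕ.+ q ℕ.+ 1
    zeros-bounded ψ j ψ≢0 {n} r r-inj roots with n ℕ.≤? q ℕ.* q ℕ.+ q ℕ.+ 1
    ... | yes n≤ = n≤
    ... | no  n≰ = contradiction (functional-zero ψ (subst (_≤ n) (sym (ℕ.+-suc (q ℕ.* q ℕ.+ q) 1)) (ℕ.≰⇒> n≰)) r r-inj roots j) ψ≢0

    -- There are q³ parameters t, more than the q² + q + 1 zeros that the degree allows.
    nonzero-value : ∀ (ψ : F⁸) j → ψ j ≢ 0# → ∃[ t ] ψ ∙ point (affine t) ≢ 0#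
    nonzero-value ψ j ψ≢0 = [ (λ found → found) , (λ vanish →
        contradiction (zeros-bounded ψ j ψ≢0 (λ t → t) (λ e → e) vanish) (ℕ.<⇒≱ (q²+q+1<q³ 4≤q))) ]′
      (nonzero? (λ t → ψ ∙ point (affine t)))

  -- The points of a hyperplane section of 𝒪₁, with the hyperplane cut out by w.
  record Section {q} (E : FiniteCubicExtension q) : Set where
    open Theory E
    field
      w         : F⁸
      invariant : Invariant w
    open Form w invariant public
    field
      u₀       : F²
      fu₀≢0    : f u₀ ≢ 0#
      n        : ℕ
      n+q≡     : n ℕ.+ q ≡ q ℕ.* q ℕ.+ 1
      pt       : Fin n → F²
      pt≢0     : ∀ i → pt i ≢ (0# , 0#)
      distinct : ∀ {i j} → i ≢ j → det (pt i) (pt j) ≢ 0#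
      f-pt     : ∀ i → f (pt i) ≡ 0#
      covers : ∀ v → v ≢ (0# , 0#) → f v ≡ 0# → ∃[ i ] det v (pt i) ≡ 0#

  module SectionTheory {q} {E : FiniteCubicExtension q} (S : Section E) where

    open Theory E
    open Projective E
    open Section S
    open ≡-Reasoning

    private
      fixed-+ : ∀ {x y} → Fixed x → Fixed y → Fixed (x + y)
      fixed-+ σx σy = trans (σ-+ _ _) (cong₂ _+_ σx σy)

    module NoSubline (e₁ e₂ : F²) (e₁e₂≢0 : det e₁ e₂ ≢ 0#) (fe₁≡0 : f e₁ ≡ 0#) (fe₂≡0 : f e₂ ≡ 0#)
                     (TrB≡0 : Tr (B e₁ e₂) ≡ 0#) (TrC≡0 : Tr (C e₁ e₂) ≡ 0#) where

      b c : Carrier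
      b = B e₁ e₂
      c = C e₁ e₂

      at : Carrier → F²
      at t = t ⊡ e₁ ⊞ 1# ⊡ e₂

      at≢0 : ∀ t → at t ≢ 0₂
      at≢0 t = combination-≢0 t 1# e₁e₂≢0 1≢0

      f-at : ∀ t → f (at t) ≡ Tr (b * t) + Tr (c * (σ t * σ (σ t)))
      f-at t = begin
        f (at t) ≡⟨ expand e₁ e₂ t 1# ⟩
        Nm t * f e₁ + Nm 1# * f e₂ + Tr (b * (t * σ 1# * σ (σ 1#))) + Tr (c * (1# * σ t * σ (σ t)))
          ≡⟨ cong₂ (λ y z → Nm t * y + Nm 1# * z + Tr (b * (t * σ 1# * σ (σ 1#))) + Tr (c * (1# * σ t * σ (σ t)))) fe₁≡0 fe₂≡0 ⟩
        Nm t * 0# + Nm 1# * 0# + Tr (b * (t * σ 1# * σ (σ 1#))) + Tr (c * (1# * σ t * σ (σ t)))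
          ≡⟨ solve 4 (λ n m x y → n :* :0 :+ m :* :0 :+ x :+ y := x :+ y) refl (Nm t) (Nm 1#) _ _ ⟩
        Tr (b * (t * σ 1# * σ (σ 1#))) + Tr (c * (1# * σ t * σ (σ t)))
          ≡⟨ cong₂ (λ y z → Tr (b * y) + Tr (c * z))
               (trans (cong₂ (λ y z → t * y * z) σ-1 (trans (cong σ σ-1) σ-1)) (solve 1 (λ t → t :* :1 :* :1 := t) refl t))
               (cong (_* σ (σ t)) (*-identityˡ (σ t))) ⟩
        Tr (b * t) + Tr (c * (σ t * σ (σ t))) ∎

      det-at : ∀ s t → det (at s) (at t) ≡ (s - t) * det e₁ e₂
      det-at s t = trans (det-combination s 1# t 1# e₁ e₂)
        (cong (_* det e₁ e₂) (solve 2 (λ s t → s :* :1 :- :1 :* t := s :- t) refl s t))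

      det-at-e₁ : ∀ t → det (at t) e₁ ≢ 0#
      det-at-e₁ t eq =
        *-≢0 1≢0 e₁e₂≢0 (trans (det-lemma e₁ e₂ t) (trans (cong -_ eq) (solve 0 (:- :0 := :0) refl)))
        where
        det-lemma : ∀ e₁ e₂ t → 1# * det e₁ e₂ ≡ - det (t ⊡ e₁ ⊞ 1# ⊡ e₂) e₁
        det-lemma (a , b) (c , d) t = solve 5 (λ a b c d t →
          :1 :* (a :* d :- b :* c) := :- ((t :* a :+ :1 :* c) :* b :- (t :* b :+ :1 :* d) :* a)) refl a b c d t

      -- f (at (t + s)) is affine in s ∈ K with slope - Tr (c t).
      f-translate : ∀ t {s} → Fixed s → f (at (t + s)) ≡ f (at t) - s * Tr (c * t)
      f-translate t {s} σs = begin
        f (at (t + s))    ≡⟨ f-at (t + s) ⟩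
        Tr (b * (t + s)) + Tr (c * (σ (t + s) * σ (σ (t + s))))
          ≡⟨ cong₂ (λ y z → Tr (b * (t + s)) + Tr (c * (y * z))) σts (trans (cong σ σts) (trans (σ-+ _ _) (cong (σ (σ t) +_) σs))) ⟩
        Tr (b * (t + s)) + Tr (c * ((σ t + s) * (σ (σ t) + s)))
          ≡⟨ cong₂ (λ y z → Tr y + Tr z)
               (solve 3 (λ b t s → b :* (t :+ s) := b :* t :+ s :* b) refl b t s)
               (solve 5 (λ c t t′ t″ s → c :* ((t′ :+ s) :* (t″ :+ s)) :=
                  c :* (t′ :* t″) :+ ((s :* (t :+ t′ :+ t″) :+ s :* s) :* c :+ :- s :* (c :* t))) refl c t (σ t) (σ (σ t)) s) ⟩
        Tr (b * t + s * b) + Tr (c * (σ t * σ (σ t)) + ((s * Tr t + s * s) * c + - s * (c * t)))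
          ≡⟨ cong₂ _+_ (trans (Tr-+ _ _) (cong (Tr (b * t) +_) (trans (Tr-*-fixed b σs) (cong (s *_) TrB≡0))))
               (trans (Tr-+ _ _) (cong (Tr (c * (σ t * σ (σ t))) +_) (trans (Tr-+ _ _) (cong₂ _+_
                 (trans (Tr-*-fixed c (fixed-+ (fixed-* σs (Tr-fixed t)) (fixed-* σs σs))) (cong ((s * Tr t + s * s) *_) TrC≡0))
                 (Tr-*-fixed (c * t) (trans (σ-neg s) (cong -_ σs))))))) ⟩
        (Tr (b * t) + s * 0#) + (Tr (c * (σ t * σ (σ t))) + ((s * Tr t + s * s) * 0# + - s * Tr (c * t)))
          ≡⟨ solve 5 (λ x y s r z → (x :+ s :* :0) :+ (y :+ (r :* :0 :+ :- s :* z)) := (x :+ y) :- s :* z) refl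
               (Tr (b * t)) (Tr (c * (σ t * σ (σ t)))) s (s * Tr t + s * s) (Tr (c * t)) ⟩
        (Tr (b * t) + Tr (c * (σ t * σ (σ t)))) - s * Tr (c * t) ≡⟨ cong (_- s * Tr (c * t)) (f-at t) ⟨
        f (at t) - s * Tr (c * t) ∎
        where
        σts : σ (t + s) ≡ σ t + s
        σts = trans (σ-+ t s) (cong (σ t +_) σs)

      f-at-fixed : ∀ {s} → Fixed s → f (at s) ≡ 0#
      f-at-fixed {s} σs = begin
        f (at s)                  ≡⟨ cong (f ∘ at) (+-identityˡ s) ⟨
        f (at (0# + s))           ≡⟨ f-translate 0# σs ⟩
        f (at 0#) - s * Tr (c * 0#) ≡⟨ cong₂ (λ x y → x - s * y) (trans (f-at 0#) (cong₂ _+_ (Tr-0 b)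
                                       (trans (cong (λ z → Tr (c * (z * σ (σ 0#)))) σ-0) (trans (cong (λ z → Tr (c * z)) (zeroˡ _)) (Tr-0 c))))) (Tr-0 c) ⟩
        (0# + 0#) - s * 0#        ≡⟨ solve 1 (λ s → (:0 :+ :0) :- s :* :0 := :0) refl s ⟩
        0#                        ∎
        where
        Tr-0 : ∀ c → Tr (c * 0#) ≡ 0#
        Tr-0 c = trans (cong Tr (zeroʳ c)) (trans (cong₂ (λ x y → 0# + x + y) σ-0 (trans (cong σ σ-0) σ-0))
          (solve 0 (:0 :+ :0 :+ :0 := :0) refl))

      Tr-c-fixed : ∀ {s} → Fixed s → Tr (c * s) ≡ 0#
      Tr-c-fixed {s} σs = trans (cong Tr (*-comm c s)) (trans (Tr-*-fixed c σs) (trans (cong (s *_) TrC≡0) (zeroʳ s)))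

      private
        section-at : ∀ v → v ≢ 0₂ → f v ≡ 0# → Fin n
        section-at v v≢0 fv≡0 = proj₁ (covers v v≢0 fv≡0)

        section-parallel : ∀ {u v} u≢0 fu v≢0 fv → section-at u u≢0 fu ≡ section-at v v≢0 fv → det u v ≡ 0#
        section-parallel {u} {v} u≢0 fu v≢0 fv eq = det-trans (pt≢0 _) (proj₂ (covers u u≢0 fu))
          (subst (λ i → det v (pt i) ≡ 0#) (sym eq) (proj₂ (covers v v≢0 fv)))

      -- The q + 1 points of the subline are zeros of f, and so is one point of each coset of K on which
      -- Tr (c t) ≠ 0; together these are more than q² - q + 1 points.
      absurd-c : c ≢ 0# → ⊥
      absurd-c c≢0 = subline-count 4≤q n+q≡ (n≤size+size Z N cover) Z-small (Fin.injective⇒≤ {f = g₁ ⊕ g₂} (λ {x} {y} → g-inj {x} {y}))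
        where
        Z : Enumeration (λ t → Tr (c * t) ≡ 0#)
        Z = enumerate (λ t → Tr (c * t) ≟ 0#)
        N : Enumeration (λ t → Tr (c * t) ≢ 0#)
        N = enumerate (λ t → ¬? (Tr (c * t) ≟ 0#))
        cover : ∀ t → Tr (c * t) ≡ 0# ⊎ Tr (c * t) ≢ 0#
        cover t = toSum (Tr (c * t) ≟ 0#)
        Z-small : size Z ≤ q ℕ.* q ℕ.+ q ℕ.+ 1
        Z-small = zeros-bounded (trace-functional c) 4F c≢0 (elem Z) (injective Z)
          λ i → trans (trace-functional-∙ c _) (sound Z i)

        module Translate (i : Fin (size N)) where
          t s⁻ s : Carrier
          t = elem N i
          s⁻ = proj₁ (inverse (Tr (c * t)) (sound N i))
          -- The root of the affine function of `f-translate`, whose slope is nonzero for this `t`.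
          s = f (at t) * s⁻
          f-at-σ : Fixed (f (at t))
          f-at-σ = invariant-∙ (point (at t)) (point (at t)) invariant (point-invariant (at t))
          σs : Fixed s
          σs = fixed-* f-at-σ (fixed-inverse (proj₂ (inverse (Tr (c * t)) (sound N i))) (Tr-fixed (c * t)))
          κ : ∃[ y ] ι y ≡ s
          κ = fixed⇒ι s σs
          zero-at : f (at (t + s)) ≡ 0#
          zero-at = trans (f-translate t σs) (trans
            (solve 3 (λ x i d → x :- x :* i :* d := x :* (:1 :- d :* i)) refl (f (at t)) s⁻ (Tr (c * t)))
            (trans (cong (λ z → f (at t) * (1# - z)) (proj₂ (inverse (Tr (c * t)) (sound N i))))
              (solve 1 (λ x → x :* (:1 :- :1) := :0) refl (f (at t)))))
          idx : Fin n
          idx = section-at (at (t + s)) (at≢0 _) zero-at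

        open Translate

        sub : Fin (suc q) → F²
        sub zero    = e₁
        sub (suc x) = at (ι x)
        sub≢0 : ∀ x → sub x ≢ 0₂
        sub≢0 zero    = det≢0⇒≢0ˡ e₁e₂≢0
        sub≢0 (suc x) = at≢0 _
        f-sub : ∀ x → f (sub x) ≡ 0#
        f-sub zero    = fe₁≡0
        f-sub (suc x) = f-at-fixed (σ-ι x)
        sub-idx : Fin (suc q) → Fin n
        sub-idx x = section-at (sub x) (sub≢0 x) (f-sub x)
        sub-parallel : ∀ x y → det (sub x) (sub y) ≡ 0# → x ≡ y
        sub-parallel zero    zero    _ = refl
        sub-parallel zero    (suc y) e = contradiction (det-sym {e₁} e) (det-at-e₁ _)
        sub-parallel (suc x) zero    e = contradiction e (det-at-e₁ _)
        sub-parallel (suc x) (suc y) e = cong suc (ι-injective (x-y≡0⇒x≡y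
          (*≡0ʳ e₁e₂≢0 (trans (*-comm _ _) (trans (sym (det-at _ _)) e)))))

        -- The target consists of pairs of a zero of `f` and an element of `K`. A pair made of t + s
        -- and s gives back t, which makes `g₁` injective; `g₂` takes each point of the subline with
        -- every element of `K`.
        g₁ : Fin (size N) → Fin (n ℕ.* q)
        g₁ i = combine (idx i) (proj₁ (κ i))
        base : Fin (suc q ℕ.* q) → Fin (suc q)
        base k = proj₁ (remQuot {suc q} q k)
        shift-by : Fin (suc q ℕ.* q) → Fin q
        shift-by k = proj₂ (remQuot {suc q} q k)
        g₂ : Fin (suc q ℕ.* q) → Fin (n ℕ.* q)
        g₂ k = combine (sub-idx (base k)) (shift-by k)
        g₁-inj : Inj g₁
        g₁-inj {i} {j} e = injective N (begin
          t i               ≡⟨ solve 2 (λ t s → t := (t :+ s) :- s) refl (t i) (s i) ⟩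
          (t i + s i) - s i ≡⟨ cong₂ _-_ same-zero same-s ⟩
          (t j + s j) - s j ≡⟨ solve 2 (λ t s → t := (t :+ s) :- s) refl (t j) (s j) ⟨
          t j               ∎)
          where
          idx≡κ≡ = Fin.combine-injective (idx i) (proj₁ (κ i)) (idx j) (proj₁ (κ j)) e
          same-s : s i ≡ s j
          same-s = trans (sym (proj₂ (κ i))) (trans (cong ι (proj₂ idx≡κ≡)) (proj₂ (κ j)))
          same-zero : t i + s i ≡ t j + s j
          same-zero = x-y≡0⇒x≡y (*≡0ʳ e₁e₂≢0 (trans (*-comm _ _) (trans (sym (det-at _ _))
            (section-parallel {at (t i + s i)} {at (t j + s j)} (at≢0 (t i + s i)) (zero-at i) (at≢0 (t j + s j)) (zero-at j) (proj₁ idx≡κ≡)))))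
        g₂-inj : Inj g₂
        g₂-inj {k} {l} e = trans (sym (Fin.combine-remQuot {suc q} q k)) (trans
          (cong₂ combine (sub-parallel (base k) (base l) (section-parallel {sub (base k)} {sub (base l)} (sub≢0 (base k)) (f-sub (base k))
            (sub≢0 (base l)) (f-sub (base l)) (proj₁ eqs))) (proj₂ eqs))
          (Fin.combine-remQuot {suc q} q l))
          where
          eqs = Fin.combine-injective (sub-idx (base k)) (shift-by k) (sub-idx (base l)) (shift-by l) e
        -- If the translate lay on the subline, t itself would lie in `K`, and there Tr (c t) is t
        -- times Tr c, hence zero.
        g-disjoint : ∀ i k → g₁ i ≢ g₂ k
        g-disjoint i k e = off-subline (base k)
          (section-parallel {at (t i + s i)} {sub (base k)} (at≢0 (t i + s i)) (zero-at i) (sub≢0 (base k)) (f-sub (base k))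
            (proj₁ (Fin.combine-injective (idx i) (proj₁ (κ i)) (sub-idx (base k)) (shift-by k) e)))
          where
          off-subline : ∀ x → det (at (t i + s i)) (sub x) ≢ 0#
          off-subline zero    par = det-at-e₁ _ par
          off-subline (suc y) par = sound N i (Tr-c-fixed (begin
            σ (t i)                   ≡⟨ cong σ t≡ ⟩
            σ (ι y - s i)             ≡⟨ trans (σ-+ _ _) (cong₂ _+_ (σ-ι y) (trans (σ-neg _) (cong -_ (σs i)))) ⟩
            ι y - s i                 ≡⟨ t≡ ⟨
            t i                       ∎))
            where
            t≡ : t i ≡ ι y - s i
            t≡ = trans (solve 2 (λ t s → t := (t :+ s) :- s) refl (t i) (s i)) (cong (_- s i)
              (x-y≡0⇒x≡y (*≡0ʳ e₁e₂≢0 (trans (*-comm _ _) (trans (sym (det-at _ _)) par)))))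
        g-inj : Inj (g₁ ⊕ g₂)
        g-inj {x} {y} = ⊕-injective {f = g₁} {g = g₂} (λ {i} {j} → g₁-inj {i} {j}) (λ {k} {l} → g₂-inj {k} {l}) g-disjoint {x} {y}

    -- `B` and `C` are exchanged along with `e₁` and `e₂`, so either of them being nonzero is
    -- refuted by `absurd-c`. If both vanish, so does the whole expansion of `f`, contrary to its
    -- value at `u₀`.
    no-subline : ∀ e₁ e₂ → det e₁ e₂ ≢ 0# → f e₁ ≡ 0# → f e₂ ≡ 0# →
                 Tr (B e₁ e₂) ≡ 0# → Tr (C e₁ e₂) ≡ 0# → ⊥
    no-subline e₁ e₂ det≢0 fe₁≡0 fe₂≡0 TrB≡0 TrC≡0 = cases (B e₁ e₂ ≟ 0#) (C e₁ e₂ ≟ 0#)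
      where
      x = det u₀ e₂
      y = det e₁ u₀
      coordinates : ∀ e₁ e₂ u → det e₁ e₂ ⊡ u ≡ det u e₂ ⊡ e₁ ⊞ det e₁ u ⊡ e₂
      coordinates (a , b) (c , d) (u , v) = cong₂ _,_
        (solve 6 (λ a b c d u v → (a :* d :- b :* c) :* u := (u :* d :- v :* c) :* a :+ (a :* v :- b :* u) :* c) refl a b c d u v)
        (solve 6 (λ a b c d u v → (a :* d :- b :* c) :* v := (u :* d :- v :* c) :* b :+ (a :* v :- b :* u) :* d) refl a b c d u v)
      vanish : ∀ {z r} → z ≡ 0# → Tr (z * r) ≡ 0#
      vanish {r = r} refl = trans (cong Tr (zeroˡ r)) (trans (cong₂ (λ x y → 0# + x + y) σ-0 (trans (cong σ σ-0) σ-0))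
        (solve 0 (:0 :+ :0 :+ :0 := :0) refl))
      cases : Dec (B e₁ e₂ ≡ 0#) → Dec (C e₁ e₂ ≡ 0#) → ⊥
      cases _         (no C≢0)  = NoSubline.absurd-c e₁ e₂ det≢0 fe₁≡0 fe₂≡0 TrB≡0 TrC≡0 C≢0
      cases (no B≢0)  (yes _)   = NoSubline.absurd-c e₂ e₁ (det-≢0-sym {e₁} {e₂} det≢0) fe₂≡0 fe₁≡0 TrC≡0 TrB≡0 B≢0
      cases (yes B≡0) (yes C≡0) = *-≢0 (Nm-≢0 det≢0) fu₀≢0 (begin
        Nm (det e₁ e₂) * f u₀                   ≡⟨ f-scale (det e₁ e₂) u₀ ⟨
        f (det e₁ e₂ ⊡ u₀)                      ≡⟨ cong f (coordinates e₁ e₂ u₀) ⟩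
        f (x ⊡ e₁ ⊞ y ⊡ e₂)                     ≡⟨ expand e₁ e₂ x y ⟩
        Nm x * f e₁ + Nm y * f e₂ + Tr (B e₁ e₂ * (x * σ y * σ (σ y))) + Tr (C e₁ e₂ * (y * σ x * σ (σ x)))
          ≡⟨ cong₂ (λ r s → r + Tr (B e₁ e₂ * (x * σ y * σ (σ y))) + s)
               (cong₂ (λ r s → Nm x * r + Nm y * s) fe₁≡0 fe₂≡0) (vanish C≡0) ⟩
        Nm x * 0# + Nm y * 0# + Tr (B e₁ e₂ * (x * σ y * σ (σ y))) + 0#
          ≡⟨ cong (λ r → Nm x * 0# + Nm y * 0# + r + 0#) (vanish B≡0) ⟩
        Nm x * 0# + Nm y * 0# + 0# + 0#         ≡⟨ solve 2 (λ a b → a :* :0 :+ b :* :0 :+ :0 :+ :0 := :0) refl (Nm x) (Nm y) ⟩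
        0#                                      ∎)

-- Any five points of the section are independent.

module FiveGenerality where

  open CubicExtensions
  open HyperplaneSections
  open import Data.Empty using (⊥)
  open import Data.Fin.Base as Fin using (Fin; punchIn; punchOut)
  open import Data.Fin.Patterns using (0F; 1F; 2F; 3F)
  import Data.Fin.Properties as Fin
  open import Data.Product.Base using (_,_; proj₁; proj₂)
  open import Function.Base using (_∘_)
  open import Relation.Binary.PropositionalEquality
  open import Relation.Nullary using (yes; no; contradiction)

  module _ {q} {E : FiniteCubicExtension q} (S : Section E) where

    open Theory E
    open Projective E
    open Section S
    open SectionTheory S using (no-subline)
    open ≡-Reasoning

    -- Four points with cross ratio in K lie on a subline v₁ , v₂ , v₁ + k v₂ after rescaling;
    -- there f is (k Tr B + k² Tr C), with three zeros.
    no-cross-ratio-in-K : ∀ v₁ v₂ v₃ v₄ → det v₁ v₂ ≢ 0# → det v₃ v₁ ≢ 0# → det v₃ v₂ ≢ 0# → det v₄ v₁ ≢ 0# →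
                  det v₄ v₂ ≢ 0# → det v₃ v₄ ≢ 0# → f v₁ ≡ 0# → f v₂ ≡ 0# → f v₃ ≡ 0# → f v₄ ≡ 0# →
                  det v₃ v₁ * det v₄ v₂ * σ (det v₃ v₂ * det v₄ v₁) ≡ det v₃ v₂ * det v₄ v₁ * σ (det v₃ v₁ * det v₄ v₂) → ⊥
    no-cross-ratio-in-K v₁ v₂ v₃ v₄ ≢₁₂ a≢0 b≢0 c≢0 d≢0 ≢₃₄ fv₁ fv₂ fv₃ fv₄ ratio∈K =
      no-subline e₁ e₂ e₁e₂≢0 fe₁ fe₂ TrB≡0 (trans (solve 2 (λ x y → y := (x :+ y) :- x) refl (Tr (B e₁ e₂)) (Tr (C e₁ e₂)))
        (trans (cong₂ _-_ at-1 TrB≡0) (solve 0 (:0 :- :0 := :0) refl)))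
      where
      a = det v₃ v₁
      b = det v₃ v₂
      c = det v₄ v₁
      d = det v₄ v₂
      bc≢0 = *-≢0 b≢0 c≢0
      ad≢0 = *-≢0 a≢0 d≢0
      i = proj₁ (inverse (a * d) ad≢0)
      adi≡1 = proj₂ (inverse (a * d) ad≢0)
      -- A cross ratio of the four points: after the rescaling below, v₃ is proportional to e₁ + e₂
      -- and v₄ to e₁ + k e₂.
      k = b * c * i
      σk : Fixed k
      σk = *-cancelˡ (σ-≢0 ad≢0) (*-cancelˡ ad≢0 (begin
        a * d * (σ (a * d) * σ k)   ≡⟨ cong (a * d *_) (σ-* (a * d) k) ⟨
        a * d * σ (a * d * k)       ≡⟨ cong (λ z → a * d * σ z) adk≡bc ⟩
        a * d * σ (b * c)           ≡⟨ ratio∈K ⟩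
        b * c * σ (a * d)           ≡⟨ cong (_* σ (a * d)) adk≡bc ⟨
        a * d * k * σ (a * d)       ≡⟨ solve 3 (λ x y z → x :* z :* y := x :* (y :* z)) refl (a * d) (σ (a * d)) k ⟩
        a * d * (σ (a * d) * k)     ∎))
        where
        adk≡bc : a * d * k ≡ b * c
        adk≡bc = trans (solve 3 (λ x y z → x :* (y :* z) := y :* (x :* z)) refl (a * d) (b * c) i)
          (trans (cong (b * c *_) adi≡1) (*-identityʳ (b * c)))
      k≢0 : k ≢ 0#
      k≢0 = *-≢0 bc≢0 (inverse-≢0 adi≡1)
      e₁ = b ⊡ v₁
      e₂ = (- a) ⊡ v₂
      det-⊡ : ∀ x y u v → det (x ⊡ u) (y ⊡ v) ≡ x * y * det u v
      det-⊡ x y (u , u′) (v , v′) = solve 6 (λ x y u u′ v v′ →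
        (x :* u) :* (y :* v′) :- (x :* u′) :* (y :* v) := x :* y :* (u :* v′ :- u′ :* v)) refl x y u u′ v v′
      -≢0 : ∀ {x} → x ≢ 0# → - x ≢ 0#
      -≢0 {x} x≢0 -x≡0 = x≢0 (trans (solve 1 (λ x → x := :- (:- x)) refl x) (trans (cong -_ -x≡0) (solve 0 (:- :0 := :0) refl)))
      e₁e₂≢0 : det e₁ e₂ ≢ 0#
      e₁e₂≢0 eq = *-≢0 (*-≢0 b≢0 (-≢0 a≢0)) ≢₁₂ (trans (sym (det-⊡ b (- a) v₁ v₂)) eq)
      f-⊡ : ∀ x {v} → f v ≡ 0# → f (x ⊡ v) ≡ 0#
      f-⊡ x {v} fv≡0 = trans (f-scale x v) (trans (cong (Nm x *_) fv≡0) (zeroʳ (Nm x)))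
      fe₁ = f-⊡ b fv₁
      fe₂ = f-⊡ (- a) fv₂
      sum-e : ∀ v₁ v₂ v₃ → 1# ⊡ (det v₃ v₂ ⊡ v₁) ⊞ 1# ⊡ ((- det v₃ v₁) ⊡ v₂) ≡ det v₁ v₂ ⊡ v₃
      sum-e (x , x′) (y , y′) (z , z′) = cong₂ _,_
        (solve 6 (λ x x′ y y′ z z′ → :1 :* ((z :* y′ :- z′ :* y) :* x) :+ :1 :* (:- (z :* x′ :- z′ :* x) :* y)
           := (x :* y′ :- x′ :* y) :* z) refl x x′ y y′ z z′)
        (solve 6 (λ x x′ y y′ z z′ → :1 :* ((z :* y′ :- z′ :* y) :* x′) :+ :1 :* (:- (z :* x′ :- z′ :* x) :* y′)
           := (x :* y′ :- x′ :* y) :* z′) refl x x′ y y′ z z′)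
      sum-ke : 1# ⊡ e₁ ⊞ k ⊡ e₂ ≡ (b * a * i * det v₁ v₂) ⊡ v₄
      sum-ke = cong₂ _,_
        (coordinate (proj₁ v₁) (proj₁ v₂) (proj₁ v₄) (solve 6 (λ x x′ y y′ z z′ →
           (x :* y′ :- x′ :* y) :* z := (z :* y′ :- z′ :* y) :* x :- (z :* x′ :- z′ :* x) :* y) refl
           (proj₁ v₁) (proj₂ v₁) (proj₁ v₂) (proj₂ v₂) (proj₁ v₄) (proj₂ v₄)))
        (coordinate (proj₂ v₁) (proj₂ v₂) (proj₂ v₄) (solve 6 (λ x x′ y y′ z z′ →
           (x :* y′ :- x′ :* y) :* z′ := (z :* y′ :- z′ :* y) :* x′ :- (z :* x′ :- z′ :* x) :* y′) refl
           (proj₁ v₁) (proj₂ v₁) (proj₁ v₂) (proj₂ v₂) (proj₁ v₄) (proj₂ v₄)))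
        where
        coordinate : ∀ x y z → det v₁ v₂ * z ≡ d * x - c * y →
                     1# * (b * x) + k * (- a * y) ≡ b * a * i * det v₁ v₂ * z
        coordinate x y z eq = begin
          1# * (b * x) + k * (- a * y)             ≡⟨ cong (λ o → o * (b * x) + k * (- a * y)) adi≡1 ⟨
          a * d * i * (b * x) + k * (- a * y)
            ≡⟨ solve 7 (λ a b c d i x y → a :* d :* i :* (b :* x) :+ b :* c :* i :* (:- a :* y)
                 := b :* a :* i :* (d :* x :- c :* y)) refl a b c d i x y ⟩
          b * a * i * (d * x - c * y)              ≡⟨ cong (b * a * i *_) eq ⟨
          b * a * i * (det v₁ v₂ * z)              ≡⟨ *-assoc _ _ _ ⟨
          b * a * i * det v₁ v₂ * z                ∎
      -- For κ in `K` the conjugates collapse, and the outer terms of the binary cubic vanish with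
      -- `f e₁` and `f e₂`. What remains is κ² Tr B + κ Tr C, whose values at 1 and k determine both
      -- traces.
      at-fixed : ∀ {κ} → Fixed κ → f (1# ⊡ e₁ ⊞ κ ⊡ e₂) ≡ 0# → κ * (κ * Tr (B e₁ e₂) + Tr (C e₁ e₂)) ≡ 0#
      at-fixed {κ} σκ fe≡0 = begin
        κ * (κ * Tr (B e₁ e₂) + Tr (C e₁ e₂))
          ≡⟨ solve 5 (λ κ x y n m → κ :* (κ :* x :+ y) := n :* :0 :+ m :* :0 :+ κ :* κ :* x :+ κ :* y) refl
               κ (Tr (B e₁ e₂)) (Tr (C e₁ e₂)) (Nm 1#) (Nm κ) ⟩
        Nm 1# * 0# + Nm κ * 0# + κ * κ * Tr (B e₁ e₂) + κ * Tr (C e₁ e₂)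
          ≡⟨ cong₂ (λ x y → Nm 1# * 0# + Nm κ * 0# + x + y) (Tr-*-fixed (B e₁ e₂) (fixed-* σκ σκ)) (Tr-*-fixed (C e₁ e₂) σκ) ⟨
        Nm 1# * 0# + Nm κ * 0# + Tr (κ * κ * B e₁ e₂) + Tr (κ * C e₁ e₂)
          ≡⟨ cong₂ (λ x y → Nm 1# * 0# + Nm κ * 0# + Tr x + Tr y) κκ κ11 ⟩
        Nm 1# * 0# + Nm κ * 0# + Tr (B e₁ e₂ * (1# * σ κ * σ (σ κ))) + Tr (C e₁ e₂ * (κ * σ 1# * σ (σ 1#)))
          ≡⟨ cong₂ (λ x y → Nm 1# * x + Nm κ * y + Tr (B e₁ e₂ * (1# * σ κ * σ (σ κ))) + Tr (C e₁ e₂ * (κ * σ 1# * σ (σ 1#)))) fe₁ fe₂ ⟨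
        Nm 1# * f e₁ + Nm κ * f e₂ + Tr (B e₁ e₂ * (1# * σ κ * σ (σ κ))) + Tr (C e₁ e₂ * (κ * σ 1# * σ (σ 1#)))
          ≡⟨ expand e₁ e₂ 1# κ ⟨
        f (1# ⊡ e₁ ⊞ κ ⊡ e₂) ≡⟨ fe≡0 ⟩
        0# ∎
        where
        κκ : κ * κ * B e₁ e₂ ≡ B e₁ e₂ * (1# * σ κ * σ (σ κ))
        κκ = trans (solve 2 (λ κ x → κ :* κ :* x := x :* (:1 :* κ :* κ)) refl κ (B e₁ e₂))
          (sym (cong₂ (λ x y → B e₁ e₂ * (1# * x * y)) σκ (trans (cong σ σκ) σκ)))
        κ11 : κ * C e₁ e₂ ≡ C e₁ e₂ * (κ * σ 1# * σ (σ 1#))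
        κ11 = trans (solve 2 (λ κ x → κ :* x := x :* (κ :* :1 :* :1)) refl κ (C e₁ e₂))
          (sym (cong₂ (λ x y → C e₁ e₂ * (κ * x * y)) σ-1 (trans (cong σ σ-1) σ-1)))
      at-1 : Tr (B e₁ e₂) + Tr (C e₁ e₂) ≡ 0#
      at-1 = trans (solve 2 (λ x y → x :+ y := :1 :* (:1 :* x :+ y)) refl (Tr (B e₁ e₂)) (Tr (C e₁ e₂)))
        (at-fixed σ-1 (trans (cong f (sum-e v₁ v₂ v₃)) (f-⊡ (det v₁ v₂) fv₃)))
      at-k : k * Tr (B e₁ e₂) + Tr (C e₁ e₂) ≡ 0#
      at-k = *≡0ʳ k≢0 (at-fixed σk (trans (cong f sum-ke) (f-⊡ (b * a * i * det v₁ v₂) fv₄)))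
      -- By the Plücker relation, k = 1 would make `v₃` and `v₄` proportional.
      k≢1 : k - 1# ≢ 0#
      k≢1 k-1≡0 = *-≢0 ≢₁₂ ≢₃₄ (begin
        det v₁ v₂ * det v₃ v₄                  ≡⟨ identity v₁ v₂ v₃ v₄ ⟩
        a * d - b * c                          ≡⟨ cong (_- b * c) (*-identityʳ (a * d)) ⟨
        a * d * 1# - b * c                     ≡⟨ cong (λ z → a * d * z - b * c) (x-y≡0⇒x≡y k-1≡0) ⟨
        a * d * (b * c * i) - b * c            ≡⟨ solve 3 (λ x y i → y :* (x :* i) :- x := x :* (y :* i :- :1)) refl (b * c) (a * d) i ⟩
        b * c * (a * d * i - 1#)               ≡⟨ cong (λ z → b * c * (z - 1#)) adi≡1 ⟩
        b * c * (1# - 1#)                      ≡⟨ solve 1 (λ x → x :* (:1 :- :1) := :0) refl (b * c) ⟩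
        0#                                     ∎)
        where
        identity : ∀ v₁ v₂ v₃ v₄ → det v₁ v₂ * det v₃ v₄ ≡ det v₃ v₁ * det v₄ v₂ - det v₃ v₂ * det v₄ v₁
        identity (x , x′) (y , y′) (z , z′) (u , u′) = solve 8 (λ x x′ y y′ z z′ u u′ →
          (x :* y′ :- x′ :* y) :* (z :* u′ :- z′ :* u) := (z :* x′ :- z′ :* x) :* (u :* y′ :- u′ :* y)
          :- (z :* y′ :- z′ :* y) :* (u :* x′ :- u′ :* x)) refl x x′ y y′ z z′ u u′
      TrB≡0 : Tr (B e₁ e₂) ≡ 0#
      TrB≡0 = *≡0ʳ k≢1 (trans (solve 3 (λ k x y → (k :- :1) :* x := (k :* x :+ y) :- (x :+ y)) refl k (Tr (B e₁ e₂)) (Tr (C e₁ e₂)))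
        (trans (cong₂ _-_ at-k at-1) (solve 0 (:0 :- :0 := :0) refl)))

    -- Killing three of five dependent points by a product functional leaves two terms; interchanging the
    -- roles of two of the killed points and comparing shows that a cross ratio lies in K.
    five-independent : (v : Fin 5 → F²) → (∀ {i j} → i ≢ j → det (v i) (v j) ≢ 0#) → (∀ i → f (v i) ≡ 0#) →
                       (x : Fin 5 → Carrier) → (∀ j → combination x (point ∘ v) j ≡ 0#) → ∀ i → x i ≡ 0#
    five-independent v det≢0 f-v x dependent i with x i ≟ 0#
    ... | yes xᵢ≡0 = xᵢ≡0
    ... | no  xᵢ≢0 = contradiction ratio∈K (no-cross-ratio-in-K (v j) (v k) (v i) (v m)
            (det≢0 (p≢p 1F 2F λ ())) (det≢0 (i≢p 1F)) (det≢0 (i≢p 2F)) (det≢0 (p≢p 0F 1F λ ())) (det≢0 (p≢p 0F 2F λ ()))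
            (det≢0 (i≢p 0F)) (f-v j) (f-v k) (f-v i) (f-v m))
      where
      p = punchIn i
      m = p 0F
      j = p 1F
      k = p 2F
      l = p 3F
      i≢p : ∀ h → i ≢ p h
      i≢p h = Fin.punchInᵢ≢i i h ∘ sym
      p≢p : ∀ g h → g ≢ h → p g ≢ p h
      p≢p g h g≢h = g≢h ∘ Fin.punchIn-injective i g h
      term : F² → F² → F² → F² → Carrier
      term u a b c = det u a * σ (det u b) * σ (σ (det u c))
      functional : F² → F² → F² → F⁸
      functional a b c = tensor (a ᗮ) ((σ₂ b) ᗮ) ((σ₂ (σ₂ c)) ᗮ)
      functional-point : ∀ a b c u → functional a b c ∙ point u ≡ term u a b c
      functional-point a b c u = trans (tensor-ᗮ u (σ₂ u) (σ₂ (σ₂ u)) a (σ₂ b) (σ₂ (σ₂ c)))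
        (sym (cong₂ (λ y z → det u a * y * z) (σ-det u b) (trans (cong σ (σ-det u c)) (σ-det (σ₂ u) (σ₂ c)))))
      kill : ∀ {z} → z ≡ 0# → σ z ≡ 0#
      kill refl = σ-0
      two-terms : ∀ a b c → term (v j) a b c ≡ 0# → term (v k) a b c ≡ 0# → term (v l) a b c ≡ 0# →
                  x i * term (v i) a b c + x m * term (v m) a b c ≡ 0#
      two-terms a b c j≡0 k≡0 l≡0 = begin
        x i * term (v i) a b c + x m * term (v m) a b c
          ≡⟨ sum-pair {f = λ h → x h * term (v h) a b c} (i≢p 0F) rest ⟨
        sum (λ h → x h * term (v h) a b c) ≡⟨ sum-cong-≗ (λ h → cong (x h *_) (functional-point a b c (v h))) ⟨
        sum (λ h → x h * (functional a b c ∙ point (v h))) ≡⟨ ∙-combination (functional a b c) x (point ∘ v) ⟨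
        functional a b c ∙ combination x (point ∘ v)
          ≡⟨ sum-zero (λ h → trans (cong (functional a b c h *_) (dependent h)) (zeroʳ (functional a b c h))) ⟩
        0# ∎
        where
        vanish : ∀ h → term (v h) a b c ≡ 0# → x h * term (v h) a b c ≡ 0#
        vanish h e = trans (cong (x h *_) e) (zeroʳ (x h))
        rest : ∀ h → h ≢ i → h ≢ m → x h * term (v h) a b c ≡ 0#
        rest h h≢i h≢m = subst (λ h → x h * term (v h) a b c ≡ 0#) p≡h (cases (punchOut (h≢i ∘ sym)) (λ e → h≢m (trans (sym p≡h) (cong p e))))
          where
          p≡h : p (punchOut (h≢i ∘ sym)) ≡ h
          p≡h = Fin.punchIn-punchOut (h≢i ∘ sym)
          cases : ∀ g → g ≢ 0F → x (p g) * term (v (p g)) a b c ≡ 0#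
          cases 0F g≢0 = contradiction refl g≢0
          cases 1F _   = vanish j j≡0
          cases 2F _   = vanish k k≡0
          cases 3F _   = vanish l l≡0
      term-a : ∀ u b c → term u u b c ≡ 0#
      term-a u b c = trans (cong (λ z → z * σ (det u b) * σ (σ (det u c))) (det-self u)) (solve 2 (λ y z → :0 :* y :* z := :0) refl _ _)
      term-b : ∀ u a c → term u a u c ≡ 0#
      term-b u a c = trans (cong (λ z → det u a * z * σ (σ (det u c))) (kill (det-self u))) (solve 2 (λ y z → y :* :0 :* z := :0) refl _ _)
      term-c : ∀ u a b → term u a b u ≡ 0#
      term-c u a b = trans (cong (λ z → det u a * σ (det u b) * z) (kill (kill (det-self u)))) (zeroʳ _)
      eq₁ = two-terms (v j) (v k) (v l) (term-a (v j) (v k) (v l)) (term-b (v k) (v j) (v l)) (term-c (v l) (v j) (v k))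
      eq₂ = two-terms (v k) (v j) (v l) (term-b (v j) (v k) (v l)) (term-a (v k) (v j) (v l)) (term-c (v l) (v k) (v j))
      a = det (v i) (v j)
      b = det (v i) (v k)
      c = det (v m) (v j)
      d = det (v m) (v k)
      e = σ (σ (det (v i) (v l)))
      g = σ (σ (det (v m) (v l)))
      e≢0 : e ≢ 0#
      e≢0 = σ-≢0 (σ-≢0 (det≢0 (i≢p 3F)))
      g≢0 : g ≢ 0#
      g≢0 = σ-≢0 (σ-≢0 (det≢0 (p≢p 0F 3F λ ())))
      xₘ≢0 : x m ≢ 0#
      xₘ≢0 xₘ≡0 = *-≢0 xᵢ≢0 (*-≢0 (*-≢0 (det≢0 (i≢p 1F)) (σ-≢0 (det≢0 (i≢p 2F)))) e≢0) (begin
        x i * (a * σ b * e)                              ≡⟨ +-identityʳ _ ⟨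
        x i * (a * σ b * e) + 0#                         ≡⟨ cong (x i * (a * σ b * e) +_) (trans (cong (_* (c * σ d * g)) xₘ≡0) (zeroˡ _)) ⟨
        x i * (a * σ b * e) + x m * (c * σ d * g)        ≡⟨ eq₁ ⟩
        0#                                               ∎)
      factor = x i * e * (x m * g)
      ratio∈K : a * d * σ (b * c) ≡ b * c * σ (a * d)
      ratio∈K = *-cancelˡ {factor} (*-≢0 (*-≢0 xᵢ≢0 e≢0) (*-≢0 xₘ≢0 g≢0)) (begin
        factor * (a * d * σ (b * c))        ≡⟨ cong (λ z → factor * (a * d * z)) (σ-* b c) ⟩
        factor * (a * d * (σ b * σ c))
          -- Both relations are multiplied so that the terms without `x i` agree and cancel in the
          -- difference.
          ≡⟨ solve 12 (λ x e y g a d b′ c′ b c a′ d′ →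
               x :* e :* (y :* g) :* (a :* d :* (b′ :* c′))
               := x :* e :* (y :* g) :* (b :* c :* (a′ :* d′))
                  :+ ((x :* (a :* b′ :* e) :+ y :* (c :* d′ :* g)) :* (y :* (d :* c′ :* g))
                  :- (x :* (b :* a′ :* e) :+ y :* (d :* c′ :* g)) :* (y :* (c :* d′ :* g))))
               refl (x i) e (x m) g a d (σ b) (σ c) b c (σ a) (σ d) ⟩
        factor * (b * c * (σ a * σ d)) + ((x i * (a * σ b * e) + x m * (c * σ d * g)) * (x m * (d * σ c * g))
          - (x i * (b * σ a * e) + x m * (d * σ c * g)) * (x m * (c * σ d * g)))
          ≡⟨ cong₂ (λ y z → factor * (b * c * (σ a * σ d)) + (y * (x m * (d * σ c * g)) - z * (x m * (c * σ d * g)))) eq₁ eq₂ ⟩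
        factor * (b * c * (σ a * σ d)) + (0# * (x m * (d * σ c * g)) - 0# * (x m * (c * σ d * g)))
          ≡⟨ solve 3 (λ x y z → x :+ (:0 :* y :- :0 :* z) := x) refl (factor * (b * c * (σ a * σ d))) _ _ ⟩
        factor * (b * c * (σ a * σ d))      ≡⟨ cong (λ z → factor * (b * c * z)) (σ-* a d) ⟨
        factor * (b * c * σ (a * d))        ∎)

-- Double counting with sums of indicators.

module DoubleCounting where

  open import Data.Fin.Base as Fin using (Fin; zero; suc)
  import Data.Fin.Properties as Fin
  open import Data.Nat.Base
  open import Data.Nat.Properties
  open import Data.Nat.Tactic.RingSolver using (solve-∀)
  open import Data.Product.Base using (∃-syntax; _,_)
  open import Function.Base using (_∘_)
  open import Relation.Binary.PropositionalEquality
  open import Relation.Nullary using (Dec; ¬_; yes; no; contradiction)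
  open import Algebra.Properties.Semiring.Sum +-*-semiring
    using (sum; sum-cong-≗; sum-remove; ∑-distrib-+; ∑-comm; sum-replicate-zero; *-distribˡ-sum; *-distribʳ-sum)

  sum-mono : ∀ {n} {f g : Fin n → ℕ} → (∀ i → f i ≤ g i) → sum f ≤ sum g
  sum-mono {zero}  f≤g = z≤n
  sum-mono {suc n} f≤g = +-mono-≤ (f≤g zero) (sum-mono (f≤g ∘ suc))

  sum-const : ∀ n c → sum {n} (λ _ → c) ≡ n * c
  sum-const zero    c = refl
  sum-const (suc n) c = cong (c +_) (sum-const n c)

  sum-zero : ∀ {n} {f : Fin n → ℕ} → (∀ i → f i ≡ 0) → sum f ≡ 0
  sum-zero {n} f≡0 = trans (sum-cong-≗ f≡0) (sum-replicate-zero n)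

  𝟙 : ∀ {p} {P : Set p} → Dec P → ℕ
  𝟙 (yes _) = 1
  𝟙 (no _)  = 0

  𝟙-mono : ∀ {p r} {P : Set p} {R : Set r} (P? : Dec P) (R? : Dec R) → (P → R) → 𝟙 P? ≤ 𝟙 R?
  𝟙-mono (no _)  R?      P⇒R = z≤n
  𝟙-mono (yes p) (yes _) P⇒R = ≤-refl
  𝟙-mono (yes p) (no ¬r) P⇒R = contradiction (P⇒R p) ¬r

  𝟙-cong : ∀ {p r} {P : Set p} {R : Set r} (P? : Dec P) (R? : Dec R) → (P → R) → (R → P) → 𝟙 P? ≡ 𝟙 R?
  𝟙-cong P? R? P⇒R R⇒P = ≤-antisym (𝟙-mono P? R? P⇒R) (𝟙-mono R? P? R⇒P)

  𝟙-no : ∀ {p} {P : Set p} (P? : Dec P) → ¬ P → 𝟙 P? ≡ 0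
  𝟙-no (yes p) ¬p = contradiction p ¬p
  𝟙-no (no _)  _  = refl

  𝟙≤1 : ∀ {p} {P : Set p} (P? : Dec P) → 𝟙 P? ≤ 1
  𝟙≤1 (yes _) = ≤-refl
  𝟙≤1 (no _)  = z≤n

  sum-𝟙≡ : ∀ {n} (i : Fin n) → sum (λ j → 𝟙 (i Fin.≟ j)) ≡ 1
  sum-𝟙≡ {suc n} zero    = cong suc (sum-zero {n} λ j → 𝟙-no (zero Fin.≟ suc j) λ ())
  sum-𝟙≡ {suc n} (suc i) = trans (sum-cong-≗ λ j → 𝟙-cong (suc i Fin.≟ suc j) (i Fin.≟ j) Fin.suc-injective (cong suc)) (sum-𝟙≡ i)

  sum-at-most-one : ∀ {n p} {P : Fin n → Set p} (P? : ∀ i → Dec (P i)) → (∀ {i j} → P i → P j → i ≡ j) →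
                    sum (λ i → 𝟙 (P? i)) ≤ 1
  sum-at-most-one {zero}  P? unique = z≤n
  sum-at-most-one {suc n} P? unique with P? zero
  ... | no _   = sum-at-most-one (P? ∘ suc) λ p p′ → Fin.suc-injective (unique p p′)
  ... | yes p₀ = s≤s (≤-reflexive (sum-zero λ i → 𝟙-no (P? (suc i)) λ p → contradiction (unique p₀ p) λ ()))

  -- The fibres have sizes m_c with Σ m_c = n, and m² ≥ 3m - 2 for every natural number m.
  fibre-pairs : ∀ {n m} (f : Fin n → Fin m) →
                3 * n ≤ sum (λ i → sum (λ j → 𝟙 (f i Fin.≟ f j))) + 2 * m
  fibre-pairs {n} {m} f = begin
    3 * n                                                  ≡⟨ cong (3 *_) total ⟨
    3 * sum fibre                                          ≡⟨ *-distribˡ-sum 3 fibre ⟩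
    sum (λ c → 3 * fibre c)                                ≤⟨ sum-mono (λ c → 3m≤m²+2 (fibre c)) ⟩
    sum (λ c → fibre c * fibre c + 2)                      ≡⟨ ∑-distrib-+ (λ c → fibre c * fibre c) (λ _ → 2) ⟩
    sum (λ c → fibre c * fibre c) + sum {m} (λ _ → 2)      ≡⟨ cong₂ _+_ pairs (trans (sum-const m 2) (*-comm m 2)) ⟩
    sum (λ i → sum (λ j → 𝟙 (f i Fin.≟ f j))) + 2 * m ∎
    where
    open ≤-Reasoning
    fibre : Fin m → ℕ
    fibre c = sum (λ i → 𝟙 (f i Fin.≟ c))
    total : sum fibre ≡ n
    total = trans (∑-comm (λ c i → 𝟙 (f i Fin.≟ c))) (trans (sum-cong-≗ (sum-𝟙≡ ∘ f)) (trans (sum-const n 1) (*-identityʳ n)))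
    3m≤m²+2 : ∀ m → 3 * m ≤ m * m + 2
    3m≤m²+2 zero          = z≤n
    3m≤m²+2 (suc zero)    = ≤-refl
    3m≤m²+2 (suc (suc m)) = subst (3 * suc (suc m) ≤_) (sym (identity m)) (m≤m+n (3 * suc (suc m)) (m * m + m))
      where
      identity : ∀ m → suc (suc m) * suc (suc m) + 2 ≡ 3 * suc (suc m) + (m * m + m)
      identity = solve-∀
    split : ∀ i j → sum (λ c → 𝟙 (f i Fin.≟ c) * 𝟙 (f j Fin.≟ c)) ≡ 𝟙 (f i Fin.≟ f j)
    split i j with f i Fin.≟ f j
    ... | yes e = trans (sum-cong-≗ λ c → trans (cong (λ x → 𝟙 (f i Fin.≟ c) * 𝟙 (x Fin.≟ c)) (sym e)) (𝟙-idem (f i Fin.≟ c))) (sum-𝟙≡ (f i))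
      where
      𝟙-idem : ∀ {p} {P : Set p} (P? : Dec P) → 𝟙 P? * 𝟙 P? ≡ 𝟙 P?
      𝟙-idem (yes _) = refl
      𝟙-idem (no _)  = refl
    ... | no ≢ = sum-zero λ c → 𝟙-disjoint (f i Fin.≟ c) (f j Fin.≟ c) λ e e′ → ≢ (trans e (sym e′))
      where
      𝟙-disjoint : ∀ {p r} {P : Set p} {R : Set r} (P? : Dec P) (R? : Dec R) → (P → ¬ R) → 𝟙 P? * 𝟙 R? ≡ 0
      𝟙-disjoint (no _)  _       _ = refl
      𝟙-disjoint (yes _) (no _)  _ = refl
      𝟙-disjoint (yes p) (yes r) d = contradiction r (d p)
    pairs : sum (λ c → fibre c * fibre c) ≡ sum (λ i → sum (λ j → 𝟙 (f i Fin.≟ f j)))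
    pairs = trans (sum-cong-≗ λ c → trans (*-distribʳ-sum (fibre c) (λ i → 𝟙 (f i Fin.≟ c)))
                    (sum-cong-≗ λ i → *-distribˡ-sum (𝟙 (f i Fin.≟ c)) (λ j → 𝟙 (f j Fin.≟ c))))
      (trans (∑-comm (λ c i → sum (λ j → 𝟙 (f i Fin.≟ c) * 𝟙 (f j Fin.≟ c))))
        (sum-cong-≗ λ i → trans (∑-comm (λ c j → 𝟙 (f i Fin.≟ c) * 𝟙 (f j Fin.≟ c))) (sum-cong-≗ (split i))))

  -- Induction on the index set: the row and the column of the first index have equal sums, and its
  -- diagonal entry is zero.
  symmetric-sum-even : ∀ {n} (c : Fin n → Fin n → ℕ) → (∀ i j → c i j ≡ c j i) → (∀ i → c i i ≡ 0) →
                       ∃[ t ] sum (λ i → sum (c i)) ≡ 2 * t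
  symmetric-sum-even {zero}  c c-sym c-diag = 0 , refl
  symmetric-sum-even {suc n} c c-sym c-diag =
    let t , eq = symmetric-sum-even (λ i j → c (suc i) (suc j)) (λ _ _ → c-sym _ _) (c-diag ∘ suc)
        row = sum (λ j → c zero (suc j))
    in row + t , (begin
      c zero zero + row + sum (λ i → c (suc i) zero + sum (λ j → c (suc i) (suc j)))
        ≡⟨ cong₂ (λ x y → x + row + y) (c-diag zero) (∑-distrib-+ (λ i → c (suc i) zero) (λ i → sum (λ j → c (suc i) (suc j)))) ⟩
      row + (sum (λ i → c (suc i) zero) + sum (λ i → sum (λ j → c (suc i) (suc j))))
        ≡⟨ cong₂ (λ x y → row + (x + y)) (sum-cong-≗ λ i → c-sym (suc i) zero) eq ⟩
      row + (row + 2 * t) ≡⟨ identity row t ⟩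
      2 * (row + t) ∎)
    where
    open ≡-Reasoning
    identity : ∀ r t → r + (r + 2 * t) ≡ 2 * (r + t)
    identity = solve-∀

  -- Induction on the index set. Rotation sorts the triples containing `zero` into threes: those
  -- with two entries `zero` contribute 3a, those with one contribute 3b, and the constant triple
  -- contributes nothing.
  cyclic-sum-triple : ∀ {n} (c : Fin n → Fin n → Fin n → ℕ) → (∀ i j k → c i j k ≡ c j k i) → (∀ i → c i i i ≡ 0) →
                      ∃[ t ] sum (λ i → sum (λ j → sum (c i j))) ≡ 3 * t
  cyclic-sum-triple {zero}  c c-cyc c-diag = 0 , refl
  cyclic-sum-triple {suc n} c c-cyc c-diag =
    let t , eq = cyclic-sum-triple (λ i j k → c (suc i) (suc j) (suc k)) (λ _ _ _ → c-cyc _ _ _) (c-diag ∘ suc)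
    in a + b + t , (begin
      (c zero zero zero + sum (λ k → c zero zero (suc k)) + sum (λ j → c zero (suc j) zero + sum (λ k → c zero (suc j) (suc k))))
        + sum (λ i → (c (suc i) zero zero + sum (λ k → c (suc i) zero (suc k)))
            + sum (λ j → c (suc i) (suc j) zero + sum (λ k → c (suc i) (suc j) (suc k))))
        ≡⟨ cong₂ _+_
             (cong₂ _+_ (cong₂ _+_ (c-diag zero) (sum-cong-≗ λ k → trans (c-cyc zero zero (suc k)) (c-cyc zero (suc k) zero)))
               (trans (∑-distrib-+ (λ j → c zero (suc j) zero) _) (cong (_+ b) (sum-cong-≗ λ j → c-cyc zero (suc j) zero))))
             (trans (∑-distrib-+ (λ i → c (suc i) zero zero + sum (λ k → c (suc i) zero (suc k))) _) (cong₂ _+_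
               (trans (∑-distrib-+ (λ i → c (suc i) zero zero) _) (cong (a +_)
                 (trans (sum-cong-≗ λ i → sum-cong-≗ λ k → c-cyc (suc i) zero (suc k)) (∑-comm (λ i k → c zero (suc k) (suc i))))))
               (trans (sum-cong-≗ λ i → ∑-distrib-+ (λ j → c (suc i) (suc j) zero) _)
                 (trans (∑-distrib-+ (λ i → sum (λ j → c (suc i) (suc j) zero)) _)
                   (cong₂ _+_ (sum-cong-≗ λ i → sum-cong-≗ λ j → sym (c-cyc zero (suc i) (suc j))) eq))))) ⟩
      (0 + a + (a + b)) + ((a + b) + (b + 3 * t))     ≡⟨ identity a b t ⟩
      3 * (a + b + t) ∎)
    where
    open ≡-Reasoning
    a = sum (λ i → c (suc i) zero zero)
    b = sum (λ j → sum (λ k → c zero (suc j) (suc k)))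
    identity : ∀ a b t → (0 + a + (a + b)) + ((a + b) + (b + 3 * t)) ≡ 3 * (a + b + t)
    identity = solve-∀

-- Six dependent points for q ≥ 5, by sphere packing.

module SixDependent where

  open Counting
  open FiniteFields
  open Arithmetic using (6q⁷<triples; section-size)
  open import Data.Fin.Base as Fin using (Fin; zero; suc; punchIn; splitAt; remQuot; combine; funToFin; finToFun)
  open import Data.Fin.Properties as Fin using (any?)
  open import Data.Nat.Base as ℕ using (ℕ; zero; suc; _≤_; _<_; s≤s; z≤n)
  import Data.Nat.Properties as ℕ
  open import Data.Nat.Tactic.RingSolver using (solve-∀)
  open import Data.Product.Base using (Σ; ∃-syntax; _×_; _,_)
  open import Data.Sum.Base using (_⊎_; inj₁; inj₂; [_,_]′)
  open import Function.Base using (_∘_; id)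
  open import Relation.Binary.PropositionalEquality
  open import Relation.Nullary using (yes; no; contradiction; ¬?)

  module _ {N} (K : FiniteField N) where

    open FieldTheory K

    SixDependent : ∀ {n m} → (Fin n → Fin m → Carrier) → Set
    SixDependent {n} p = Σ (Fin 6 → Fin n) λ g → Inj g ×
      Σ (Fin 6 → Carrier) λ x → NonZeroVector x × (∀ j → combination x (p ∘ g) j ≡ 0#)

  module Weights {N} (K : FiniteField N) where

    open FieldTheory K

    weight : ∀ {n} → (Fin n → Carrier) → ℕ
    weight {zero}  d = 0
    weight {suc n} d with d zero ≟ 0#
    ... | yes _ = weight (d ∘ suc)
    ... | no  _ = suc (weight (d ∘ suc))

    weight-cons-≤ : ∀ {n} (d : Fin (suc n) → Carrier) → weight d ≤ suc (weight (d ∘ suc))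
    weight-cons-≤ d with d zero ≟ 0#
    ... | yes _ = ℕ.n≤1+n _
    ... | no  _ = ℕ.≤-refl

    weight-cons-0 : ∀ {n} (d : Fin (suc n) → Carrier) → d zero ≡ 0# → weight d ≡ weight (d ∘ suc)
    weight-cons-0 d d₀≡0 with d zero ≟ 0#
    ... | yes _ = refl
    ... | no ≢0 = contradiction d₀≡0 ≢0

    weight-minus : ∀ {n} (u v : Fin n → Carrier) → weight (λ i → u i - v i) ≤ weight u ℕ.+ weight v
    weight-minus {zero}  u v = z≤n
    weight-minus {suc n} u v with u zero ≟ 0# | v zero ≟ 0#
    ... | yes u₀≡0 | yes v₀≡0 = ℕ.≤-trans
          (ℕ.≤-reflexive (weight-cons-0 (λ i → u i - v i) (trans (cong₂ _-_ u₀≡0 v₀≡0) (-‿inverseʳ 0#))))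
          (weight-minus (u ∘ suc) (v ∘ suc))
    ... | no _  | yes _ = ℕ.≤-trans (weight-cons-≤ (λ i → u i - v i)) (s≤s (weight-minus (u ∘ suc) (v ∘ suc)))
    ... | yes _ | no _  = ℕ.≤-trans (weight-cons-≤ (λ i → u i - v i)) (ℕ.≤-trans (s≤s (weight-minus (u ∘ suc) (v ∘ suc)))
                            (ℕ.≤-reflexive (sym (ℕ.+-suc _ _))))
    ... | no _  | no _  = ℕ.≤-trans (weight-cons-≤ (λ i → u i - v i)) (s≤s (ℕ.≤-trans (weight-minus (u ∘ suc) (v ∘ suc))
                            (ℕ.+-monoʳ-≤ (weight (u ∘ suc)) (ℕ.n≤1+n _))))

    support : ∀ {n} (d : Fin n → Carrier) → Σ (Fin (weight d) → Fin n) λ h → Inj h × (∀ i → d (h i) ≢ 0#)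
    support {zero}  d = (λ ()) , (λ { {()} }) , λ ()
    support {suc n} d with d zero ≟ 0# | support (d ∘ suc)
    ... | yes _  | h , h-inj , d∘h≢0 = suc ∘ h , h-inj ∘ Fin.suc-injective , d∘h≢0
    ... | no ≢0  | h , h-inj , d∘h≢0 = h′ , (λ {x} {y} → h′-inj x y) , λ { zero → ≢0 ; (suc i) → d∘h≢0 i }
      where
      h′ : Fin (suc _) → Fin (suc n)
      h′ zero    = zero
      h′ (suc i) = suc (h i)
      h′-inj : ∀ x y → h′ x ≡ h′ y → x ≡ y
      h′-inj zero    zero    _ = refl
      h′-inj zero    (suc y) ()
      h′-inj (suc x) zero    ()
      h′-inj (suc x) (suc y) e = cong suc (h-inj (Fin.suc-injective e))

    weight+zeros : ∀ {n m} (d : Fin n → Carrier) (g : Fin m → Fin n) → Inj g → (∀ i → d (g i) ≡ 0#) →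
                   weight d ℕ.+ m ≤ n
    weight+zeros d g g-inj d∘g≡0 = let h , h-inj , d∘h≢0 = support d in
      Fin.injective⇒≤ (⊕-injective h-inj g-inj λ i j e → d∘h≢0 i (trans (cong d e) (d∘g≡0 j)))

    -- `SixDependent` asks for six distinct indices, but a light relation may have smaller support.
    -- The support is padded to `m` indices, and `same-sum` transfers the relation to them.
    record Cover {n} (m : ℕ) (d : Fin n → Carrier) : Set where
      field
        index     : Fin m → Fin n
        injective : Inj index
        hits      : ∀ i → d i ≢ 0# → ∃[ j ] index j ≡ i
        same-sum  : ∀ (F : Fin n → Carrier) → (∀ i → d i ≡ 0# → F i ≡ 0#) → sum F ≡ sum (F ∘ index)

    -- A zero entry is skipped as long as enough positions remain; once every remaining position is
    -- needed, all of them are taken.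
    cover : ∀ n m (d : Fin n → Carrier) → weight d ≤ m → m ≤ n → Cover m d
    cover zero zero d _ _ = record
      { index = λ () ; injective = λ { {()} } ; hits = λ () ; same-sum = λ _ _ → refl }
    cover (suc n) m d w≤m m≤n with d zero ≟ 0#
    ... | yes d₀≡0 with m ℕ.≤? n
    ...   | yes m≤n′ = record
            { index = suc ∘ C.index
            ; injective = C.injective ∘ Fin.suc-injective
            ; hits = λ { zero d₀≢0 → contradiction d₀≡0 d₀≢0
                       ; (suc i) dᵢ≢0 → let j , e = C.hits i dᵢ≢0 in j , cong suc e }
            ; same-sum = λ F F≡0 → trans (cong (_+ sum (F ∘ suc)) (F≡0 zero d₀≡0))
                (trans (+-identityˡ _) (C.same-sum (F ∘ suc) (F≡0 ∘ suc)))
            }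
            where module C = Cover (cover n m (d ∘ suc) w≤m m≤n′)
    ...   | no m≰n with refl ← ℕ.≤-antisym m≤n (ℕ.≰⇒> m≰n) = record
            { index = id ; injective = id ; hits = λ i _ → i , refl ; same-sum = λ _ _ → refl }
    cover (suc n) (suc m) d (s≤s w≤m) (s≤s m≤n) | no d₀≢0 = record
      { index = index′
      ; injective = λ {x} {y} → index′-inj x y
      ; hits = λ { zero _ → zero , refl
                 ; (suc i) dᵢ≢0 → let j , e = C.hits i dᵢ≢0 in suc j , cong suc e }
      ; same-sum = λ F F≡0 → cong (F zero +_) (C.same-sum (F ∘ suc) (F≡0 ∘ suc))
      }
      where
      module C = Cover (cover n m (d ∘ suc) w≤m m≤n)
      index′ : Fin (suc m) → Fin (suc n)
      index′ zero    = zero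
      index′ (suc i) = suc (C.index i)
      index′-inj : ∀ x y → index′ x ≡ index′ y → x ≡ y
      index′-inj zero    zero    _ = refl
      index′-inj (suc x) (suc y) e = cong suc (C.injective (Fin.suc-injective e))

    low-weight⇒dependent : ∀ {n m} (p : Fin n → Fin m → Carrier) → 6 ≤ n → (d : Fin n → Carrier) →
      NonZeroVector d → weight d ≤ 6 → (∀ j → combination d p j ≡ 0#) → SixDependent K p
    low-weight⇒dependent {n} p 6≤n d (i , dᵢ≢0) w≤6 dependent =
      C.index , C.injective , d ∘ C.index ,
      (let j , e = C.hits i dᵢ≢0 in j , λ d≡0 → dᵢ≢0 (trans (cong d (sym e)) d≡0)) ,
      λ j → trans (sym (C.same-sum (λ i → d i * p i j) λ i e → trans (cong (_* p i j) e) (zeroˡ (p i j)))) (dependent j)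
      where module C = Cover (cover n 6 d w≤6 6≤n)

  -- If no six of the points were dependent, the combinations of at most three
  -- of them would be distinct, and there are more than q⁷ of these when q ≥ 5.
  module SpherePacking {N} (K : FiniteField (suc N)) where

    open FieldTheory K
    open Weights K

    -- The size of a Hamming ball of radius `w` over an alphabet of `suc N` letters: the first
    -- letter is either zero or one of the `N` others, which uses up one unit of weight.
    words : ℕ → ℕ → ℕ
    words zero    w       = 1
    words (suc n) zero    = 1
    words (suc n) (suc w) = words n (suc w) ℕ.+ N ℕ.* words n w

    infixr 5 _◂_
    _◂_ : ∀ {n} → Carrier → (Fin n → Carrier) → Fin (suc n) → Carrier
    (x ◂ d) zero    = x
    (x ◂ d) (suc i) = d i

    word : ∀ n w → Fin (words n w) → Fin n → Carrier
    word (suc n) zero    _ = λ _ → 0#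
    word (suc n) (suc w) i = [ (λ a → 0# ◂ word n (suc w) a)
                             , (λ b → let c , r = remQuot (words n w) b in punchIn 0# c ◂ word n w r) ]′ (splitAt (words n (suc w)) i)

    weight-0 : ∀ n → weight {n} (λ _ → 0#) ≡ 0
    weight-0 zero    = refl
    weight-0 (suc n) = trans (weight-cons-0 {n} (λ _ → 0#) refl) (weight-0 n)

    word-weight : ∀ n w i → weight (word n w i) ≤ w
    word-weight zero    w    i = z≤n
    word-weight (suc n) zero i = ℕ.≤-reflexive (weight-0 (suc n))
    word-weight (suc n) (suc w) i with splitAt (words n (suc w)) i
    ... | inj₁ a = ℕ.≤-trans (ℕ.≤-reflexive (weight-cons-0 (0# ◂ word n (suc w) a) refl)) (word-weight n (suc w) a)
    ... | inj₂ b = ℕ.≤-trans (weight-cons-≤ (punchIn 0# _ ◂ word n w _)) (s≤s (word-weight n w _))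

    word-injective : ∀ n w i j → word n w i ≗ word n w j → i ≡ j
    word-injective zero    w       zero zero _ = refl
    word-injective (suc n) zero    zero zero _ = refl
    word-injective (suc n) (suc w) i j e = splitAt-injective (words n (suc w)) (lemma (splitAt (words n (suc w)) i) (splitAt (words n (suc w)) j) e)
      where
      term : Fin (words n (suc w)) ⊎ Fin (N ℕ.* words n w) → Fin (suc n) → Carrier
      term = [ (λ a → 0# ◂ word n (suc w) a) , (λ b → let c , r = remQuot (words n w) b in punchIn 0# c ◂ word n w r) ]′
      lemma : ∀ x y → term x ≗ term y → x ≡ y
      lemma (inj₁ a) (inj₁ b) e = cong inj₁ (word-injective n (suc w) a b (e ∘ suc))
      lemma (inj₁ a) (inj₂ b) e = contradiction (sym (e zero)) (Fin.punchInᵢ≢i 0# _)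
      lemma (inj₂ a) (inj₁ b) e = contradiction (e zero) (Fin.punchInᵢ≢i 0# _)
      lemma (inj₂ a) (inj₂ b) e = cong inj₂ (trans (sym (Fin.combine-remQuot {N} (words n w) a)) (trans
        (cong₂ combine (Fin.punchIn-injective 0# _ _ (e zero)) (word-injective n w _ _ (e ∘ suc))) (Fin.combine-remQuot {N} (words n w) b)))

    words-0 : ∀ n → words n 0 ≡ 1
    words-0 zero    = refl
    words-0 (suc n) = refl

    singles : ∀ k → k ℕ.* N ≤ words k 1
    singles zero    = z≤n
    singles (suc k) = ℕ.≤-trans (ℕ.+-mono-≤ (ℕ.≤-reflexive (sym (trans (cong (N ℕ.*_) (words-0 k)) (ℕ.*-identityʳ N)))) (singles k))
      (ℕ.≤-reflexive (ℕ.+-comm (N ℕ.* words k 0) (words k 1)))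

    -- N² times a binomial coefficient counts the words of weight two; the factor 2, like the 6 in
    -- `triples`, clears the denominator.
    pairs : ∀ k → (1 ℕ.+ k) ℕ.* k ℕ.* (N ℕ.* N) ≤ 2 ℕ.* words (1 ℕ.+ k) 2
    pairs zero    = z≤n
    pairs (suc k) = begin
      (2 ℕ.+ k) ℕ.* (1 ℕ.+ k) ℕ.* (N ℕ.* N)                                    ≡⟨ identity k N ⟩
      (1 ℕ.+ k) ℕ.* k ℕ.* (N ℕ.* N) ℕ.+ 2 ℕ.* (N ℕ.* ((1 ℕ.+ k) ℕ.* N))        ≤⟨ ℕ.+-mono-≤ (pairs k) (ℕ.*-monoʳ-≤ 2 (ℕ.*-monoʳ-≤ N (singles (1 ℕ.+ k)))) ⟩
      2 ℕ.* words (1 ℕ.+ k) 2 ℕ.+ 2 ℕ.* (N ℕ.* words (1 ℕ.+ k) 1)              ≡⟨ ℕ.*-distribˡ-+ 2 (words (1 ℕ.+ k) 2) _ ⟨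
      2 ℕ.* words (2 ℕ.+ k) 2                                                   ∎
      where
      open ℕ.≤-Reasoning
      identity : ∀ k N → (2 ℕ.+ k) ℕ.* (1 ℕ.+ k) ℕ.* (N ℕ.* N) ≡ (1 ℕ.+ k) ℕ.* k ℕ.* (N ℕ.* N) ℕ.+ 2 ℕ.* (N ℕ.* ((1 ℕ.+ k) ℕ.* N))
      identity = solve-∀

    triples : ∀ k → (2 ℕ.+ k) ℕ.* (1 ℕ.+ k) ℕ.* k ℕ.* (N ℕ.* N ℕ.* N) ≤ 6 ℕ.* words (2 ℕ.+ k) 3
    triples zero    = z≤n
    triples (suc k) = begin
      (3 ℕ.+ k) ℕ.* (2 ℕ.+ k) ℕ.* (1 ℕ.+ k) ℕ.* (N ℕ.* N ℕ.* N)                ≡⟨ identity k N ⟩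
      (2 ℕ.+ k) ℕ.* (1 ℕ.+ k) ℕ.* k ℕ.* (N ℕ.* N ℕ.* N) ℕ.+ 3 ℕ.* N ℕ.* ((2 ℕ.+ k) ℕ.* (1 ℕ.+ k) ℕ.* (N ℕ.* N))
        ≤⟨ ℕ.+-mono-≤ (triples k) (ℕ.*-monoʳ-≤ (3 ℕ.* N) (pairs (suc k))) ⟩
      6 ℕ.* words (2 ℕ.+ k) 3 ℕ.+ 3 ℕ.* N ℕ.* (2 ℕ.* words (2 ℕ.+ k) 2)        ≡⟨ distribute (words (2 ℕ.+ k) 3) N (words (2 ℕ.+ k) 2) ⟩
      6 ℕ.* words (3 ℕ.+ k) 3                                                   ∎
      where
      open ℕ.≤-Reasoning
      identity : ∀ k N → (3 ℕ.+ k) ℕ.* (2 ℕ.+ k) ℕ.* (1 ℕ.+ k) ℕ.* (N ℕ.* N ℕ.* N) ≡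
        (2 ℕ.+ k) ℕ.* (1 ℕ.+ k) ℕ.* k ℕ.* (N ℕ.* N ℕ.* N) ℕ.+ 3 ℕ.* N ℕ.* ((2 ℕ.+ k) ℕ.* (1 ℕ.+ k) ℕ.* (N ℕ.* N))
      identity = solve-∀
      distribute : ∀ x N y → 6 ℕ.* x ℕ.+ 3 ℕ.* N ℕ.* (2 ℕ.* y) ≡ 6 ℕ.* (x ℕ.+ N ℕ.* y)
      distribute = solve-∀

    -- The points serve as columns of a parity check matrix. Two words of weight at most three with
    -- equal syndrome differ by a nonzero relation of weight at most six; `funToFin` numbers the
    -- syndromes so that the pigeonhole principle applies.
    packed⇒dependent : ∀ {n} → 6 ≤ n → suc N ℕ.^ 7 < words n 3 → (p : Fin n → Fin 7 → Carrier) → SixDependent K p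
    packed⇒dependent {n} 6≤n q⁷<words p =
      let i , j , i<j , e = Fin.pigeonhole q⁷<words syndrome
          d = λ l → word n 3 i l - word n 3 j l
      in low-weight⇒dependent p 6≤n d (nonzero i j i<j)
           (ℕ.≤-trans (weight-minus (word n 3 i) (word n 3 j)) (ℕ.+-mono-≤ (word-weight n 3 i) (word-weight n 3 j)))
           (kernel i j e)
      where
      syndrome : Fin (words n 3) → Fin (suc N ℕ.^ 7)
      syndrome i = funToFin (combination (word n 3 i) p)
      nonzero : ∀ i j → i Fin.< j → NonZeroVector (λ l → word n 3 i l - word n 3 j l)
      nonzero i j i<j with any? (λ l → ¬? (word n 3 i l - word n 3 j l ≟ 0#))
      ... | yes found = found
      ... | no  none  = contradiction (word-injective n 3 i j same) (Fin.<⇒≢ i<j)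
        where
        same : word n 3 i ≗ word n 3 j
        same l with word n 3 i l - word n 3 j l ≟ 0#
        ... | yes e = x-y≡0⇒x≡y e
        ... | no ≢0 = contradiction (l , ≢0) none
      kernel : ∀ i j → syndrome i ≡ syndrome j → ∀ l → combination (λ h → word n 3 i h - word n 3 j h) p l ≡ 0#
      kernel i j e l = begin
        sum (λ h → (word n 3 i h - word n 3 j h) * p h l)
          ≡⟨ sum-cong-≗ (λ h → solve 3 (λ a b c → (a :- b) :* c := a :* c :+ :- :1 :* (b :* c)) refl (word n 3 i h) (word n 3 j h) (p h l)) ⟩
        sum (λ h → word n 3 i h * p h l + - 1# * (word n 3 j h * p h l))
          ≡⟨ sum-+* (- 1#) (λ h → word n 3 i h * p h l) (λ h → word n 3 j h * p h l) ⟩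
        combination (word n 3 i) p l + - 1# * combination (word n 3 j) p l
          ≡⟨ cong (λ z → combination (word n 3 i) p l + - 1# * z) same ⟨
        combination (word n 3 i) p l + - 1# * combination (word n 3 i) p l
          ≡⟨ solve 1 (λ x → x :+ :- :1 :* x := :0) refl (combination (word n 3 i) p l) ⟩
        0# ∎
        where
        open ≡-Reasoning
        same : combination (word n 3 i) p l ≡ combination (word n 3 j) p l
        same = trans (sym (Fin.finToFun-funToFin (combination (word n 3 i) p) l))
          (trans (cong (λ s → finToFun s l) e) (Fin.finToFun-funToFin (combination (word n 3 j) p) l))

    many⇒dependent : ∀ k → 4 ≤ k → 6 ℕ.* suc N ℕ.^ 7 < (2 ℕ.+ k) ℕ.* (1 ℕ.+ k) ℕ.* k ℕ.* (N ℕ.* N ℕ.* N) →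
                     (p : Fin (2 ℕ.+ k) → Fin 7 → Carrier) → SixDependent K p
    many⇒dependent k 4≤k 6q⁷< = packed⇒dependent (s≤s (s≤s 4≤k))
      (ℕ.*-cancelˡ-< 6 (suc N ℕ.^ 7) (words (2 ℕ.+ k) 3) (ℕ.<-≤-trans 6q⁷< (triples k)))

  six-dependent-q≥5 : ∀ {q n} (K : FiniteField q) → 5 ≤ q → n ℕ.+ q ≡ q ℕ.* q ℕ.+ 1 →
                      (p : Fin n → Fin 7 → Fin q) → SixDependent K p
  six-dependent-q≥5 {suc N} K (s≤s 4≤N) n+q≡ p with section-size 4≤N refl n+q≡
  ... | k , refl , 1+k≡qN , 4≤k = SpherePacking.many⇒dependent K k 4≤k (6q⁷<triples 4≤N refl 1+k≡qN) p

-- Six dependent points for q = 4, through arcs in PG(2,4).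

module TenArcs where

  open Counting
  open FiniteFields
  open DoubleCounting
  open SixDependent
  open import Data.Empty using (⊥; ⊥-elim)
  open import Data.Fin.Base as Fin using (Fin; zero; suc; punchIn; punchOut; inject≤)
  open import Data.Fin.Patterns using (0F; 1F; 2F; 3F)
  open import Data.Fin.Properties as Fin using (any?)
  open import Data.Nat.Base as ℕ using (ℕ; zero; suc; _≤_; _<_; s≤s; z≤n)
  import Data.Nat.Properties as ℕ
  open import Data.Product.Base using (Σ; ∃-syntax; _×_; _,_; proj₁; proj₂)
  open import Data.Sum.Base using (_⊎_; inj₁; inj₂; [_,_]′)
  open import Function.Base using (_∘_)
  open import Relation.Binary.PropositionalEquality
  open import Relation.Nullary using (Dec; ¬_; yes; no; contradiction; ¬?; _×-dec_)
  open import Algebra.Properties.Semiring.Sum ℕ.+-*-semiring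
    using () renaming (sum to ∑; sum-cong-≗ to ∑-cong; sum-remove to ∑-remove; ∑-distrib-+ to ∑-+)

  module Planes {q} (K : FiniteField q) where

    open FieldTheory K
    open ≡-Reasoning

    K³ : Set
    K³ = Fin 3 → Carrier

    cross : K³ → K³ → K³
    cross u v 0F = u 1F * v 2F - u 2F * v 1F
    cross u v 1F = u 2F * v 0F - u 0F * v 2F
    cross u v 2F = u 0F * v 1F - u 1F * v 0F

    det₃ : K³ → K³ → K³ → Carrier
    det₃ u v w = cross u v ∙ w

    private
      :cross∙ : ∀ {n} (u₀ u₁ u₂ v₀ v₁ v₂ w₀ w₁ w₂ : Polynomial n) → Polynomial n
      :cross∙ u₀ u₁ u₂ v₀ v₁ v₂ w₀ w₁ w₂ =
        (u₁ :* v₂ :- u₂ :* v₁) :* w₀ :+ ((u₂ :* v₀ :- u₀ :* v₂) :* w₁ :+ ((u₀ :* v₁ :- u₁ :* v₀) :* w₂ :+ :0))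

    det₃-cyclic : ∀ u v w → det₃ u v w ≡ det₃ v w u
    det₃-cyclic u v w = solve 9 (λ a b c d e f g h i → :cross∙ a b c d e f g h i := :cross∙ d e f g h i a b c) refl
      (u 0F) (u 1F) (u 2F) (v 0F) (v 1F) (v 2F) (w 0F) (w 1F) (w 2F)

    det₃-swap : ∀ u v w → det₃ u w v ≡ - det₃ u v w
    det₃-swap u v w = solve 9 (λ a b c d e f g h i → :cross∙ a b c g h i d e f := :- :cross∙ a b c d e f g h i) refl
      (u 0F) (u 1F) (u 2F) (v 0F) (v 1F) (v 2F) (w 0F) (w 1F) (w 2F)

    cross-∙ˡ : ∀ u v → cross u v ∙ u ≡ 0#
    cross-∙ˡ u v = solve 6 (λ a b c d e f → :cross∙ a b c d e f a b c := :0) refl (u 0F) (u 1F) (u 2F) (v 0F) (v 1F) (v 2F)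

    cross-∙ʳ : ∀ u v → cross u v ∙ v ≡ 0#
    cross-∙ʳ u v = solve 6 (λ a b c d e f → :cross∙ a b c d e f d e f := :0) refl (u 0F) (u 1F) (u 2F) (v 0F) (v 1F) (v 2F)

    -- By Cramer's rule, an entry of `a` times the determinant is a combination of the three
    -- vanishing products; a nonzero entry is then cancelled.
    kills⇒det₃≡0 : ∀ {a u v w} → NonZeroVector a → a ∙ u ≡ 0# → a ∙ v ≡ 0# → a ∙ w ≡ 0# → det₃ u v w ≡ 0#
    kills⇒det₃≡0 {a} {u} {v} {w} (m , aₘ≢0) au≡0 av≡0 aw≡0 = *≡0ʳ aₘ≢0 (begin
      a m * det₃ u v w                                                                          ≡⟨ cramer m ⟩
      (a ∙ u) * cross v w m + (a ∙ v) * cross w u m + (a ∙ w) * cross u v m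
        ≡⟨ cong₂ (λ x y → x * cross v w m + y * cross w u m + (a ∙ w) * cross u v m) au≡0 av≡0 ⟩
      0# * cross v w m + 0# * cross w u m + (a ∙ w) * cross u v m
        ≡⟨ cong (λ z → 0# * cross v w m + 0# * cross w u m + z * cross u v m) aw≡0 ⟩
      0# * cross v w m + 0# * cross w u m + 0# * cross u v m
        ≡⟨ solve 3 (λ x y z → :0 :* x :+ :0 :* y :+ :0 :* z := :0) refl (cross v w m) (cross w u m) (cross u v m) ⟩
      0#                                                                                        ∎)
      where
      cramer : ∀ m → a m * det₃ u v w ≡ (a ∙ u) * cross v w m + (a ∙ v) * cross w u m + (a ∙ w) * cross u v m
      cramer 0F = solve 12 (λ x y z a b c d e f g h i → x :* :cross∙ a b c d e f g h i :=
        (x :* a :+ (y :* b :+ (z :* c :+ :0))) :* (e :* i :- f :* h) :+ (x :* d :+ (y :* e :+ (z :* f :+ :0))) :* (h :* c :- i :* b)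
        :+ (x :* g :+ (y :* h :+ (z :* i :+ :0))) :* (b :* f :- c :* e)) refl
        (a 0F) (a 1F) (a 2F) (u 0F) (u 1F) (u 2F) (v 0F) (v 1F) (v 2F) (w 0F) (w 1F) (w 2F)
      cramer 1F = solve 12 (λ x y z a b c d e f g h i → y :* :cross∙ a b c d e f g h i :=
        (x :* a :+ (y :* b :+ (z :* c :+ :0))) :* (f :* g :- d :* i) :+ (x :* d :+ (y :* e :+ (z :* f :+ :0))) :* (i :* a :- g :* c)
        :+ (x :* g :+ (y :* h :+ (z :* i :+ :0))) :* (c :* d :- a :* f)) refl
        (a 0F) (a 1F) (a 2F) (u 0F) (u 1F) (u 2F) (v 0F) (v 1F) (v 2F) (w 0F) (w 1F) (w 2F)
      cramer 2F = solve 12 (λ x y z a b c d e f g h i → z :* :cross∙ a b c d e f g h i :=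
        (x :* a :+ (y :* b :+ (z :* c :+ :0))) :* (d :* h :- e :* g) :+ (x :* d :+ (y :* e :+ (z :* f :+ :0))) :* (g :* b :- h :* a)
        :+ (x :* g :+ (y :* h :+ (z :* i :+ :0))) :* (a :* e :- b :* d)) refl
        (a 0F) (a 1F) (a 2F) (u 0F) (u 1F) (u 2F) (v 0F) (v 1F) (v 2F) (w 0F) (w 1F) (w 2F)

    -- The identity a × (u × v) = (a · v) u - (a · u) v, read at a coordinate where `u` is nonzero.
    parallel-killed : ∀ {u v} → (∀ m → cross u v m ≡ 0#) → NonZeroVector u → ∀ {a} → a ∙ u ≡ 0# → a ∙ v ≡ 0#
    parallel-killed {u} {v} cross≡0 (m , uₘ≢0) {a} au≡0 = *≡0ʳ uₘ≢0 (trans (split m) (begin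
      v m * (a ∙ u) + cross a (cross u v) m
        ≡⟨ cong₂ _+_ (trans (cong (v m *_) au≡0) (zeroʳ (v m))) (cross-zero m) ⟩
      0# + 0#   ≡⟨ +-identityˡ 0# ⟩
      0#        ∎))
      where
      split : ∀ m → u m * (a ∙ v) ≡ v m * (a ∙ u) + cross a (cross u v) m
      split 0F = solve 9 (λ x y z a b c d e f → a :* (x :* d :+ (y :* e :+ (z :* f :+ :0))) := d :* (x :* a :+ (y :* b :+ (z :* c :+ :0)))
        :+ (y :* (a :* e :- b :* d) :- z :* (c :* d :- a :* f))) refl (a 0F) (a 1F) (a 2F) (u 0F) (u 1F) (u 2F) (v 0F) (v 1F) (v 2F)
      split 1F = solve 9 (λ x y z a b c d e f → b :* (x :* d :+ (y :* e :+ (z :* f :+ :0))) := e :* (x :* a :+ (y :* b :+ (z :* c :+ :0)))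
        :+ (z :* (b :* f :- c :* e) :- x :* (a :* e :- b :* d))) refl (a 0F) (a 1F) (a 2F) (u 0F) (u 1F) (u 2F) (v 0F) (v 1F) (v 2F)
      split 2F = solve 9 (λ x y z a b c d e f → c :* (x :* d :+ (y :* e :+ (z :* f :+ :0))) := f :* (x :* a :+ (y :* b :+ (z :* c :+ :0)))
        :+ (x :* (c :* d :- a :* f) :- y :* (b :* f :- c :* e))) refl (a 0F) (a 1F) (a 2F) (u 0F) (u 1F) (u 2F) (v 0F) (v 1F) (v 2F)
      zero-minus : ∀ x y {s t} → s ≡ 0# → t ≡ 0# → x * s - y * t ≡ 0#
      zero-minus x y refl refl = solve 2 (λ x y → x :* :0 :- y :* :0 := :0) refl x y
      cross-zero : ∀ m → cross a (cross u v) m ≡ 0#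
      cross-zero 0F = zero-minus (a 1F) (a 2F) (cross≡0 2F) (cross≡0 1F)
      cross-zero 1F = zero-minus (a 2F) (a 0F) (cross≡0 0F) (cross≡0 2F)
      cross-zero 2F = zero-minus (a 0F) (a 1F) (cross≡0 1F) (cross≡0 0F)

    record Pencil (x : K³) : Set where
      field
        line    : Fin (suc q) → K³
        line≢0  : ∀ s → NonZeroVector (line s)
        through : ∀ s → line s ∙ x ≡ 0#
        join    : ∀ y → ∃[ s ] line s ∙ y ≡ 0#

    -- Two functionals `u` and `w` kill `x`, with `w` zero at a coordinate `m` where `u` is not.
    -- Hence `w` and all `u + s w` are nonzero, and for given `y` the equation u · y + s (w · y) = 0
    -- is solved by some s unless `w` itself kills `y`.
    pencil : ∀ x → Pencil x
    pencil x = record { line = line ; line≢0 = line≢0 ; through = through ; join = join }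
      where
      first = fewer-annihilated {1} {3} (s≤s (s≤s z≤n)) (λ _ → x)
      u = proj₁ first
      m = proj₁ (proj₁ (proj₂ first))
      uₘ≢0 = proj₂ (proj₁ (proj₂ first))
      ux≡0 : u ∙ x ≡ 0#
      ux≡0 = proj₂ (proj₂ first) 0F
      eₘ : K³
      eₘ i with i Fin.≟ m
      ... | yes _ = 1#
      ... | no  _ = 0#
      second = fewer-annihilated {2} {3} (s≤s (s≤s (s≤s z≤n))) (λ { 0F → x ; 1F → eₘ })
      w = proj₁ second
      wx≡0 : w ∙ x ≡ 0#
      wx≡0 = proj₂ (proj₂ second) 0F
      wₘ≡0 : w m ≡ 0#
      wₘ≡0 = trans (sym (trans (sum-single {f = λ i → w i * eₘ i} m off) on)) (proj₂ (proj₂ second) 1F)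
        where
        off : ∀ j → j ≢ m → w j * eₘ j ≡ 0#
        off j j≢m with j Fin.≟ m
        ... | yes j≡m = contradiction j≡m j≢m
        ... | no _    = zeroʳ (w j)
        on : w m * eₘ m ≡ w m
        on with m Fin.≟ m
        ... | yes _ = *-identityʳ (w m)
        ... | no ≢  = contradiction refl ≢
      line : Fin (suc q) → K³
      line zero    = w
      line (suc s) i = u i + s * w i
      line≢0 : ∀ s → NonZeroVector (line s)
      line≢0 zero    = proj₁ (proj₂ second)
      line≢0 (suc s) = m , λ e → uₘ≢0 (trans (sym (trans (cong (λ z → u m + s * z) wₘ≡0)
        (solve 2 (λ u s → u :+ s :* :0 := u) refl (u m) s))) e)
      line-∙ : ∀ s y → line (suc s) ∙ y ≡ u ∙ y + s * (w ∙ y)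
      line-∙ s y = trans (sum-cong-≗ λ i → solve 4 (λ u s w y → (u :+ s :* w) :* y := u :* y :+ s :* (w :* y)) refl (u i) s (w i) (y i))
        (sum-+* s (λ i → u i * y i) (λ i → w i * y i))
      through : ∀ s → line s ∙ x ≡ 0#
      through zero    = wx≡0
      through (suc s) = trans (line-∙ s x) (trans (cong₂ (λ a b → a + s * b) ux≡0 wx≡0) (solve 1 (λ s → :0 :+ s :* :0 := :0) refl s))
      join : ∀ y → ∃[ s ] line s ∙ y ≡ 0#
      join y with w ∙ y ≟ 0#
      ... | yes wy≡0 = zero , wy≡0
      ... | no  wy≢0 = let i , wyi≡1 = inverse (w ∙ y) wy≢0 in suc (- ((u ∙ y) * i)) , (begin
        line (suc (- ((u ∙ y) * i))) ∙ y          ≡⟨ line-∙ (- ((u ∙ y) * i)) y ⟩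
        u ∙ y + - ((u ∙ y) * i) * (w ∙ y)         ≡⟨ solve 3 (λ u i w → u :+ :- (u :* i) :* w := u :* (:1 :- w :* i)) refl (u ∙ y) i (w ∙ y) ⟩
        (u ∙ y) * (1# - (w ∙ y) * i)                ≡⟨ cong (λ z → (u ∙ y) * (1# - z)) wyi≡1 ⟩
        (u ∙ y) * (1# - 1#)                       ≡⟨ solve 1 (λ u → u :* (:1 :- :1) := :0) refl (u ∙ y) ⟩
        0#                                      ∎)

  -- Ten points of PG(2,4), at most three on a line: each point would lie on
  -- exactly four lines with three of the points, but 40/3 is not an integer.
  -- The equations q ≡ 4 and m ≡ 8 stand in for literals, for which the sums would unfold.
  module Arc {q m} (q≡4 : q ≡ 4) (m≡8 : m ≡ 8) (K : FiniteField q) (c : Fin (2 ℕ.+ m) → Fin 3 → Fin q) where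

    open FieldTheory K
    open Planes K

    module _ (at-most-three : ∀ {a} → NonZeroVector a → ∀ {i j k l} → i ≢ j → i ≢ k → i ≢ l → j ≢ k → j ≢ l → k ≢ l →
                              a ∙ c i ≡ 0# → a ∙ c j ≡ 0# → a ∙ c k ≡ 0# → a ∙ c l ≡ 0# → ⊥) where

      -- Rules out coinciding or zero columns. If every line through `x` contained the columns `i`
      -- and `j`, then two of the eight other columns would share one of the five lines through `x`,
      -- and that line would carry four columns.
      no-double-point : ∀ {i j} → i ≢ j → ∀ x → (∀ a → a ∙ x ≡ 0# → a ∙ c i ≡ 0# × a ∙ c j ≡ 0#) → ⊥
      no-double-point {i} {j} i≢j x killed =
        let h , h′ , h<h′ , e = Fin.pigeonhole (subst₂ (λ a b → suc a < b) (sym q≡4) (sym m≡8) (ℕ.m≤m+n 6 2)) (λ h → proj₁ (P.join (c (other h))))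
            s = proj₁ (P.join (c (other h)))
            ki , kj = killed (P.line s) (P.through s)
        in at-most-three (P.line≢0 s) i≢j (other≢i h ∘ sym) (other≢i h′ ∘ sym) (other≢j h ∘ sym) (other≢j h′ ∘ sym)
             (λ oh≡oh′ → Fin.<⇒≢ h<h′ (Fin.punchIn-injective _ _ _ (Fin.punchIn-injective i _ _ oh≡oh′)))
             ki kj (proj₂ (P.join (c (other h))))
             (subst (λ s → P.line s ∙ c (other h′) ≡ 0#) (sym e) (proj₂ (P.join (c (other h′)))))
        where
        module P = Pencil (pencil x)
        other : Fin m → Fin (2 ℕ.+ m)
        other h = punchIn i (punchIn (punchOut i≢j) h)
        other≢i : ∀ h → other h ≢ i
        other≢i h = Fin.punchInᵢ≢i i _
        other≢j : ∀ h → other h ≢ j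
        other≢j h e = Fin.punchInᵢ≢i (punchOut i≢j) h (Fin.punchIn-injective i _ _ (trans e (sym (Fin.punchIn-punchOut i≢j))))

      cross≢0 : ∀ {i j} → i ≢ j → NonZeroVector (cross (c i) (c j))
      cross≢0 {i} {j} i≢j = [ (λ found → found) , (λ parallel → ⊥-elim (degenerate parallel (nonzero? (c i)))) ]′
                              (nonzero? (cross (c i) (c j)))
        where
        degenerate : (∀ t → cross (c i) (c j) t ≡ 0#) → NonZeroVector (c i) ⊎ (∀ t → c i t ≡ 0#) → ⊥
        degenerate parallel (inj₁ cᵢ≢0) = no-double-point i≢j (c i) λ a ka → ka , parallel-killed parallel cᵢ≢0 {a} ka
        degenerate parallel (inj₂ cᵢ≡0) = no-double-point i≢j (c j) λ a ka →
          FieldTheory.sum-zero K (λ t → trans (cong (a t *_) (cᵢ≡0 t)) (zeroʳ (a t))) , ka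

      Collinear : (i j k : Fin (2 ℕ.+ m)) → Set
      Collinear i j k = i ≢ j × j ≢ k × k ≢ i × det₃ (c i) (c j) (c k) ≡ 0#

      collinear? : ∀ i j k → Dec (Collinear i j k)
      collinear? i j k = ¬? (i Fin.≟ j) ×-dec ¬? (j Fin.≟ k) ×-dec ¬? (k Fin.≟ i) ×-dec (det₃ (c i) (c j) (c k) ≟ 0#)

      col : (i j k : Fin (2 ℕ.+ m)) → ℕ
      col i j k = 𝟙 (collinear? i j k)

      col-cyclic : ∀ i j k → col i j k ≡ col j k i
      col-cyclic i j k = 𝟙-cong (collinear? i j k) (collinear? j k i)
        (λ (i≢j , j≢k , k≢i , e) → j≢k , k≢i , i≢j , trans (sym (det₃-cyclic (c i) (c j) (c k))) e)
        (λ (j≢k , k≢i , i≢j , e) → i≢j , j≢k , k≢i , trans (det₃-cyclic (c i) (c j) (c k)) e)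

      col-sym : ∀ i j k → col i j k ≡ col i k j
      col-sym i j k = 𝟙-cong (collinear? i j k) (collinear? i k j) (flip i j k) (flip i k j)
        where
        flip : ∀ i j k → Collinear i j k → Collinear i k j
        flip i j k (i≢j , j≢k , k≢i , e) = k≢i ∘ sym , j≢k ∘ sym , i≢j ∘ sym ,
          trans (det₃-swap (c i) (c j) (c k)) (trans (cong -_ e) (solve 0 (:- :0 := :0) refl))

      -- At most one `k` belongs to each of nine `j`, and the pairs come with their reversals, so
      -- the even count is at most 8. Conversely the nine other columns lie on five lines through
      -- column `i`, and `fibre-pairs` gives 27 ≤ pairs + 9 + 10, where 9 stands for the diagonal.
      pairs-through : ∀ i → ∑ (λ j → ∑ (col i j)) ≡ 8
      pairs-through i =
        let t , s≡2t = symmetric-sum-even (col i) (col-sym i) (λ j → 𝟙-no (collinear? i j j) λ (_ , j≢j , _) → j≢j refl)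
        in even-8-9 t (∑ (λ j → ∑ (col i j))) s≡2t lower (subst (λ k → ∑ (λ j → ∑ (col i j)) ≤ suc k) m≡8 upper)
        where
        open ℕ.≤-Reasoning
        even-8-9 : ∀ t s → s ≡ 2 ℕ.* t → 8 ≤ s → s ≤ 9 → s ≡ 8
        even-8-9 t s refl 8≤2t 2t≤9 = cong (2 ℕ.*_) (ℕ.≤-antisym (ℕ.≮⇒≥ λ 4<t → ℕ.<⇒≱ {9} {10} ℕ.≤-refl (ℕ.≤-trans (ℕ.*-monoʳ-≤ 2 4<t) 2t≤9))
          (ℕ.*-cancelˡ-≤ {4} {t} 2 8≤2t))
        p = punchIn i
        i≢p : ∀ j → i ≢ p j
        i≢p j = Fin.punchInᵢ≢i i j ∘ sym
        upper : ∑ (λ j → ∑ (col i j)) ≤ suc m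
        upper = begin
          ∑ (λ j → ∑ (col i j))                          ≡⟨ ∑-remove {i = i} (λ j → ∑ (col i j)) ⟩
          ∑ (col i i) ℕ.+ ∑ (λ j → ∑ (col i (p j)))      ≡⟨ cong (ℕ._+ ∑ (λ j → ∑ (col i (p j)))) (DoubleCounting.sum-zero λ k → 𝟙-no (collinear? i i k) λ (i≢i , _) → i≢i refl) ⟩
          ∑ (λ j → ∑ (col i (p j)))                      ≤⟨ sum-mono (λ j → sum-at-most-one (collinear? i (p j)) (unique (i≢p j))) ⟩
          ∑ {suc m} (λ _ → 1)                            ≡⟨ trans (sum-const (suc m) 1) (ℕ.*-identityʳ (suc m)) ⟩
          suc m                                          ∎
          where
          unique : ∀ {j k l} → i ≢ j → Collinear i j k → Collinear i j l → k ≡ l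
          unique {j} {k} {l} i≢j (_ , j≢k , k≢i , ek) (_ , j≢l , l≢i , el) with k Fin.≟ l
          ... | yes k≡l = k≡l
          ... | no  k≢l = ⊥-elim (at-most-three (cross≢0 i≢j) i≢j (k≢i ∘ sym) (l≢i ∘ sym) j≢k j≢l k≢l
                  (cross-∙ˡ (c i) (c j)) (cross-∙ʳ (c i) (c j)) ek el)
        module P = Pencil (pencil (c i))
        f : Fin (suc m) → Fin (suc q)
        f j = proj₁ (P.join (c (p j)))
        bound : ∀ j k → 𝟙 (f j Fin.≟ f k) ≤ col i (p j) (p k) ℕ.+ 𝟙 (j Fin.≟ k)
        bound j k with j Fin.≟ k
        ... | yes _  = ℕ.≤-trans (𝟙≤1 (f j Fin.≟ f k)) (ℕ.m≤n+m 1 (col i (p j) (p k)))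
        ... | no j≢k = ℕ.≤-trans (𝟙-mono (f j Fin.≟ f k) (collinear? i (p j) (p k)) λ e →
                i≢p j , (λ pj≡pk → j≢k (Fin.punchIn-injective i j k pj≡pk)) , i≢p k ∘ sym ,
                kills⇒det₃≡0 {P.line (f j)} {c i} {c (p j)} {c (p k)} (P.line≢0 (f j)) (P.through (f j)) (proj₂ (P.join (c (p j))))
                  (subst (λ s → P.line s ∙ c (p k) ≡ 0#) (sym e) (proj₂ (P.join (c (p k))))))
                (ℕ.m≤m+n (col i (p j) (p k)) 0)
        pairs : ℕ
        pairs = ∑ (λ j → ∑ (λ k → col i (p j) (p k)))
        counted : 3 ℕ.* suc m ≤ pairs ℕ.+ suc m ℕ.+ 2 ℕ.* suc q
        counted = begin
          3 ℕ.* suc m                                                                   ≤⟨ fibre-pairs f ⟩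
          ∑ (λ j → ∑ (λ k → 𝟙 (f j Fin.≟ f k))) ℕ.+ 2 ℕ.* suc q
            ≤⟨ ℕ.+-monoˡ-≤ (2 ℕ.* suc q) (sum-mono λ j → sum-mono (bound j)) ⟩
          ∑ (λ j → ∑ (λ k → col i (p j) (p k) ℕ.+ 𝟙 (j Fin.≟ k))) ℕ.+ 2 ℕ.* suc q
            ≡⟨ cong (ℕ._+ 2 ℕ.* suc q) (trans (∑-cong λ j → trans (∑-+ (λ k → col i (p j) (p k)) (λ k → 𝟙 (j Fin.≟ k)))
                 (cong (∑ (λ k → col i (p j) (p k)) ℕ.+_) (sum-𝟙≡ j)))
                 (trans (∑-+ {suc m} (λ j → ∑ (λ k → col i (p j) (p k))) (λ _ → 1))
                   (cong (pairs ℕ.+_) (trans (sum-const (suc m) 1) (ℕ.*-identityʳ (suc m)))))) ⟩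
          pairs ℕ.+ suc m ℕ.+ 2 ℕ.* suc q                                               ∎
        pairs≤ : pairs ≤ ∑ (λ j → ∑ (col i j))
        pairs≤ = begin
          pairs
            ≤⟨ sum-mono (λ j → ℕ.≤-trans (ℕ.m≤n+m _ (col i (p j) i)) (ℕ.≤-reflexive (sym (∑-remove {i = i} (col i (p j)))))) ⟩
          ∑ (λ j → ∑ (col i (p j)))
            ≤⟨ ℕ.≤-trans (ℕ.m≤n+m _ (∑ (col i i))) (ℕ.≤-reflexive (sym (∑-remove {i = i} (λ j → ∑ (col i j))))) ⟩
          ∑ (λ j → ∑ (col i j))                                                         ∎
        lower : 8 ≤ ∑ (λ j → ∑ (col i j))
        lower = ℕ.≤-trans (ℕ.+-cancelʳ-≤ 19 8 pairs (subst (27 ≤_) (ℕ.+-assoc pairs 9 10)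
          (subst₂ (λ m q → 3 ℕ.* suc m ≤ pairs ℕ.+ suc m ℕ.+ 2 ℕ.* suc q) m≡8 q≡4 counted))) pairs≤

      absurd : ⊥
      absurd =
        -- The ten columns together give 10 · 8 = 80 ordered triples, which rotation would group by
        -- threes.
        let t , total≡3t = cyclic-sum-triple col col-cyclic (λ i → 𝟙-no (collinear? i i i) λ (i≢i , _) → i≢i refl)
        in 3∤80 t (trans (sym total≡3t) (trans (∑-cong pairs-through)
             (trans (sum-const (2 ℕ.+ m) 8) (cong (λ m → (2 ℕ.+ m) ℕ.* 8) {m} {8} m≡8))))
        where
        3∤80 : ∀ t → 3 ℕ.* t ≢ 80
        3∤80 t 3t≡80 with t ℕ.≤? 26
        ... | yes t≤26 = ℕ.<⇒≱ {79} {80} ℕ.≤-refl (ℕ.≤-trans (subst (_≤ 78) 3t≡80 (ℕ.*-monoʳ-≤ 3 t≤26)) (ℕ.n≤1+n 78))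
        ... | no  t≰26 = ℕ.<⇒≱ {80} {81} ℕ.≤-refl (subst (81 ≤_) 3t≡80 (ℕ.*-monoʳ-≤ 3 (ℕ.≰⇒> t≰26)))

  module Relations {q n k} (K : FiniteField q) (p : Fin n → Fin k → Fin q) where

    open FieldTheory K
    open ≡-Reasoning

    -- The vanishing at earlier pivots makes the three relations independent.
    three-relations : ∀ α₁ α₂ α₃ {j₁ j₂ j₃} → α₁ j₁ ≢ 0# → α₂ j₂ ≢ 0# → α₃ j₃ ≢ 0# →
      α₂ j₁ ≡ 0# → α₃ j₁ ≡ 0# → α₃ j₂ ≡ 0# →
      (∀ j → combination α₁ p j ≡ 0#) → (∀ j → combination α₂ p j ≡ 0#) → (∀ j → combination α₃ p j ≡ 0#) →
      Σ (Fin n → Fin 3 → Carrier) λ c → (∀ a j → combination (λ i → a ∙ c i) p j ≡ 0#) ×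
        (∀ a → NonZeroVector a → NonZeroVector (λ i → a ∙ c i))
    three-relations α₁ α₂ α₃ {j₁} {j₂} {j₃} α₁j₁≢0 α₂j₂≢0 α₃j₃≢0 α₂j₁≡0 α₃j₁≡0 α₃j₂≡0 kernel₁ kernel₂ kernel₃ =
      columns , relation-kernel , relation≢0
      where
      columns : Fin n → Fin 3 → Carrier
      columns i 0F = α₁ i
      columns i 1F = α₂ i
      columns i 2F = α₃ i

      relation : (Fin 3 → Carrier) → Fin n → Carrier
      relation a i = a ∙ columns i

      relation-kernel : ∀ a j → combination (relation a) p j ≡ 0#
      relation-kernel a j = begin
        sum (λ i → (a 0F * α₁ i + (a 1F * α₂ i + (a 2F * α₃ i + 0#))) * p i j)
          ≡⟨ sum-cong-≗ (λ i → solve 7 (λ a b c x y z p → (a :* x :+ (b :* y :+ (c :* z :+ :0))) :* p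
               := (a :* (x :* p) :+ b :* (y :* p)) :+ c :* (z :* p)) refl (a 0F) (a 1F) (a 2F) (α₁ i) (α₂ i) (α₃ i) (p i j)) ⟩
        sum (λ i → (a 0F * (α₁ i * p i j) + a 1F * (α₂ i * p i j)) + a 2F * (α₃ i * p i j))
          ≡⟨ trans (sum-+* (a 2F) (λ i → a 0F * (α₁ i * p i j) + a 1F * (α₂ i * p i j)) (λ i → α₃ i * p i j))
               (cong (_+ a 2F * combination α₃ p j) (trans (sum-+* (a 1F) (λ i → a 0F * (α₁ i * p i j)) (λ i → α₂ i * p i j))
                 (cong (_+ a 1F * combination α₂ p j) (sym (*-distribˡ-sum (a 0F) (λ i → α₁ i * p i j)))))) ⟩
        a 0F * combination α₁ p j + a 1F * combination α₂ p j + a 2F * combination α₃ p j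
          ≡⟨ cong₂ _+_ (cong₂ (λ x y → a 0F * x + a 1F * y) (kernel₁ j) (kernel₂ j))
               (cong (a 2F *_) (kernel₃ j)) ⟩
        a 0F * 0# + a 1F * 0# + a 2F * 0#   ≡⟨ solve 3 (λ a b c → a :* :0 :+ b :* :0 :+ c :* :0 := :0) refl (a 0F) (a 1F) (a 2F) ⟩
        0#                                  ∎

      relation≢0 : ∀ a → NonZeroVector a → NonZeroVector (relation a)
      relation≢0 a (t , aₜ≢0) = [ (λ found → found) , (λ at → ⊥-elim (aₜ≢0 (zeros at t))) ]′ (nonzero? (relation a))
        where
        module _ (at : ∀ i → relation a i ≡ 0#) where
          a₀≡0 : a 0F ≡ 0#
          a₀≡0 = *≡0ʳ α₁j₁≢0 (begin
            α₁ j₁ * a 0F  ≡⟨ solve 4 (λ x a b c → x :* a := a :* x :+ (b :* :0 :+ (c :* :0 :+ :0))) refl (α₁ j₁) (a 0F) (a 1F) (a 2F) ⟩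
            a 0F * α₁ j₁ + (a 1F * 0# + (a 2F * 0# + 0#))
              ≡⟨ cong₂ (λ x y → a 0F * α₁ j₁ + (a 1F * x + (a 2F * y + 0#))) α₂j₁≡0 α₃j₁≡0 ⟨
            relation a j₁ ≡⟨ at j₁ ⟩
            0#            ∎)
          a₁≡0 : a 1F ≡ 0#
          a₁≡0 = *≡0ʳ α₂j₂≢0 (begin
            α₂ j₂ * a 1F  ≡⟨ solve 4 (λ x y b c → x :* b := :0 :* y :+ (b :* x :+ (c :* :0 :+ :0))) refl (α₂ j₂) (α₁ j₂) (a 1F) (a 2F) ⟩
            0# * α₁ j₂ + (a 1F * α₂ j₂ + (a 2F * 0# + 0#))
              ≡⟨ cong₂ (λ x y → x * α₁ j₂ + (a 1F * α₂ j₂ + (a 2F * y + 0#))) a₀≡0 α₃j₂≡0 ⟨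
            relation a j₂ ≡⟨ at j₂ ⟩
            0#            ∎)
          a₂≡0 : a 2F ≡ 0#
          a₂≡0 = *≡0ʳ α₃j₃≢0 (begin
            α₃ j₃ * a 2F  ≡⟨ solve 4 (λ x y z c → x :* c := :0 :* y :+ (:0 :* z :+ (c :* x :+ :0))) refl (α₃ j₃) (α₁ j₃) (α₂ j₃) (a 2F) ⟩
            0# * α₁ j₃ + (0# * α₂ j₃ + (a 2F * α₃ j₃ + 0#))
              ≡⟨ cong₂ (λ x y → x * α₁ j₃ + (y * α₂ j₃ + (a 2F * α₃ j₃ + 0#))) a₀≡0 a₁≡0 ⟨
            relation a j₃ ≡⟨ at j₃ ⟩
            0#            ∎)
          zeros : ∀ t → a t ≡ 0#
          zeros 0F = a₀≡0
          zeros 1F = a₁≡0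
          zeros 2F = a₂≡0

  module LightRelation {q m} (q≡4 : q ≡ 4) (m≡8 : m ≡ 8) (K : FiniteField q) (p : Fin (2 ℕ.+ m) → Fin 7 → Fin q)
    (c : Fin (2 ℕ.+ m) → Fin 3 → Fin q)
    (kernel : ∀ a j → FieldTheory.combination K (λ i → FieldTheory._∙_ K a (c i)) p j ≡ FieldTheory.0# K)
    (nonzero : ∀ a → FieldTheory.NonZeroVector K a → FieldTheory.NonZeroVector K (λ i → FieldTheory._∙_ K a (c i))) where

    open FieldTheory K
    open Weights K

    private
      relation : (Fin 3 → Carrier) → Fin (2 ℕ.+ m) → Carrier
      relation a i = a ∙ c i

      vec₃ : Carrier → Carrier → Carrier → Fin 3 → Carrier
      vec₃ x y z 0F = x
      vec₃ x y z 1F = y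
      vec₃ x y z 2F = z

      Light : Carrier → Carrier → Carrier → Set
      Light x y z = NonZeroVector (vec₃ x y z) × weight (relation (vec₃ x y z)) ≤ 6

      light? : Dec (∃[ x ] ∃[ y ] ∃[ z ] Light x y z)
      light? = any? λ x → any? λ y → any? λ z →
        any? (λ t → ¬? (vec₃ x y z t ≟ 0#)) ×-dec (weight (relation (vec₃ x y z)) ℕ.≤? 6)

      four-zeros : ∀ d (g : Fin 4 → Fin (2 ℕ.+ m)) → Inj g → (∀ t → d (g t) ≡ 0#) → weight d ≤ 6
      four-zeros d g g-inj zeros = ℕ.+-cancelʳ-≤ 4 (weight d) 6
        (subst (λ m → weight d ℕ.+ 4 ≤ 2 ℕ.+ m) m≡8 (weight+zeros d g (λ {x} {y} → g-inj {x} {y}) zeros))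

      quad : (i j k l : Fin (2 ℕ.+ m)) → Fin 4 → Fin (2 ℕ.+ m)
      quad i j k l 0F = i
      quad i j k l 1F = j
      quad i j k l 2F = k
      quad i j k l 3F = l

      quad-inj : ∀ {i j k l} → i ≢ j → i ≢ k → i ≢ l → j ≢ k → j ≢ l → k ≢ l → ∀ x y → quad i j k l x ≡ quad i j k l y → x ≡ y
      quad-inj _ _ _ _ _ _ 0F 0F _ = refl
      quad-inj _ _ _ _ _ _ 1F 1F _ = refl
      quad-inj _ _ _ _ _ _ 2F 2F _ = refl
      quad-inj _ _ _ _ _ _ 3F 3F _ = refl
      quad-inj i≢j _ _ _ _ _ 0F 1F e = contradiction e i≢j
      quad-inj i≢j _ _ _ _ _ 1F 0F e = contradiction (sym e) i≢j
      quad-inj _ i≢k _ _ _ _ 0F 2F e = contradiction e i≢k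
      quad-inj _ i≢k _ _ _ _ 2F 0F e = contradiction (sym e) i≢k
      quad-inj _ _ i≢l _ _ _ 0F 3F e = contradiction e i≢l
      quad-inj _ _ i≢l _ _ _ 3F 0F e = contradiction (sym e) i≢l
      quad-inj _ _ _ j≢k _ _ 1F 2F e = contradiction e j≢k
      quad-inj _ _ _ j≢k _ _ 2F 1F e = contradiction (sym e) j≢k
      quad-inj _ _ _ _ j≢l _ 1F 3F e = contradiction e j≢l
      quad-inj _ _ _ _ j≢l _ 3F 1F e = contradiction (sym e) j≢l
      quad-inj _ _ _ _ _ k≢l 2F 3F e = contradiction e k≢l
      quad-inj _ _ _ _ _ k≢l 3F 2F e = contradiction (sym e) k≢l

      -- Column `i` lies on the line `a` exactly when the relation with coefficients `a ∙ c i` omits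
      -- the point `i`. A line with four of the ten columns is thus a relation of weight at most
      -- six, and without such relations the columns form an arc.
      heavy⇒⊥ : ¬ (∃[ x ] ∃[ y ] ∃[ z ] Light x y z) → ⊥
      heavy⇒⊥ none = Arc.absurd q≡4 m≡8 K c few-zeros
        where
        nonzero-vec₃ : ∀ a → NonZeroVector a → NonZeroVector (vec₃ (a 0F) (a 1F) (a 2F))
        nonzero-vec₃ a (0F , aₜ≢0) = 0F , aₜ≢0
        nonzero-vec₃ a (1F , aₜ≢0) = 1F , aₜ≢0
        nonzero-vec₃ a (2F , aₜ≢0) = 2F , aₜ≢0
        few-zeros : ∀ {a} → NonZeroVector a → ∀ {i j k l} → i ≢ j → i ≢ k → i ≢ l → j ≢ k → j ≢ l → k ≢ l →
                    a ∙ c i ≡ 0# → a ∙ c j ≡ 0# → a ∙ c k ≡ 0# → a ∙ c l ≡ 0# → ⊥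
        few-zeros {a} a≢0 {i} {j} {k} {l} i≢j i≢k i≢l j≢k j≢l k≢l zi zj zk zl =
          none (a 0F , a 1F , a 2F , nonzero-vec₃ a a≢0 ,
            four-zeros (relation (vec₃ (a 0F) (a 1F) (a 2F))) (quad i j k l)
              (λ {x} {y} → quad-inj i≢j i≢k i≢l j≢k j≢l k≢l x y) zeros)
          where
          zeros : ∀ t → relation (vec₃ (a 0F) (a 1F) (a 2F)) (quad i j k l t) ≡ 0#
          zeros 0F = zi
          zeros 1F = zj
          zeros 2F = zk
          zeros 3F = zl

    ten-dependent : SixDependent K p
    ten-dependent = cases light?
      where
      cases : Dec (∃[ x ] ∃[ y ] ∃[ z ] Light x y z) → SixDependent K p
      cases (no none) = ⊥-elim (heavy⇒⊥ none)
      cases (yes (x , y , z , ≢0 , w≤6)) = low-weight⇒dependent p (subst (λ m → 6 ≤ 2 ℕ.+ m) (sym m≡8) (ℕ.m≤m+n 6 4))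
        (relation (vec₃ x y z)) (nonzero (vec₃ x y z) ≢0) w≤6 (kernel (vec₃ x y z))

  module _ {q m} (q≡4 : q ≡ 4) (m≡8 : m ≡ 8) (K : FiniteField q) (p : Fin (2 ℕ.+ m) → Fin 7 → Fin q) where

    open FieldTheory K

    private
      infixr 5 _◂_
      _◂_ : ∀ {k} → (Fin (2 ℕ.+ m) → Carrier) → (Fin (2 ℕ.+ m) → Fin k → Carrier) → Fin (2 ℕ.+ m) → Fin (suc k) → Carrier
      (e ◂ r) i zero    = e i
      (e ◂ r) i (suc j) = r i j

      δ : Fin (2 ℕ.+ m) → Fin (2 ℕ.+ m) → Carrier
      δ i j with j Fin.≟ i
      ... | yes _ = 1#
      ... | no  _ = 0#

      ∙-δ : ∀ x i → x ∙ δ i ≡ x i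
      ∙-δ x i = trans (sum-single {f = λ j → x j * δ i j} i off) on
        where
        off : ∀ j → j ≢ i → x j * δ i j ≡ 0#
        off j j≢i with j Fin.≟ i
        ... | yes e = contradiction e j≢i
        ... | no _  = zeroʳ (x j)
        on : x i * δ i i ≡ x i
        on with i Fin.≟ i
        ... | yes _ = *-identityʳ (x i)
        ... | no ≢  = contradiction refl ≢

      few : ∀ {k} → k < 10 → k < 2 ℕ.+ m
      few {k} = subst (λ m → k < 2 ℕ.+ m) (sym m≡8)

    -- Adjoining `δ j₁` as a further coordinate forces the second relation to vanish at the pivot of
    -- the first, and likewise for the third relation and both earlier pivots. Ten points outnumber
    -- 7, 8 and 9 coordinates.
    six-dependent-q≡4 : SixDependent K p
    six-dependent-q≡4 =
      let α₁ , (j₁ , α₁j₁≢0) , ker₁ = more-dependent {2 ℕ.+ m} {7} (few (ℕ.m≤m+n 8 2)) p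
          α₂ , (j₂ , α₂j₂≢0) , ker₂ = more-dependent {2 ℕ.+ m} {8} (few (ℕ.m≤m+n 9 1)) (δ j₁ ◂ p)
          α₃ , (j₃ , α₃j₃≢0) , ker₃ = more-dependent {2 ℕ.+ m} {9} (few ℕ.≤-refl) (δ j₁ ◂ δ j₂ ◂ p)
          c , kernel , nonzero = Relations.three-relations K p α₁ α₂ α₃ {j₁} {j₂} {j₃} α₁j₁≢0 α₂j₂≢0 α₃j₃≢0
            (trans (sym (∙-δ α₂ j₁)) (ker₂ zero)) (trans (sym (∙-δ α₃ j₁)) (ker₃ zero)) (trans (sym (∙-δ α₃ j₂)) (ker₃ (suc zero)))
            ker₁ (λ j → ker₂ (suc j)) (λ j → ker₃ (suc (suc j)))
      in LightRelation.ten-dependent q≡4 m≡8 K p c kernel nonzero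

  six-dependent : ∀ {q n} (K : FiniteField q) → 4 ≤ q → n ℕ.+ q ≡ q ℕ.* q ℕ.+ 1 →
                  (p : Fin n → Fin 7 → Fin q) → SixDependent K p
  six-dependent {q} {n} K 4≤q n+q≡ p = cases (5 ℕ.≤? q)
    where
    cases : Dec (5 ≤ q) → SixDependent K p
    cases (yes 5≤q) = six-dependent-q≥5 K 5≤q n+q≡ p
    cases (no  5≰q) =
      let g , g-inj , rest = six-dependent-q≡4 q≡4 refl K (λ i → p (inject≤ i 10≤n))
      in (λ i → inject≤ (g i) 10≤n) , (λ e → g-inj (Fin.inject≤-injective 10≤n 10≤n _ _ e)) , rest
      where
      q≡4 : q ≡ 4
      q≡4 = ℕ.≤-antisym (ℕ.s≤s⁻¹ (ℕ.≰⇒> 5≰q)) 4≤q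
      -- For q = 4 the section has 13 points, of which the first ten are used.
      10≤n : 10 ≤ n
      10≤n = ℕ.≤-trans (ℕ.m≤m+n 10 3) (ℕ.≤-reflexive (sym (ℕ.+-cancelʳ-≡ 4 n 13
        (subst (λ q → n ℕ.+ q ≡ q ℕ.* q ℕ.+ 1) q≡4 n+q≡))))

-- The invariant functional of a hyperplane, and the pencil argument for spanning.

module Hyperplanes where

  open Counting
  open CubicExtensions
  open Arithmetic
  open HyperplaneSections
  open import Data.Empty using (⊥)
  open import Data.Fin.Base as Fin using (Fin; zero; suc; punchIn; punchOut; combine; funToFin; finToFun)
  open import Data.Fin.Patterns using (0F; 1F; 2F; 3F; 4F; 5F; 6F; 7F)
  import Data.Fin.Properties as Fin
  open import Data.Nat.Base as ℕ using (ℕ; zero; suc; _≤_; s≤s)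
  import Data.Nat.Properties as ℕ
  open import Data.Product.Base using (Σ; ∃-syntax; _,_; proj₁; proj₂)
  open import Data.Sum.Base using (_⊎_)
  open import Function.Base using (_∘_)
  open import Relation.Binary.PropositionalEquality
  open import Relation.Nullary using (¬_; Dec; yes; no; ¬?)
  open import Relation.Nullary.Decidable using (toSum; decidable-stable)

  -- Otherwise |Z| + q (q² + q + 1 - |Z|) ≥ q³, contradicting |Z| ≥ q² - q.
  no-covering-pencil : ∀ {q n} {A B : Fin (q ℕ.^ 3) → Set} → 4 ≤ q → n ℕ.+ q ≡ q ℕ.* q ℕ.+ 1 →
    (Z : Enumeration A) (N : Enumeration B) → (∀ t → A t ⊎ B t) → n ≤ suc (size Z) →
    (P : Fin q → Fin (q ℕ.^ 3) → Set) (slope : Fin (size N) → Fin q) → (∀ i → P (slope i) (elem N i)) →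
    (∀ l i → P l (elem Z i)) →
    (∀ l {k} (r : Fin k → Fin (q ℕ.^ 3)) → Inj r → (∀ i → P l (r i)) → k ≤ q ℕ.* q ℕ.+ q ℕ.+ 1) →
    (∀ t → A t → ¬ B t) → ⊥
  no-covering-pencil {q} {B = B} 4≤q n+q≡ Z N cover Z-large P slope N∈P Z∈P bounded disjoint =
    let l , r , r-inj , r-slope = large-fibre q (M ℕ.∸ size Z) slope
          (pencil-count 4≤q n+q≡ Z-large Z-small (n≤size+size Z N cover))
    in ℕ.<⇒≱ {M} ℕ.≤-refl (ℕ.≤-trans (ℕ.≤-reflexive (sym (trans (ℕ.+-suc (size Z) (M ℕ.∸ size Z)) (cong suc (ℕ.m+[n∸m]≡n Z-small)))))
         (bounded l (elem Z ⊕ (elem N ∘ r))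
           (⊕-injective (injective Z) (λ e → r-inj (injective N e))
             (λ i j e → disjoint (elem Z i) (sound Z i) (subst B (sym e) (sound N (r j)))))
           (⊕-all (P l) (Z∈P l) (λ j → subst (λ l → P l (elem N (r j))) (r-slope j) (N∈P (r j))))))
    where
    M = q ℕ.* q ℕ.+ q ℕ.+ 1
    -- All members of the pencil contain `Z`, so any single one bounds its size.
    Z-small : size Z ≤ M
    Z-small = bounded (l₀ 4≤q) (elem Z) (injective Z) (Z∈P (l₀ 4≤q))
      where
      l₀ : ∀ {q} → 4 ≤ q → Fin q
      l₀ (s≤s _) = zero

  module Functional {q} (E : FiniteCubicExtension q) where

    open Theory E
    open Projective E
    open ≡-Reasoning

    infix 7 _⊙_
    _⊙_ : ∀ {n} → (Fin n → K.Carrier) → (Fin n → F⁸) → F⁸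
    x ⊙ u = combination (ι ∘ x) u

    Independent : ∀ {n} → (Fin n → F⁸) → Set
    Independent u = ∀ x → (∀ j → (x ⊙ u) j ≡ 0#) → ∀ i → x i ≡ K.0#

    ⊙-invariant : ∀ {n} x {u : Fin n → F⁸} → (∀ i → Invariant (u i)) → Invariant (x ⊙ u)
    ⊙-invariant x {u} u-inv j = trans (σ-sum (λ i → ι (x i) * u i j))
      (sum-cong-≗ λ i → trans (σ-* _ _) (cong₂ _*_ (σ-ι (x i)) (u-inv i j)))

    ⊙-minus : ∀ {n} (x y : Fin n → K.Carrier) (u : Fin n → F⁸) j →
              ((λ i → x i K.- y i) ⊙ u) j ≡ (x ⊙ u) j - (y ⊙ u) j
    ⊙-minus x y u j = begin
      sum (λ i → ι (x i K.- y i) * u i j)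
        ≡⟨ sum-cong-≗ (λ i → trans (cong (_* u i j) (ι-minus (x i) (y i)))
             (solve 3 (λ a b c → (a :- b) :* c := a :* c :+ :- :1 :* (b :* c)) refl (ι (x i)) (ι (y i)) (u i j))) ⟩
      sum (λ i → ι (x i) * u i j + - 1# * (ι (y i) * u i j)) ≡⟨ sum-+* (- 1#) (λ i → ι (x i) * u i j) (λ i → ι (y i) * u i j) ⟩
      (x ⊙ u) j + - 1# * (y ⊙ u) j ≡⟨ solve 2 (λ a b → a :+ :- :1 :* b := a :- b) refl ((x ⊙ u) j) ((y ⊙ u) j) ⟩
      (x ⊙ u) j - (y ⊙ u) j ∎
      where
      ι-minus : ∀ a b → ι (a K.- b) ≡ ι a - ι b
      ι-minus a b = begin
        ι (a K.- b)                   ≡⟨ solve 2 (λ x y → x := (x :+ y) :- y) refl (ι (a K.- b)) (ι b) ⟩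
        (ι (a K.- b) + ι b) - ι b     ≡⟨ cong (_- ι b) (trans (sym (ι-+ _ _)) (cong ι (K.solve 2 (λ a b → a K.:- b K.:+ b K.:= a) refl a b))) ⟩
        ι a - ι b                     ∎

    independent⇒unique : ∀ {n} {u : Fin n → F⁸} → Independent u → ∀ x y → x ⊙ u ≗ y ⊙ u → ∀ i → x i ≡ y i
    independent⇒unique {u = u} indep x y eq i = K.x-y≡0⇒x≡y
      (indep (λ i → x i K.- y i) (λ j → trans (⊙-minus x y u j) (x≡y⇒x-y≡0 (eq j))) i)

    private
      injective⇒surjective′ : ∀ {m n} {f : Fin m → Fin n} → m ≡ n → Inj f → ∀ y → ∃[ x ] f x ≡ y
      injective⇒surjective′ refl f-inj = injective⇒surjective (λ {x} {y} → f-inj {x} {y})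

      κ : ∀ {x} → Fixed x → K.Carrier
      κ {x} σx = proj₁ (fixed⇒ι x σx)

      κ-injective : ∀ {x y} (σx : Fixed x) (σy : Fixed y) → κ σx ≡ κ σy → x ≡ y
      κ-injective {x} {y} σx σy e = trans (sym (proj₂ (fixed⇒ι x σx))) (trans (cong ι e) (proj₂ (fixed⇒ι y σy)))

      -- Invariance makes entries 0 and 7 elements of `K`, entries 2 and 1 conjugates of entry 4,
      -- and entries 5 and 6 conjugates of entry 3, so four entries determine the vector.
      code : ∀ u → Invariant u → Fin (q ℕ.* (q ℕ.^ 3 ℕ.* (q ℕ.^ 3 ℕ.* q)))
      code u u-inv = combine (κ (u-inv 0F)) (combine (u 4F) (combine (u 3F) (κ (u-inv 7F))))

      code-injective : ∀ u u-inv v v-inv → code u u-inv ≡ code v v-inv → u ≗ v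
      code-injective u u-inv v v-inv e = λ
        { 0F → κ-injective (u-inv 0F) (v-inv 0F) (proj₁ split₁)
        ; 1F → trans (sym (u-inv 2F)) (trans (cong σ u₂≡v₂) (v-inv 2F))
        ; 2F → u₂≡v₂
        ; 3F → proj₁ split₃
        ; 4F → proj₁ split₂
        ; 5F → u₅≡v₅
        ; 6F → trans (sym (u-inv 5F)) (trans (cong σ u₅≡v₅) (v-inv 5F))
        ; 7F → κ-injective (u-inv 7F) (v-inv 7F) (proj₂ split₃) }
        where
        split₁ = Fin.combine-injective (κ (u-inv 0F)) (combine (u 4F) (combine (u 3F) (κ (u-inv 7F))))
                   (κ (v-inv 0F)) (combine (v 4F) (combine (v 3F) (κ (v-inv 7F)))) e
        split₂ = Fin.combine-injective (u 4F) (combine (u 3F) (κ (u-inv 7F))) (v 4F) (combine (v 3F) (κ (v-inv 7F))) (proj₂ split₁)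
        split₃ = Fin.combine-injective (u 3F) (κ (u-inv 7F)) (v 3F) (κ (v-inv 7F)) (proj₂ split₂)
        u₂≡v₂ : u 2F ≡ v 2F
        u₂≡v₂ = trans (sym (u-inv 4F)) (trans (cong σ (proj₁ split₂)) (v-inv 4F))
        u₅≡v₅ : u 5F ≡ v 5F
        u₅≡v₅ = trans (sym (u-inv 3F)) (trans (cong σ (proj₁ split₃)) (v-inv 3F))

    -- U₁ has q⁸ elements.
    independent⇒spanning : (g : Fin 8 → F⁸) → (∀ i → Invariant (g i)) → Independent g →
                           ∀ u → Invariant u → Σ (Fin 8 → K.Carrier) λ x → u ≗ x ⊙ g
    independent⇒spanning g g-inv g-indep u u-inv =
      let k , e = injective⇒surjective′ {f = f} (q⁸≡ q) (λ {k} {l} → f-inj {k} {l}) (code u u-inv)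
      in finToFun k , λ j → sym (code-injective (finToFun k ⊙ g) (inv k) u u-inv e j)
      where
      inv : ∀ (k : Fin (q ℕ.^ 8)) → Invariant (finToFun {m = q} {n = 8} k ⊙ g)
      inv k = ⊙-invariant (finToFun k) g-inv
      f : Fin (q ℕ.^ 8) → Fin (q ℕ.* (q ℕ.^ 3 ℕ.* (q ℕ.^ 3 ℕ.* q)))
      f k = code (finToFun k ⊙ g) (inv k)
      f-inj : Inj f
      f-inj {k} {l} e = trans (sym (Fin.funToFin-finToFin {8} {q} k)) (trans
        (funToFin-cong (independent⇒unique {u = g} g-indep (finToFun k) (finToFun l) (code-injective (finToFun k ⊙ g) (inv k) (finToFun l ⊙ g) (inv l) e)))
        (Fin.funToFin-finToFin {8} {q} l))
        where
        funToFin-cong : ∀ {m n} {x y : Fin m → Fin n} → x ≗ y → funToFin x ≡ funToFin y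
        funToFin-cong {zero}  x≗y = refl
        funToFin-cong {suc m} x≗y = cong₂ combine (x≗y zero) (funToFin-cong (x≗y ∘ suc))

    module Hyperplane (h : Fin 7 → F⁸) (h-inv : ∀ i → Invariant (h i)) (h-indep : Independent h) where

      private
        killer = fewer-annihilated {7} {8} ℕ.≤-refl h
        ψ = proj₁ killer
        ψ-nonzero = proj₁ (proj₂ killer)
        ψ-value = nonzero-value ψ (proj₁ ψ-nonzero) (proj₂ ψ-nonzero)
        e = ψ ∙ point (affine (proj₁ ψ-value))
        θ-value = nonzero-value (trace-functional 1#) 4F 1≢0
        θ = proj₁ θ-value
        e⁻¹ = proj₁ (inverse e (proj₂ ψ-value))

        -- Scaled so that `χ` takes the value `θ` at `point u₀`; the trace of `θ` is nonzero, hence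
        -- so is the value of the symmetrised functional there.
        χ : F⁸
        χ j = θ * e⁻¹ * ψ j

        χ-∙ : ∀ u → χ ∙ u ≡ θ * e⁻¹ * (ψ ∙ u)
        χ-∙ u = trans (sum-cong-≗ λ j → *-assoc (θ * e⁻¹) (ψ j) (u j)) (sym (*-distribˡ-sum (θ * e⁻¹) (λ j → ψ j * u j)))

      -- The trace of a multiple of ψ takes values in K on U₁ and still does not vanish there.
      w : F⁸
      w = symmetrize χ

      w-inv : Invariant w
      w-inv = symmetrize-invariant χ

      u₀ : F²
      u₀ = affine (proj₁ ψ-value)

      open Form w w-inv using (f)

      fu₀≢0 : f u₀ ≢ 0#
      fu₀≢0 fu₀≡0 = proj₂ θ-value (begin
        trace-functional 1# ∙ point (affine θ) ≡⟨ trace-functional-∙ 1# θ ⟩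
        Tr (1# * θ)                            ≡⟨ cong Tr (trans (*-comm 1# θ) (cong (θ *_) (sym (proj₂ (inverse e (proj₂ ψ-value)))))) ⟩
        Tr (θ * (e * e⁻¹))                     ≡⟨ cong Tr (trans (solve 3 (λ a b c → a :* (b :* c) := a :* c :* b) refl θ e e⁻¹) (sym (χ-∙ (point u₀)))) ⟩
        Tr (χ ∙ point u₀)                      ≡⟨ symmetrize-∙ χ (point-invariant u₀) ⟨
        f u₀                                   ≡⟨ fu₀≡0 ⟩
        0#                                     ∎)

      w-h : ∀ i → w ∙ h i ≡ 0#
      w-h i = trans (symmetrize-∙ χ (h-inv i)) (trans (cong Tr (trans (χ-∙ (h i)) (trans (cong (θ * e⁻¹ *_) (proj₂ (proj₂ killer) i)) (zeroʳ _))))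
        (trans (cong₂ (λ x y → 0# + x + y) σ-0 (trans (cong σ σ-0) σ-0)) (solve 0 (:0 :+ :0 :+ :0 := :0) refl)))

      g : Fin 8 → F⁸
      g zero    = point u₀
      g (suc i) = h i

      g-inv : ∀ i → Invariant (g i)
      g-inv zero    = point-invariant u₀
      g-inv (suc i) = h-inv i

      w-g : ∀ x → w ∙ (x ⊙ g) ≡ ι (x zero) * f u₀
      w-g x = trans (∙-combination w (ι ∘ x) g) (trans (cong (ι (x zero) * f u₀ +_)
        (sum-zero λ i → trans (cong (ι (x (suc i)) *_) (w-h i)) (zeroʳ _))) (+-identityʳ _))

      head≡0 : ∀ x → w ∙ (x ⊙ g) ≡ 0# → x zero ≡ K.0#
      head≡0 x wx≡0 = ι-injective (trans (*≡0ʳ fu₀≢0 (trans (*-comm _ _) (trans (sym (w-g x)) wx≡0))) (sym ι-0))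

      tail-⊙ : ∀ x → x zero ≡ K.0# → x ⊙ g ≗ (x ∘ suc) ⊙ h
      tail-⊙ x x₀≡0 j = trans (cong (_+ ((x ∘ suc) ⊙ h) j) (trans (cong (_* point u₀ j) (trans (cong ι x₀≡0) ι-0)) (zeroˡ _))) (+-identityˡ _)

      g-indep : Independent g
      g-indep x x⊙g≡0 = λ { zero → x₀≡0 ; (suc i) → h-indep (x ∘ suc) (λ j → trans (sym (tail-⊙ x x₀≡0 j)) (x⊙g≡0 j)) i }
        where
        x₀≡0 : x zero ≡ K.0#
        x₀≡0 = head≡0 x (sum-zero λ j → trans (cong (w j *_) (x⊙g≡0 j)) (zeroʳ (w j)))

      coordinates : ∀ u → Invariant u → Σ (Fin 8 → K.Carrier) λ x → u ≗ x ⊙ g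
      coordinates = independent⇒spanning g g-inv g-indep

      -- Since `w` kills the seven vectors `h` and not `point u₀`, its value reads off the
      -- coordinate along `point u₀`.
      kernel⇒member : ∀ u → Invariant u → w ∙ u ≡ 0# → Σ (Fin 7 → K.Carrier) λ x → u ≗ x ⊙ h
      kernel⇒member u u-inv wu≡0 =
        let x , u≗ = coordinates u u-inv
        in x ∘ suc , λ j → trans (u≗ j) (tail-⊙ x (head≡0 x (trans (sym (∙-congʳ w u≗)) wu≡0)) j)

      -- The pencil of hyperplanes through a subspace {α = 0} of the hyperplane: if that subspace contained
      -- the whole section, then some member of the pencil would meet 𝒪₁ in more than q² + q + 1 points.
      module Pencil (α : Fin 7 → K.Carrier) (m : Fin 7) (αₘ≢0 : α m ≢ K.0#)
                    {n} (n+q≡ : n ℕ.+ q ≡ q ℕ.* q ℕ.+ 1) (pt : Fin n → F²)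
                    (distinct : ∀ {i j} → i ≢ j → det (pt i) (pt j) ≢ 0#) (f-pt : ∀ i → f (pt i) ≡ 0#)
                    (killed : ∀ t x → f (affine t) ≡ 0# → point (affine t) ≗ x ⊙ h → α K.∙ x ≡ K.0#) where

        x : Carrier → Fin 8 → K.Carrier
        x t = proj₁ (coordinates (point (affine t)) (point-invariant (affine t)))

        point≗ : ∀ t → point (affine t) ≗ x t ⊙ g
        point≗ t = proj₂ (coordinates (point (affine t)) (point-invariant (affine t)))

        f-affine : ∀ t → f (affine t) ≡ ι (x t zero) * f u₀
        f-affine t = trans (∙-congʳ w (point≗ t)) (w-g (x t))

        -- In coordinates with respect to `point u₀` and `h`, the given hyperplane is x₀ = 0. The
        -- parameter `l` runs through the q other hyperplanes that contain its subspace α = 0.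
        InPencil : K.Carrier → Carrier → Set
        InPencil l t = α K.∙ (x t ∘ suc) ≡ l K.* x t zero

        module _ (l : K.Carrier) where
          -- Vectors spanning the member of parameter `l`, multiplied by `α m` in place of a
          -- division. A functional `φ` that kills all seven exists over `F`, and the degree bound
          -- is applied to it.
          spanning-vector : Fin 7 → F⁸
          spanning-vector zero    j = ι (α m) * point u₀ j + ι l * h m j
          spanning-vector (suc i) j = ι (α m) * h (punchIn m i) j + - ι (α (punchIn m i)) * h m j

          member = fewer-annihilated {7} {8} ℕ.≤-refl spanning-vector
          φ = proj₁ member

          φ-h : ∀ i → ι (α m) * (φ ∙ h i) ≡ ι (α i) * (φ ∙ h m)
          φ-h i = cases (m Fin.≟ i)
            where
            spanned : ∀ k → ι (α m) * (φ ∙ h (punchIn m k)) ≡ ι (α (punchIn m k)) * (φ ∙ h m)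
            spanned k = x-y≡0⇒x≡y (begin
              ι (α m) * (φ ∙ h i′) - ι (α i′) * (φ ∙ h m)
                ≡⟨ solve 4 (λ a b c d → a :* b :- c :* d := a :* b :+ :- c :* d) refl (ι (α m)) (φ ∙ h i′) (ι (α i′)) (φ ∙ h m) ⟩
              ι (α m) * (φ ∙ h i′) + - ι (α i′) * (φ ∙ h m) ≡⟨ ∙-linear φ (ι (α m)) (h i′) (- ι (α i′)) (h m) ⟨
              φ ∙ spanning-vector (suc k) ≡⟨ proj₂ (proj₂ member) (suc k) ⟩
              0# ∎)
              where i′ = punchIn m k
            cases : Dec (m ≡ i) → ι (α m) * (φ ∙ h i) ≡ ι (α i) * (φ ∙ h m)
            cases (yes refl) = refl
            cases (no m≢i) = subst (λ i → ι (α m) * (φ ∙ h i) ≡ ι (α i) * (φ ∙ h m)) (Fin.punchIn-punchOut m≢i) (spanned (punchOut m≢i))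

          φ-u₀ : ι (α m) * (φ ∙ point u₀) ≡ - (ι l * (φ ∙ h m))
          φ-u₀ = x-y≡0⇒x≡y (begin
            ι (α m) * (φ ∙ point u₀) - - (ι l * (φ ∙ h m)) ≡⟨ solve 2 (λ a b → a :- :- b := a :+ b) refl _ _ ⟩
            ι (α m) * (φ ∙ point u₀) + ι l * (φ ∙ h m) ≡⟨ ∙-linear φ (ι (α m)) (point u₀) (ι l) (h m) ⟨
            φ ∙ spanning-vector zero ≡⟨ proj₂ (proj₂ member) zero ⟩
            0# ∎)

          in-pencil⇒killed : ∀ t → InPencil l t → φ ∙ point (affine t) ≡ 0#
          in-pencil⇒killed t in-l = *≡0ʳ (ι-≢0 αₘ≢0) (begin
            a * (φ ∙ point (affine t)) ≡⟨ cong (a *_) (trans (∙-congʳ φ (point≗ t)) (∙-combination φ (ι ∘ x t) g)) ⟩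
            a * (ι (x t zero) * (φ ∙ point u₀) + sum (λ i → ι (x t (suc i)) * (φ ∙ h i)))
              ≡⟨ solve 4 (λ a y u s → a :* (y :* u :+ s) := y :* (a :* u) :+ a :* s) refl a (ι (x t zero)) (φ ∙ point u₀) _ ⟩
            ι (x t zero) * (a * (φ ∙ point u₀)) + a * sum (λ i → ι (x t (suc i)) * (φ ∙ h i))
              ≡⟨ cong₂ _+_ (cong (ι (x t zero) *_) φ-u₀) tail-sum ⟩
            ι (x t zero) * - (ι l * z) + ι (α K.∙ (x t ∘ suc)) * z
              ≡⟨ cong (λ y → ι (x t zero) * - (ι l * z) + y * z) (trans (cong ι in-l) (ι-* l (x t zero))) ⟩
            ι (x t zero) * - (ι l * z) + ι l * ι (x t zero) * z
              ≡⟨ solve 3 (λ y l z → y :* :- (l :* z) :+ l :* y :* z := :0) refl (ι (x t zero)) (ι l) z ⟩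
            0# ∎)
            where
            a = ι (α m)
            z = φ ∙ h m
            tail-sum : a * sum (λ i → ι (x t (suc i)) * (φ ∙ h i)) ≡ ι (α K.∙ (x t ∘ suc)) * z
            tail-sum = begin
              a * sum (λ i → ι (x t (suc i)) * (φ ∙ h i)) ≡⟨ *-distribˡ-sum a (λ i → ι (x t (suc i)) * (φ ∙ h i)) ⟩
              sum (λ i → a * (ι (x t (suc i)) * (φ ∙ h i)))
                ≡⟨ sum-cong-≗ (λ i → trans (solve 3 (λ a x p → a :* (x :* p) := x :* (a :* p)) refl a (ι (x t (suc i))) (φ ∙ h i))
                     (trans (cong (ι (x t (suc i)) *_) (φ-h i)) (trans (solve 3 (λ x y z → x :* (y :* z) := y :* x :* z) refl (ι (x t (suc i))) (ι (α i)) z)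
                       (cong (_* z) (sym (ι-* (α i) (x t (suc i)))))))) ⟩
              sum (λ i → ι (α i K.* x t (suc i)) * z) ≡⟨ *-distribʳ-sum z (λ i → ι (α i K.* x t (suc i))) ⟨
              sum (λ i → ι (α i K.* x t (suc i))) * z ≡⟨ cong (_* z) (ι-sum (λ i → α i K.* x t (suc i))) ⟨
              ι (α K.∙ (x t ∘ suc)) * z ∎

          pencil-bounded : ∀ {k} (r : Fin k → Carrier) → Inj r → (∀ i → InPencil l (r i)) → k ≤ q ℕ.* q ℕ.+ q ℕ.+ 1
          pencil-bounded r r-inj r-in = let j , φ≢0 = proj₁ (proj₂ member) in
            zeros-bounded φ j φ≢0 r r-inj (λ i → in-pencil⇒killed (r i) (r-in i))

        Z : Enumeration (λ t → f (affine t) ≡ 0#)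
        Z = enumerate (λ t → f (affine t) ≟ 0#)
        N : Enumeration (λ t → f (affine t) ≢ 0#)
        N = enumerate (λ t → ¬? (f (affine t) ≟ 0#))

        cover : ∀ t → f (affine t) ≡ 0# ⊎ f (affine t) ≢ 0#
        cover t = toSum (f (affine t) ≟ 0#)

        zero-in-pencil : ∀ l t → f (affine t) ≡ 0# → InPencil l t
        zero-in-pencil l t ft≡0 = trans (killed t (x t ∘ suc) ft≡0 (λ j → trans (point≗ t j) (tail-⊙ (x t) x₀≡0 j)))
          (sym (trans (cong (l K.*_) x₀≡0) (K.zeroʳ l)))
          where
          x₀≡0 : x t zero ≡ K.0#
          x₀≡0 = head≡0 (x t) (trans (sym (∙-congʳ w (point≗ t))) ft≡0)

        x₀≢0 : ∀ i → x (elem N i) zero ≢ K.0#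
        x₀≢0 i x₀≡0 = sound N i
          (trans (f-affine (elem N i)) (trans (cong (_* f u₀) (trans (cong ι x₀≡0) ι-0)) (zeroˡ (f u₀))))

        slope : Fin (size N) → K.Carrier
        slope i = (α K.∙ (x (elem N i) ∘ suc)) K.* proj₁ (K.inverse (x (elem N i) zero) (x₀≢0 i))

        slope-in-pencil : ∀ i → InPencil (slope i) (elem N i)
        slope-in-pencil i = sym (trans (K.solve 3 (λ s v y → s K.:* v K.:* y K.:= s K.:* (y K.:* v)) refl
            (α K.∙ (x (elem N i) ∘ suc)) y⁻¹ (x (elem N i) zero))
          (trans (cong ((α K.∙ (x (elem N i) ∘ suc)) K.*_) (proj₂ (K.inverse (x (elem N i) zero) (x₀≢0 i)))) (K.*-identityʳ _)))
          where y⁻¹ = proj₁ (K.inverse (x (elem N i) zero) (x₀≢0 i))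

        -- Distinct points have distinct parameters; the one possible exception is the point at
        -- infinity, which has none.
        Z-large : n ≤ suc (size Z)
        Z-large = n≤1+size Z (λ i → proj₁ (pt i) ≟ 0#)
          (λ {i} {j} vᵢ≡0 vⱼ≡0 → parallel⇒≡ i j (heads-zero⇒parallel (pt i) (pt j) vᵢ≡0 vⱼ≡0))
          (λ i → ratio (pt i)) ratio-zero
          (λ i j vᵢ≢0 vⱼ≢0 e → parallel⇒≡ i j (same-ratio⇒parallel (pt i) (pt j) vᵢ≢0 vⱼ≢0 e))
          where
          ratio-zero : ∀ i v₀≢0 → f (affine (ratio (pt i) v₀≢0)) ≡ 0#
          ratio-zero i v₀≢0 = *≡0ʳ (Nm-≢0 v₀≢0) (trans (sym (Form.f-scale w w-inv (proj₁ (pt i)) (affine (ratio (pt i) v₀≢0))))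
            (trans (cong f (⊡-ratio (pt i) v₀≢0)) (f-pt i)))
          parallel⇒≡ : ∀ i j → det (pt i) (pt j) ≡ 0# → i ≡ j
          parallel⇒≡ i j e = decidable-stable (i Fin.≟ j) λ i≢j → distinct i≢j e

        absurd : ⊥
        absurd = no-covering-pencil 4≤q n+q≡ Z N cover Z-large InPencil slope slope-in-pencil
          (λ l i → zero-in-pencil l (elem Z i) (sound Z i)) pencil-bounded (λ t e ≢0 → ≢0 e)

-- Copying the given fields onto `Fin`, where equality is decidable.

module Transport where

  open FiniteFields using (FiniteField; module FieldTheory)
  open CubicExtensions using (FiniteCubicExtension)
  open import Algebra.Apartness.Bundles using (HeytingField)
  open import Algebra.Bundles using (CommutativeRing; RawRing)
  open import Algebra.Morphism.Structures using (IsRingMonomorphism)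
  import Algebra.Morphism.RingMonomorphism as RingMonomorphism
  import Algebra.Properties.Semiring.Exp as Exp
  open import Data.Fin.Base using (Fin; zero; suc)
  open import Data.Fin.Properties as Fin using (any?)
  open import Data.Nat.Base as ℕ using (zero; suc; _≤_)
  open import Data.Product.Base using (∃-syntax; _,_; proj₁; proj₂)
  open import Function.Bundles using (Inverse)
  open import Level using (0ℓ)
  open import Relation.Binary.PropositionalEquality as ≡ using (_≡_; _≢_)
  open import Relation.Nullary using (¬_; yes; no; contradiction)

  module OnFin {c ℓ a} (K : HeytingField c ℓ a) {N} (enumeration : Defs.HasCardinality (CommutativeRing.setoid (Defs.ringOf K)) N) where

    open CommutativeRing (Defs.ringOf K)
    open HeytingField K using (#⇒invertible; invertible⇒#; #-irrefl; tight)
    open Inverse enumeration public using (to; from; from-cong)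
    open import Relation.Binary.Reasoning.Setoid setoid

    to-from : ∀ x → to (from x) ≈ x
    to-from x = Inverse.strictlyInverseˡ enumeration x

    from-to : ∀ i → from (to i) ≡ i
    from-to i = Inverse.strictlyInverseʳ enumeration i

    from-injective : ∀ {x y} → from x ≡ from y → x ≈ y
    from-injective {x} {y} e = trans (sym (to-from x)) (trans (reflexive (≡.cong to e)) (to-from y))

    private
      rawRing-Fin : RawRing 0ℓ 0ℓ
      rawRing-Fin = record
        { Carrier = Fin N
        ; _≈_ = _≡_
        ; _+_ = λ i j → from (to i + to j)
        ; _*_ = λ i j → from (to i * to j)
        ; -_  = λ i → from (- to i)
        ; 0#  = from 0#
        ; 1#  = from 1#
        }

      to-mono : IsRingMonomorphism rawRing-Fin rawRing to
      to-mono = record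
        { isRingHomomorphism = record
          { isSemiringHomomorphism = record
            { isNearSemiringHomomorphism = record
              { +-isMonoidHomomorphism = record
                { isMagmaHomomorphism = record
                  { isRelHomomorphism = record { cong = λ e → reflexive (≡.cong to e) }
                  ; homo = λ i j → to-from _
                  }
                ; ε-homo = to-from 0#
                }
              ; *-homo = λ i j → to-from _
              }
            ; 1#-homo = to-from 1#
            }
          ; -‿homo = λ i → to-from _
          }
        ; injective = λ {i} {j} e → ≡.trans (≡.sym (from-to i)) (≡.trans (from-cong e) (from-to j))
        }

      1≉0 : ¬ 1# ≈ 0#
      1≉0 1≈0 = #-irrefl refl (invertible⇒# {0#} {0#} (0# , trivial _ , trivial _))
        where
        trivial : ∀ x → x ≈ 1#
        trivial x = trans (sym (*-identityʳ x)) (trans (*-congˡ 1≈0) (trans (zeroʳ x) (sym 1≈0)))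

    -- Inverses are found by search, as x # 0 is only known up to double negation.
    field-Fin : FiniteField N
    field-Fin = record
      { _+_ = RawRing._+_ rawRing-Fin
      ; _*_ = RawRing._*_ rawRing-Fin
      ; -_  = RawRing.-_ rawRing-Fin
      ; 0#  = RawRing.0# rawRing-Fin
      ; 1#  = RawRing.1# rawRing-Fin
      ; isCommutativeRing = RingMonomorphism.isCommutativeRing to-mono isCommutativeRing
      ; 1≢0 = λ e → 1≉0 (from-injective e)
      ; inverse = inverse
      }
      where
      inverse : ∀ i → i ≢ from 0# → ∃[ j ] from (to i * to j) ≡ from 1#
      inverse i i≢0 with any? (λ j → from (to i * to j) Fin.≟ from 1#)
      ... | yes found = found
      ... | no  none  = contradiction i≡0 i≢0
        where
        not-apart : ¬ HeytingField._#_ K (to i) 0#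
        not-apart apart = let y , _ , xy≈1 = #⇒invertible apart in none (from y , from-cong (begin
          to i * to (from y)      ≈⟨ *-congˡ (to-from y) ⟩
          to i * y                ≈⟨ *-congʳ (trans (sym (+-identityʳ _)) (+-congˡ (sym -0≈0))) ⟩
          (to i - 0#) * y         ≈⟨ xy≈1 ⟩
          1#                      ∎))
          where
          -0≈0 : - 0# ≈ 0#
          -0≈0 = trans (sym (+-identityˡ _)) (-‿inverseʳ 0#)
        i≡0 : i ≡ from 0#
        i≡0 = ≡.trans (≡.sym (from-to i)) (from-cong (proj₁ (tight (to i) 0#) not-apart))

    module Fi = FieldTheory field-Fin

    from-+ : ∀ x y → from (x + y) ≡ from x Fi.+ from y
    from-+ x y = from-cong (sym (+-cong (to-from x) (to-from y)))

    from-* : ∀ x y → from (x * y) ≡ from x Fi.* from y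
    from-* x y = from-cong (sym (*-cong (to-from x) (to-from y)))

    open Exp semiring using (_^_)

    from-^ : ∀ x n → from (x ^ n) ≡ from x Fi.^ n
    from-^ x zero    = ≡.refl
    from-^ x (suc n) = ≡.trans (from-* x (x ^ n)) (≡.cong (from x Fi.*_) (from-^ x n))

  module OnFin³ {c ℓ a} {q} (q-power : Defs.IsPrimePower q) (4≤q : 4 ≤ q) (E : Defs.CubicExtension c ℓ a q) where

    private module E = Defs.CubicExtension E
    open IsRingMonomorphism E.ι-mono

    module FromK = OnFin E.K E.K-order
    module FromF = OnFin E.F E.F-order

    from-ι : ∀ x → FromF.from (E.ι (FromK.to (FromK.from x))) ≡ FromF.from (E.ι x)
    from-ι x = FromF.from-cong (⟦⟧-cong (FromK.to-from x))

    extension : FiniteCubicExtension q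
    extension = record
      { p = proj₁ q-power
      ; k = proj₁ (proj₂ q-power)
      ; p-prime = proj₁ (proj₂ (proj₂ q-power))
      ; q≡p^1+k = proj₂ (proj₂ (proj₂ q-power))
      ; 4≤q = 4≤q
      ; K = FromK.field-Fin
      ; F = FromF.field-Fin
      ; ι = λ i → FromF.from (E.ι (FromK.to i))
      ; ι-injective = λ {i} {j} e → ≡.trans (≡.sym (FromK.from-to i))
          (≡.trans (FromK.from-cong (injective (FromF.from-injective e))) (FromK.from-to j))
      ; ι-+ = λ i j → ≡.trans (from-ι _) (≡.trans (FromF.from-cong (+-homo _ _)) (FromF.from-+ _ _))
      ; ι-* = λ i j → ≡.trans (from-ι _) (≡.trans (FromF.from-cong (*-homo _ _)) (FromF.from-* _ _))
      ; ι-0 = ≡.trans (from-ι _) (FromF.from-cong 0#-homo)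
      ; ι-1 = ≡.trans (from-ι _) (FromF.from-cong 1#-homo)
      }

-- Points of 𝒪₁ as vectors of the projective line over `F`.

module Coordinates where

  open CubicExtensions
  open HyperplaneSections
  open Hyperplanes
  open Transport
  open import Algebra.Module.Bundles using (module Module)
  import Algebra.Properties.Semiring.Exp as Exp
  open import Data.Fin.Base using (Fin; zero; suc)
  open import Data.Fin.Patterns using (0F; 1F; 2F; 3F; 4F; 5F; 6F; 7F)
  open import Data.Nat.Base as ℕ using (ℕ; zero; suc; _≤_)
  import Data.Nat.Properties as ℕ
  open import Data.Product.Base using (∃-syntax; _,_; proj₁; proj₂)
  open import Data.Sum.Base using (inj₁; inj₂)
  import Data.Vec.Functional as V
  open import Function.Base using (_∘_)
  open import Relation.Binary.PropositionalEquality
  open import Relation.Nullary using (yes; no; contradiction)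

  module Bridge {c ℓ a} {q} (q-power : Defs.IsPrimePower q) (4≤q : 4 ≤ q) (E : Defs.CubicExtension c ℓ a q) where

    open OnFin³ q-power 4≤q E public
    open Theory extension
    open Projective extension
    open Functional extension
    open ≡-Reasoning
    module E = Defs.CubicExtension E
    module T = Defs.Twisted E
    open Module T.V using (Carrierᴹ; _≈ᴹ_; _*ₗ_; 0ᴹ)
    open Exp E.F.semiring using () renaming (_^_ to _^ᶠ_)

    ⌊_⌋ᶠ : E.F.Carrier → Carrier
    ⌊ x ⌋ᶠ = FromF.from x

    ⌊_⌋ᵏ : E.K.Carrier → K.Carrier
    ⌊ x ⌋ᵏ = FromK.from x

    ⌊_⌋ : Carrierᴹ → F⁸
    ⌊ v ⌋ j = ⌊ v j ⌋ᶠ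

    ⌊⌋-cong : ∀ {v w} → v ≈ᴹ w → ⌊ v ⌋ ≗ ⌊ w ⌋
    ⌊⌋-cong v≈w j = FromF.from-cong (v≈w j)

    ⌊⌋-injective : ∀ {v w} → ⌊ v ⌋ ≗ ⌊ w ⌋ → v ≈ᴹ w
    ⌊⌋-injective e j = FromF.from-injective (e j)

    ⌊*ₗ⌋ : ∀ x v j → ⌊ x *ₗ v ⌋ j ≡ ι ⌊ x ⌋ᵏ * ⌊ v ⌋ j
    ⌊*ₗ⌋ x v j = trans (FromF.from-* (E.ι x) (v j)) (cong (_* ⌊ v ⌋ j) (sym (from-ι x)))

    ⌊linComb⌋ : ∀ {n} (x : Fin n → E.K.Carrier) (v : Fin n → Carrierᴹ) j →
                ⌊ T.linComb x v ⌋ j ≡ ((⌊_⌋ᵏ ∘ x) ⊙ (⌊_⌋ ∘ v)) j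
    ⌊linComb⌋ {zero}  x v j = refl
    ⌊linComb⌋ {suc n} x v j = trans (FromF.from-+ (E.ι (x zero) E.F.* v zero j) (T.linComb (x ∘ suc) (v ∘ suc) j))
      (cong₂ _+_ (⌊*ₗ⌋ (x zero) (v zero) j) (⌊linComb⌋ (x ∘ suc) (v ∘ suc) j))

    ⌊linComb-to⌋ : ∀ {n} (x : Fin n → K.Carrier) (v : Fin n → Carrierᴹ) j →
                   ⌊ T.linComb (FromK.to ∘ x) v ⌋ j ≡ (x ⊙ (⌊_⌋ ∘ v)) j
    ⌊linComb-to⌋ x v j = trans (⌊linComb⌋ (FromK.to ∘ x) v j)
      (sum-cong-≗ λ i → cong (λ y → ι y * ⌊ v i ⌋ j) (FromK.from-to (x i)))

    linComb-member : ∀ (S : T.Subspace) {n} (x : Fin n → E.K.Carrier) (v : Fin n → Carrierᴹ) →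
                     (∀ i → T.Mem S (v i)) → T.Mem S (T.linComb x v)
    linComb-member S {zero}  x v v∈S = T.Subspace.0-closed S
    linComb-member S {suc n} x v v∈S = T.Subspace.+-closed S
      (T.Subspace.*-closed S (x zero) (v∈S zero)) (linComb-member S (x ∘ suc) (v ∘ suc) (v∈S ∘ suc))

    ⊙-member : ∀ (S : T.Subspace) {n} (x : Fin n → K.Carrier) (v : Fin n → Carrierᴹ) → (∀ i → T.Mem S (v i)) →
               ∀ {u} → ⌊ u ⌋ ≗ x ⊙ (⌊_⌋ ∘ v) → T.Mem S u
    ⊙-member S x v v∈S {u} u≗ = T.Subspace.resp S {T.linComb (FromK.to ∘ x) v} {u}
      (⌊⌋-injective λ j → trans (⌊linComb-to⌋ x v j) (sym (u≗ j))) (linComb-member S (FromK.to ∘ x) v v∈S)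

    -- U₁ and the points of 𝒪₁

    vec : (a b c d : Carrier) → F⁸
    vec a b c d = a V.∷ σ (σ b) V.∷ σ b V.∷ c V.∷ b V.∷ σ c V.∷ σ (σ c) V.∷ d V.∷ V.[]

    ^q^2≡σσ : ∀ x → x ^ (q ℕ.^ 2) ≡ σ (σ x)
    ^q^2≡σσ x = trans (cong (λ m → x ^ (q ℕ.* m)) (ℕ.*-identityʳ q)) (sym (σσ≡^q*q x))

    ⌊vec⌋ : ∀ a b c d → ⌊ T.vec a b c d ⌋ ≗ vec ⌊ a ⌋ᶠ ⌊ b ⌋ᶠ ⌊ c ⌋ᶠ ⌊ d ⌋ᶠ
    ⌊vec⌋ a b c d = λ { 0F → refl ; 1F → square b ; 2F → FromF.from-^ b q ; 3F → refl
                      ; 4F → refl ; 5F → FromF.from-^ c q ; 6F → square c ; 7F → refl }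
      where
      square : ∀ x → ⌊ x ^ᶠ (q ℕ.^ 2) ⌋ᶠ ≡ σ (σ ⌊ x ⌋ᶠ)
      square x = trans (FromF.from-^ x (q ℕ.^ 2)) (^q^2≡σσ ⌊ x ⌋ᶠ)

    vec-invariant : ∀ {a d} → Fixed a → Fixed d → ∀ b c → Invariant (vec a b c d)
    vec-invariant σa σd b c = λ { 0F → σa ; 1F → σ³ b ; 2F → refl ; 3F → refl ; 4F → refl ; 5F → refl ; 6F → σ³ c ; 7F → σd }

    invariant-resp : ∀ {u v : F⁸} → u ≗ v → Invariant v → Invariant u
    invariant-resp u≗v v-inv j = trans (cong σ (u≗v j)) (trans (v-inv j) (sym (u≗v (rotate j))))

    U₁⇒invariant : ∀ {v} → T.U₁ v → Invariant ⌊ v ⌋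
    U₁⇒invariant {v} (a , b , c , d , v≈) = invariant-resp
      (λ j → trans (⌊⌋-cong v≈ j) (⌊vec⌋ (E.ι a) b c (E.ι d) j))
      (vec-invariant (fixed a) (fixed d) ⌊ b ⌋ᶠ ⌊ c ⌋ᶠ)
      where
      fixed : ∀ a → Fixed ⌊ E.ι a ⌋ᶠ
      fixed a = subst Fixed (from-ι a) (σ-ι ⌊ a ⌋ᵏ)

    vec-affine : ∀ t → vec 1# t (σ (σ t) * σ t) (σ (σ t) * σ t * (t * 1#)) ≗ point (affine t)
    vec-affine t j = trans (entry j) (cong₂ (λ x y → tensor (1# , t) (x , σ t) (y , σ (σ t)) j) (sym σ-1) (sym (trans (cong σ σ-1) σ-1)))
      where
      σc : σ (σ (σ t) * σ t) ≡ t * σ (σ t)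
      σc = trans (σ-* (σ (σ t)) (σ t)) (cong (_* σ (σ t)) (σ³ t))
      entry : vec 1# t (σ (σ t) * σ t) (σ (σ t) * σ t * (t * 1#)) ≗ tensor (1# , t) (1# , σ t) (1# , σ (σ t))
      entry = λ
        { 0F → solve 0 (:1 := :1 :* :1 :* :1) refl
        ; 1F → solve 1 (λ r → r := :1 :* :1 :* r) refl (σ (σ t))
        ; 2F → solve 1 (λ s → s := :1 :* s :* :1) refl (σ t)
        ; 3F → solve 2 (λ s r → r :* s := :1 :* s :* r) refl (σ t) (σ (σ t))
        ; 4F → solve 1 (λ t → t := t :* :1 :* :1) refl t
        ; 5F → trans σc (solve 2 (λ t r → t :* r := t :* :1 :* r) refl t (σ (σ t)))
        ; 6F → trans (cong σ σc) (trans (σ-* t (σ (σ t))) (trans (cong (σ t *_) (σ³ t))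
                 (solve 2 (λ t s → s :* t := t :* s :* :1) refl t (σ t))))
        ; 7F → solve 3 (λ t s r → r :* s :* (t :* :1) := t :* s :* r) refl t (σ t) (σ (σ t)) }

    ⌊P₁⌋ : ∀ t → ⌊ proj₁ (T.P₁ t) ⌋ ≗ point (affine ⌊ t ⌋ᶠ)
    ⌊P₁⌋ t j = trans (⌊vec⌋ E.F.1# t _ _ j) (trans (cong₂ (λ c d → vec 1# t′ c d j) c≡ d≡) (vec-affine t′ j))
      where
      t′ = ⌊ t ⌋ᶠ
      c≡ : ⌊ t ^ᶠ (q ℕ.^ 2 ℕ.+ q) ⌋ᶠ ≡ σ (σ t′) * σ t′
      c≡ = trans (FromF.from-^ t (q ℕ.^ 2 ℕ.+ q)) (trans (^-homo-* t′ (q ℕ.^ 2) q) (cong (_* σ t′) (^q^2≡σσ t′)))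
      d≡ : ⌊ t ^ᶠ (q ℕ.^ 2 ℕ.+ q ℕ.+ 1) ⌋ᶠ ≡ σ (σ t′) * σ t′ * (t′ * 1#)
      d≡ = trans (FromF.from-^ t (q ℕ.^ 2 ℕ.+ q ℕ.+ 1)) (trans (^-homo-* t′ (q ℕ.^ 2 ℕ.+ q) 1)
        (cong (_* (t′ * 1#)) (trans (^-homo-* t′ (q ℕ.^ 2) q) (cong (_* σ t′) (^q^2≡σσ t′)))))

    ∞ : F²
    ∞ = 0# , 1#

    ⌊P∞⌋ : ⌊ proj₁ T.P∞ ⌋ ≗ point ∞
    ⌊P∞⌋ j = trans (⌊vec⌋ E.F.0# E.F.0# E.F.0# E.F.1# j) (trans (entry j)
      (cong₂ (λ u v → tensor ∞ u v j) (sym σ₂∞) (sym (trans (cong σ₂ σ₂∞) σ₂∞))))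
      where
      σ₂∞ : σ₂ ∞ ≡ ∞
      σ₂∞ = cong₂ _,_ σ-0 σ-1
      σσ0 : σ (σ 0#) ≡ 0#
      σσ0 = trans (cong σ σ-0) σ-0
      entry : vec 0# 0# 0# 1# ≗ tensor ∞ ∞ ∞
      entry = λ
        { 0F → solve 0 (:0 := :0 :* :0 :* :0) refl
        ; 1F → trans σσ0 (solve 0 (:0 := :0 :* :0 :* :1) refl)
        ; 2F → trans σ-0 (solve 0 (:0 := :0 :* :1 :* :0) refl)
        ; 3F → solve 0 (:0 := :0 :* :1 :* :1) refl
        ; 4F → solve 0 (:0 := :1 :* :0 :* :0) refl
        ; 5F → trans σ-0 (solve 0 (:0 := :1 :* :0 :* :1) refl)
        ; 6F → trans σσ0 (solve 0 (:0 := :1 :* :1 :* :0) refl)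
        ; 7F → solve 0 (:1 := :1 :* :1 :* :1) refl }

    -- The factor in `K` could be absorbed into the vector by surjectivity of the norm; it is
    -- recorded separately instead.
    record Coordinates (v : Carrierᴹ) : Set where
      field
        vector   : F²
        vector≢0 : vector ≢ 0₂
        scale    : K.Carrier
        scale≢0  : scale ≢ K.0#
        ⌊⌋≗      : ∀ j → ⌊ v ⌋ j ≡ ι scale * point vector j

    open Coordinates public

    coordinates-of : ∀ (P : T.Point) → T.O₁ P → Coordinates (proj₁ P)
    coordinates-of P@(v , v≉0) = λ
      { (inj₁ (t , (x , v≈) , _)) → from-multiple x (affine ⌊ t ⌋ᶠ) (λ e → 1≢0 (cong proj₁ e))
          λ j → trans (⌊⌋-cong v≈ j) (trans (⌊*ₗ⌋ x (proj₁ (T.P₁ t)) j) (cong (ι ⌊ x ⌋ᵏ *_) (⌊P₁⌋ t j)))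
      ; (inj₂ ((x , v≈) , _)) → from-multiple x ∞ (λ e → 1≢0 (cong proj₂ e))
          λ j → trans (⌊⌋-cong v≈ j) (trans (⌊*ₗ⌋ x (proj₁ T.P∞) j) (cong (ι ⌊ x ⌋ᵏ *_) (⌊P∞⌋ j))) }
      where
      from-multiple : ∀ x u → u ≢ 0₂ → (∀ j → ⌊ v ⌋ j ≡ ι ⌊ x ⌋ᵏ * point u j) → Coordinates v
      from-multiple x u u≢0 v≗ = record
        { vector = u ; vector≢0 = u≢0 ; scale = ⌊ x ⌋ᵏ ; ⌊⌋≗ = v≗
        ; scale≢0 = λ x≡0 → v≉0 (⌊⌋-injective {v} {0ᴹ} λ j →
            trans (v≗ j) (trans (cong (λ y → ι y * point u j) x≡0) (trans (cong (_* point u j) ι-0) (zeroˡ (point u j))))) }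

    parallel⇒scalar : ∀ {u v} → v ≢ 0₂ → det u v ≡ 0# → ∃[ μ ] u ≡ μ ⊡ v
    parallel⇒scalar {u₀ , u₁} {v₀ , v₁} v≢0 det≡0 with v₀ ≟ 0# | v₁ ≟ 0#
    ... | yes refl | yes refl = contradiction refl v≢0
    ... | no v₀≢0 | _ = let i , v₀i≡1 = inverse v₀ v₀≢0 in u₀ * i , cong₂ _,_
          (sym (trans (solve 3 (λ u i v → u :* i :* v := u :* (v :* i)) refl u₀ i v₀) (trans (cong (u₀ *_) v₀i≡1) (*-identityʳ u₀))))
          (sym (trans (solve 3 (λ u i v → u :* i :* v := u :* v :* i) refl u₀ i v₁) (trans (cong (_* i) (x-y≡0⇒x≡y det≡0))
            (trans (*-assoc u₁ v₀ i) (trans (cong (u₁ *_) v₀i≡1) (*-identityʳ u₁))))))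
    ... | _ | no v₁≢0 = let i , v₁i≡1 = inverse v₁ v₁≢0 in u₁ * i , cong₂ _,_
          (sym (trans (solve 3 (λ u i v → u :* i :* v := u :* v :* i) refl u₁ i v₀) (trans (cong (_* i) (sym (x-y≡0⇒x≡y det≡0)))
            (trans (*-assoc u₀ v₁ i) (trans (cong (u₀ *_) v₁i≡1) (*-identityʳ u₀))))))
          (sym (trans (solve 3 (λ u i v → u :* i :* v := u :* (v :* i)) refl u₁ i v₁) (trans (cong (u₁ *_) v₁i≡1) (*-identityʳ u₁))))

    -- The factor between the two points is the norm of the factor between the vectors, and norms
    -- come from `K`.
    parallel⇒multiple : ∀ u v → v ≢ 0₂ → det u v ≡ 0# → ∃[ s ] ∀ j → point u j ≡ ι s * point v j
    parallel⇒multiple u v v≢0 det≡0 =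
      let μ , u≡μv = parallel⇒scalar {u} {v} v≢0 det≡0
          s , ιs≡Nμ = fixed⇒ι (Nm μ) (Nm-fixed μ)
      in s , λ j → trans (cong (λ u → point u j) u≡μv) (trans (point-scale μ v j) (cong (_* point v j) (sym ιs≡Nμ)))

    -- The product functional `φ` built from `v` and its conjugates kills `point v` and takes the
    -- norm of `det u v` as its value at `point u`.
    multiple⇒parallel : ∀ u v x → x ≢ 0# → ∀ y → (∀ j → x * point u j ≡ y * point v j) → det u v ≡ 0#
    multiple⇒parallel u v x x≢0 y e with det u v ≟ 0#
    ... | yes det≡0 = det≡0
    ... | no  det≢0 = contradiction (begin
      x * (det u v * det (σ₂ u) (σ₂ v) * det (σ₂ (σ₂ u)) (σ₂ (σ₂ v)))
        ≡⟨ cong (x *_) (tensor-ᗮ u (σ₂ u) (σ₂ (σ₂ u)) v (σ₂ v) (σ₂ (σ₂ v))) ⟨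
      x * (φ ∙ point u)     ≡⟨ scalar x (point u) ⟨
      φ ∙ (λ j → x * point u j) ≡⟨ ∙-congʳ φ e ⟩
      φ ∙ (λ j → y * point v j) ≡⟨ scalar y (point v) ⟩
      y * (φ ∙ point v)     ≡⟨ cong (y *_) (tensor-ᗮ v (σ₂ v) (σ₂ (σ₂ v)) v (σ₂ v) (σ₂ (σ₂ v))) ⟩
      y * (det v v * det (σ₂ v) (σ₂ v) * det (σ₂ (σ₂ v)) (σ₂ (σ₂ v)))
        ≡⟨ cong (λ d → y * (d * det (σ₂ v) (σ₂ v) * det (σ₂ (σ₂ v)) (σ₂ (σ₂ v)))) (det-self v) ⟩
      y * (0# * det (σ₂ v) (σ₂ v) * det (σ₂ (σ₂ v)) (σ₂ (σ₂ v)))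
        ≡⟨ solve 3 (λ y a b → y :* (:0 :* a :* b) := :0) refl y (det (σ₂ v) (σ₂ v)) (det (σ₂ (σ₂ v)) (σ₂ (σ₂ v))) ⟩
      0#                    ∎)
      (*-≢0 x≢0 (*-≢0 (*-≢0 det≢0 σdet≢0) σσdet≢0))
      where
      φ : F⁸
      φ = tensor (v ᗮ) ((σ₂ v) ᗮ) ((σ₂ (σ₂ v)) ᗮ)
      scalar : ∀ c (u : F⁸) → φ ∙ (λ j → c * u j) ≡ c * (φ ∙ u)
      scalar c u = trans (sum-cong-≗ λ j → solve 3 (λ a c u → a :* (c :* u) := c :* (a :* u)) refl (φ j) c (u j)) (sym (*-distribˡ-sum c (λ j → φ j * u j)))
      σdet≢0 : det (σ₂ u) (σ₂ v) ≢ 0#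
      σdet≢0 e = σ-≢0 det≢0 (trans (σ-det u v) e)
      σσdet≢0 : det (σ₂ (σ₂ u)) (σ₂ (σ₂ v)) ≢ 0#
      σσdet≢0 e = σ-≢0 σdet≢0 (trans (σ-det (σ₂ u) (σ₂ v)) e)

    parallel⇒∼ : ∀ {v w} (cv : Coordinates v) (cw : Coordinates w) → det (vector cv) (vector cw) ≡ 0# →
                 ∃[ x ] v ≈ᴹ x *ₗ w
    parallel⇒∼ {v} {w} cv cw det≡0 =
      let s , u≗ = parallel⇒multiple (vector cv) (vector cw) (vector≢0 cw) det≡0
          i , ci≡1 = K.inverse (scale cw) (scale≢0 cw)
          x = scale cv K.* s K.* i
      in FromK.to x , ⌊⌋-injective {v} {FromK.to x *ₗ w} λ j → begin
        ⌊ v ⌋ j                                          ≡⟨ ⌊⌋≗ cv j ⟩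
        ι (scale cv) * point (vector cv) j               ≡⟨ cong (ι (scale cv) *_) (u≗ j) ⟩
        ι (scale cv) * (ι s * point (vector cw) j)
          ≡⟨ solve 4 (λ a s c p → a :* (s :* p) := a :* s :* :1 :* p) refl (ι (scale cv)) (ι s) (ι s) (point (vector cw) j) ⟩
        ι (scale cv) * ι s * 1# * point (vector cw) j
          ≡⟨ cong (λ o → ι (scale cv) * ι s * o * point (vector cw) j) (trans (sym ι-1) (trans (cong ι (sym ci≡1)) (ι-* (scale cw) i))) ⟩
        ι (scale cv) * ι s * (ι (scale cw) * ι i) * point (vector cw) j
          ≡⟨ solve 5 (λ a s c i p → a :* s :* (c :* i) :* p := a :* s :* i :* (c :* p)) refl (ι (scale cv)) (ι s) (ι (scale cw)) (ι i) (point (vector cw) j) ⟩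
        ι (scale cv) * ι s * ι i * (ι (scale cw) * point (vector cw) j)
          ≡⟨ cong₂ _*_ (trans (ι-* (scale cv K.* s) i) (cong (_* ι i) (ι-* (scale cv) s))) (⌊⌋≗ cw j) ⟨
        ι x * ⌊ w ⌋ j                                    ≡⟨ cong (λ y → ι y * ⌊ w ⌋ j) (FromK.from-to x) ⟨
        ι ⌊ FromK.to x ⌋ᵏ * ⌊ w ⌋ j                      ≡⟨ ⌊*ₗ⌋ (FromK.to x) w j ⟨
        ⌊ FromK.to x *ₗ w ⌋ j                            ∎

    ∼⇒parallel : ∀ {v w} (cv : Coordinates v) (cw : Coordinates w) x → v ≈ᴹ x *ₗ w →
                 det (vector cv) (vector cw) ≡ 0#
    ∼⇒parallel {v} {w} cv cw x v≈xw = multiple⇒parallel (vector cv) (vector cw) (ι (scale cv)) (ι-≢0 (scale≢0 cv)) (ι ⌊ x ⌋ᵏ * ι (scale cw)) λ j → begin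
      ι (scale cv) * point (vector cv) j                 ≡⟨ ⌊⌋≗ cv j ⟨
      ⌊ v ⌋ j                                            ≡⟨ ⌊⌋-cong v≈xw j ⟩
      ⌊ x *ₗ w ⌋ j                                       ≡⟨ ⌊*ₗ⌋ x w j ⟩
      ι ⌊ x ⌋ᵏ * ⌊ w ⌋ j                                 ≡⟨ cong (ι ⌊ x ⌋ᵏ *_) (⌊⌋≗ cw j) ⟩
      ι ⌊ x ⌋ᵏ * (ι (scale cw) * point (vector cw) j)    ≡⟨ *-assoc _ _ _ ⟨
      ι ⌊ x ⌋ᵏ * ι (scale cw) * point (vector cw) j      ∎

-- The section satisfies the conditions of a 5-general set.

module Generality where

  open Counting
  open CubicExtensions
  open Arithmetic using (q²∸q+1+q)
  open HyperplaneSections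
  open FiveGenerality
  open TenArcs using (six-dependent)
  open Hyperplanes
  open Coordinates
  open import Data.Empty using (⊥-elim)
  open import Algebra.Module.Bundles using (module Module)
  open import Data.Fin.Base using (Fin; punchIn; punchOut)
  import Data.Fin.Properties as Fin
  open import Data.Nat.Base as ℕ using (ℕ; _≤_)
  import Data.Nat.Properties as ℕ
  open import Data.Product.Base using (Σ; ∃-syntax; _×_; _,_; proj₁; proj₂)
  open import Data.Sum.Base using (_⊎_; inj₁; inj₂)
  open import Function.Base using (_∘_)
  open import Function.Bundles using (Inverse; Injection)
  open import Relation.Binary.PropositionalEquality
  open import Relation.Nullary using (Dec; ¬_; yes; no; contradiction)
  open import Relation.Unary using (_∩_; _⊆_)

  module Main {c ℓ a} {q} (q-power : Defs.IsPrimePower q) (4≤q : 4 ≤ q) (E : Defs.CubicExtension c ℓ a q)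
    (H : Defs.Twisted.Subspace E) (hyperplane : Defs.Twisted.IsHyperplane E H)
    (enumeration : Defs.HasCardinality (Defs.Twisted.setoidOf E (Defs.Twisted.pointsOf E H ∩ Defs.Twisted.O₁ E)) (q ℕ.^ 2 ℕ.∸ q ℕ.+ 1)) where

    open Bridge q-power 4≤q E
    open CubicExtensions.Theory extension hiding (4≤q)
    open Projective extension
    open Functional extension
    open Module T.V using (Carrierᴹ; _≈ᴹ_; _*ₗ_; 0ᴹ)
    open T using (HasDimension; Mem; Point)
    open ≡-Reasoning

    n : ℕ
    n = q ℕ.^ 2 ℕ.∸ q ℕ.+ 1

    X : T.PointSet _
    X = T.pointsOf H ∩ T.O₁

    open HasDimension (proj₂ hyperplane)

    h : Fin 7 → F⁸
    h i = ⌊ basis i ⌋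

    h-inv : ∀ i → Invariant (h i)
    h-inv i = U₁⇒invariant (proj₁ hyperplane (basis∈ i))

    ⊙-zero : ∀ {m} (v : Fin m → Carrierᴹ) x → (∀ j → (x ⊙ (⌊_⌋ ∘ v)) j ≡ 0#) → T.linComb (FromK.to ∘ x) v ≈ᴹ 0ᴹ
    ⊙-zero v x x⊙v≡0 = ⌊⌋-injective {T.linComb (FromK.to ∘ x) v} {0ᴹ} λ j → trans (⌊linComb-to⌋ x v j) (x⊙v≡0 j)

    h-indep : Independent h
    h-indep x x⊙h≡0 i = trans (sym (FromK.from-to (x i))) (FromK.from-cong (independent (FromK.to ∘ x) (⊙-zero basis x x⊙h≡0) i))

    module Hyp = Hyperplane h h-inv h-indep
    open Form Hyp.w Hyp.w-inv using (f; f-scale)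

    H-coordinates : ∀ {v} → Mem H v → Σ (Fin 7 → K.Carrier) λ x → ⌊ v ⌋ ≗ x ⊙ h
    H-coordinates v∈H = let x , v≈ = spanning v∈H in ⌊_⌋ᵏ ∘ x , λ j → trans (⌊⌋-cong v≈ j) (⌊linComb⌋ x basis j)

    w-kills-H : ∀ {v} → Mem H v → Hyp.w ∙ ⌊ v ⌋ ≡ 0#
    w-kills-H v∈H = let x , v≗ = H-coordinates v∈H in
      trans (∙-congʳ Hyp.w v≗) (trans (∙-combination Hyp.w (ι ∘ x) h)
        (sum-zero λ i → trans (cong (ι (x i) *_) (Hyp.w-h i)) (zeroʳ (ι (x i)))))

    f-vector : ∀ {v} → Mem H v → (cv : Coordinates v) → f (vector cv) ≡ 0#
    f-vector {v} v∈H cv = *≡0ʳ (ι-≢0 (scale≢0 cv)) (begin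
      ι (scale cv) * (Hyp.w ∙ point (vector cv))           ≡⟨ *-distribˡ-sum (ι (scale cv)) (λ j → Hyp.w j * point (vector cv) j) ⟩
      sum (λ j → ι (scale cv) * (Hyp.w j * point (vector cv) j))
        ≡⟨ sum-cong-≗ (λ j → trans (solve 3 (λ s w p → s :* (w :* p) := w :* (s :* p)) refl (ι (scale cv)) (Hyp.w j) (point (vector cv) j))
             (cong (Hyp.w j *_) (sym (⌊⌋≗ cv j)))) ⟩
      Hyp.w ∙ ⌊ v ⌋                                        ≡⟨ w-kills-H v∈H ⟩
      0#                                                   ∎)

    zero⇒member : ∀ {v} u → ⌊ v ⌋ ≗ point u → f u ≡ 0# → Mem H v
    zero⇒member {v} u v≗ fu≡0 =
      let x , u≗ = Hyp.kernel⇒member (point u) (point-invariant u) fu≡0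
      in ⊙-member H x basis basis∈ {v} (λ j → trans (v≗ j) (u≗ j))

    XPoint : Set _
    XPoint = Σ Point X

    coords : (P : XPoint) → Coordinates (proj₁ (proj₁ P))
    coords (P , _ , P∈O₁) = coordinates-of P P∈O₁

    f-coords : (P : XPoint) → f (vector (coords P)) ≡ 0#
    f-coords P@((v , _) , v∈H , _) = f-vector {v} v∈H (coords P)

    parallel⇒∼X : ∀ (P Q : XPoint) → det (vector (coords P)) (vector (coords Q)) ≡ 0# → T._∼_ (proj₁ P) (proj₁ Q)
    parallel⇒∼X P Q e = parallel⇒∼ (coords P) (coords Q) e ,
      parallel⇒∼ (coords Q) (coords P) (det-sym {vector (coords P)} {vector (coords Q)} e)

    ∼⇒parallelX : ∀ (P Q : XPoint) → T._∼_ (proj₁ P) (proj₁ Q) → det (vector (coords P)) (vector (coords Q)) ≡ 0#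
    ∼⇒parallelX P Q ((x , e) , _) = ∼⇒parallel (coords P) (coords Q) x e

    Pt : Fin n → XPoint
    Pt = Inverse.to enumeration

    Pt-injective : ∀ {i j} → T._∼_ (proj₁ (Pt i)) (proj₁ (Pt j)) → i ≡ j
    Pt-injective {i} {j} e = trans (sym (Inverse.strictlyInverseʳ enumeration i))
      (trans (Inverse.from-cong enumeration {Pt i} {Pt j} e) (Inverse.strictlyInverseʳ enumeration j))

    pt : Fin n → F²
    pt i = vector (coords (Pt i))

    distinct : ∀ {i j} → i ≢ j → det (pt i) (pt j) ≢ 0#
    distinct {i} {j} i≢j e = i≢j (Pt-injective (parallel⇒∼X (Pt i) (Pt j) e))

    -- A zero of `f` is a multiple of `affine t` or of `∞`, and its point lies in the hyperplane,
    -- which is all of the kernel of `w`. The enumeration returns this point up to `_∼_` only, so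
    -- parallelism is composed through both representatives.
    covers : ∀ u → u ≢ 0₂ → f u ≡ 0# → ∃[ i ] det u (pt i) ≡ 0#
    covers u u≢0 fu≡0 = cases (proj₁ u ≟ 0#)
      where
      index : (P : XPoint) → ∃[ i ] det (vector (coords P)) (pt i) ≡ 0#
      index P = Inverse.from enumeration P , det-sym {pt (Inverse.from enumeration P)} {vector (coords P)}
        (∼⇒parallelX (Pt (Inverse.from enumeration P)) P (Inverse.strictlyInverseˡ enumeration P))
      via : (P : XPoint) (v : F²) → v ≢ 0₂ → ⌊ proj₁ (proj₁ P) ⌋ ≗ point v → det u v ≡ 0# → ∃[ i ] det u (pt i) ≡ 0#
      via P v v≢0 P≗ uv≡0 = let i , e = index P in i , det-trans {u} {pt i} {v} v≢0 uv≡0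
        (det-trans {pt i} {v} {vector (coords P)} (vector≢0 (coords P)) (det-sym {vector (coords P)} {pt i} e)
          (multiple⇒parallel v (vector (coords P)) 1# 1≢0 (ι (scale (coords P)))
            λ j → trans (*-identityˡ (point v j)) (trans (sym (P≗ j)) (⌊⌋≗ (coords P) j))))
      ∼-refl : ∀ P → T._∼_ P P
      ∼-refl P = T.∼-isEquivalence .Relation.Binary.IsEquivalence.refl {P}
        where import Relation.Binary
      cases : Dec (proj₁ u ≡ 0#) → ∃[ i ] det u (pt i) ≡ 0#
      cases (no u₀≢0) = via (T.P₁ t , zero⇒member (affine (ratio u u₀≢0)) P≗ f-affine , inj₁ (t , ∼-refl (T.P₁ t)))
          (affine (ratio u u₀≢0)) (λ e → 1≢0 (cong proj₁ e)) P≗ parallel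
        where
        t = FromF.to (ratio u u₀≢0)
        P≗ : ⌊ proj₁ (T.P₁ t) ⌋ ≗ point (affine (ratio u u₀≢0))
        P≗ j = trans (⌊P₁⌋ t j) (cong (λ r → point (affine r) j) (FromF.from-to (ratio u u₀≢0)))
        f-affine : f (affine (ratio u u₀≢0)) ≡ 0#
        f-affine = *≡0ʳ (Nm-≢0 u₀≢0) (trans (sym (f-scale (proj₁ u) (affine (ratio u u₀≢0)))) (trans (cong f (⊡-ratio u u₀≢0)) fu≡0))
        parallel : det u (affine (ratio u u₀≢0)) ≡ 0#
        parallel = trans (cong (λ v → det v (affine (ratio u u₀≢0))) (sym (⊡-ratio u u₀≢0)))
          (solve 2 (λ a r → a :* :1 :* r :- a :* r :* :1 := :0) refl (proj₁ u) (ratio u u₀≢0))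
      cases (yes u₀≡0) = via (T.P∞ , zero⇒member ∞ ⌊P∞⌋ f-∞ , inj₂ (∼-refl T.P∞)) ∞ (λ e → 1≢0 (cong proj₂ e)) ⌊P∞⌋ parallel
        where
        u₁≢0 : proj₂ u ≢ 0#
        u₁≢0 u₁≡0 = u≢0 (cong₂ _,_ u₀≡0 u₁≡0)
        u≡ : u ≡ proj₂ u ⊡ ∞
        u≡ = cong₂ _,_ (trans u₀≡0 (sym (zeroʳ (proj₂ u)))) (sym (*-identityʳ (proj₂ u)))
        f-∞ : f ∞ ≡ 0#
        f-∞ = *≡0ʳ (Nm-≢0 u₁≢0) (trans (sym (f-scale (proj₂ u) ∞)) (trans (cong f (sym u≡)) fu≡0))
        parallel : det u ∞ ≡ 0#
        parallel = heads-zero⇒parallel u ∞ u₀≡0 refl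

    section′ : Section extension
    section′ = record
      { w = Hyp.w ; invariant = Hyp.w-inv ; u₀ = Hyp.u₀ ; fu₀≢0 = Hyp.fu₀≢0 ; n = n ; n+q≡ = q²∸q+1+q 4≤q
      ; pt = pt ; pt≢0 = λ i → vector≢0 (coords (Pt i)) ; distinct = distinct ; f-pt = λ i → f-coords (Pt i) ; covers = covers }

    co : Fin n → Fin 7 → K.Carrier
    co i = proj₁ (H-coordinates (proj₁ (proj₂ (Pt i))))

    ⌊Pt⌋ : ∀ i → ⌊ proj₁ (proj₁ (Pt i)) ⌋ ≗ co i ⊙ h
    ⌊Pt⌋ i = proj₂ (H-coordinates (proj₁ (proj₂ (Pt i))))

    ⊙-⊙ : ∀ {k m} (x : Fin k → K.Carrier) (y : Fin k → Fin m → K.Carrier) (u : Fin k → F⁸) (v : Fin m → F⁸) →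
          (∀ i → u i ≗ y i ⊙ v) → x ⊙ u ≗ K.combination x y ⊙ v
    ⊙-⊙ x y u v u≗ j = begin
      sum (λ i → ι (x i) * u i j)
        ≡⟨ sum-cong-≗ (λ i → trans (cong (ι (x i) *_) (u≗ i j)) (*-distribˡ-sum (ι (x i)) (λ l → ι (y i l) * v l j))) ⟩
      sum (λ i → sum (λ l → ι (x i) * (ι (y i l) * v l j))) ≡⟨ ∑-comm (λ i l → ι (x i) * (ι (y i l) * v l j)) ⟩
      sum (λ l → sum (λ i → ι (x i) * (ι (y i l) * v l j)))
        ≡⟨ sum-cong-≗ (λ l → trans (sum-cong-≗ λ i → trans (sym (*-assoc (ι (x i)) (ι (y i l)) (v l j))) (cong (_* v l j) (sym (ι-* (x i) (y i l)))))
             (trans (sym (*-distribʳ-sum (v l j) (λ i → ι (x i K.* y i l)))) (cong (_* v l j) (sym (ι-sum (λ i → x i K.* y i l)))))) ⟩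
      (K.combination x y ⊙ v) j ∎

    -- A dependency over `K` becomes one over `F` between the tensors once the scale of each point
    -- is moved into its coefficient.
    five : (P : Fin 5 → XPoint) → (∀ {i j} → T._∼_ (proj₁ (P i)) (proj₁ (P j)) → i ≡ j) →
           ∀ x → (∀ j → (x ⊙ (λ i → ⌊ proj₁ (proj₁ (P i)) ⌋)) j ≡ 0#) → ∀ i → x i ≡ K.0#
    five P P-inj x x⊙P≡0 i = ι-injective (trans (*≡0ʳ (ι-≢0 (scale≢0 (coords (P i)))) (trans (*-comm _ _)
        (five-independent section′ (λ i → vector (coords (P i)))
          (λ {i} {j} i≢j e → i≢j (P-inj (parallel⇒∼X (P i) (P j) e))) (λ i → f-coords (P i))
          (λ i → ι (x i) * ι (scale (coords (P i))))
          (λ j → trans (sum-cong-≗ λ i → trans (*-assoc _ _ _) (cong (ι (x i) *_) (sym (⌊⌋≗ (coords (P i)) j)))) (x⊙P≡0 j)) i)))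
      (sym ι-0))

    -- A subspace of projective dimension 3 has a basis of four vectors, and five coordinate vectors
    -- of length four are dependent over `K`, against `five`.
    at-most-four : ∀ S → Mem S ⊆ Mem H → T.HasProjDimension S 3 → Defs.HasAtMost (T.setoidOf (X ∩ T.pointsOf S)) 4
    at-most-four S S⊆H dim injection =
      let x , (i , xᵢ≢0) , dependent = K.more-dependent {5} {4} ℕ.≤-refl (λ i → proj₁ (S-coordinates i))
      in xᵢ≢0 (five P (Injection.injective injection) x (λ j → trans
           (⊙-⊙ x (λ i → proj₁ (S-coordinates i)) (λ i → ⌊ proj₁ (proj₁ (P i)) ⌋) (λ i → ⌊ D.basis i ⌋) (λ i → proj₂ (S-coordinates i)) j)
           (sum-zero λ l → trans (cong (λ y → ι y * ⌊ D.basis l ⌋ j) (dependent l)) (trans (cong (_* ⌊ D.basis l ⌋ j) ι-0) (zeroˡ _)))) i)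
      where
      module D = HasDimension dim
      P : Fin 5 → XPoint
      P i = let Q , Q∈X , _ = Injection.to injection i in Q , Q∈X
      S-coordinates : ∀ i → Σ (Fin 4 → K.Carrier) λ y → ⌊ proj₁ (proj₁ (P i)) ⌋ ≗ y ⊙ (λ i → ⌊ D.basis i ⌋)
      S-coordinates i = let y , v≈ = D.spanning (proj₂ (proj₂ (Injection.to injection i)))
                        in ⌊_⌋ᵏ ∘ y , λ j → trans (⌊⌋-cong v≈ j) (⌊linComb⌋ y D.basis j)

    -- The pencil argument speaks of every parameter t at which `f` vanishes, while `co` lists
    -- coordinates of the enumerated representatives. The two agree up to a factor in `K`, which
    -- does not affect vanishing under `α`.
    not-annihilated : ¬ K.Annihilated co
    not-annihilated (α , (m , αₘ≢0) , kills) =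
      Hyp.Pencil.absurd α m αₘ≢0 (q²∸q+1+q 4≤q) pt distinct (λ i → f-coords (Pt i)) killed
      where
      killed : ∀ t x → f (affine t) ≡ 0# → point (affine t) ≗ x ⊙ h → α K.∙ x ≡ K.0#
      killed t x ft≡0 t≗ =
        let i , e = covers (affine t) (λ e → 1≢0 (cong proj₁ e)) ft≡0
            s , t≗Pt = parallel⇒multiple (affine t) (pt i) (vector≢0 (coords (Pt i))) e
            r , cr≡1 = K.inverse (scale (coords (Pt i))) (scale≢0 (coords (Pt i)))
            y = s K.* r
            x≡ : ∀ l → x l ≡ y K.* co i l
            x≡ = independent⇒unique {u = h} h-indep x (λ l → y K.* co i l) λ j → begin
              (x ⊙ h) j                                    ≡⟨ t≗ j ⟨
              point (affine t) j                           ≡⟨ t≗Pt j ⟩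
              ι s * point (pt i) j                         ≡⟨ cong (_* point (pt i) j) (trans (cong ι (trans (sym (K.*-identityʳ s)) (trans (cong (s K.*_) (sym cr≡1))
                                                                (K.solve 3 (λ s c r → s K.:* (c K.:* r) K.:= s K.:* r K.:* c) refl s (scale (coords (Pt i))) r)))) (ι-* y (scale (coords (Pt i))))) ⟩
              ι y * ι (scale (coords (Pt i))) * point (pt i) j   ≡⟨ trans (*-assoc _ _ _) (cong (ι y *_) (sym (⌊⌋≗ (coords (Pt i)) j))) ⟩
              ι y * ⌊ proj₁ (proj₁ (Pt i)) ⌋ j             ≡⟨ cong (ι y *_) (⌊Pt⌋ i j) ⟩
              ι y * (co i ⊙ h) j                           ≡⟨ *-distribˡ-sum (ι y) (λ l → ι (co i l) * h l j) ⟩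
              sum (λ l → ι y * (ι (co i l) * h l j))       ≡⟨ sum-cong-≗ (λ l → trans (sym (*-assoc _ _ _)) (cong (_* h l j) (sym (ι-* y (co i l))))) ⟩
              ((λ l → y K.* co i l) ⊙ h) j                 ∎
        in trans (K.sum-cong-≗ λ l → trans (cong (α l K.*_) (x≡ l)) (K.solve 3 (λ a y c → a K.:* (y K.:* c) K.:= y K.:* (a K.:* c)) refl (α l) y (co i l)))
             (trans (sym (K.*-distribˡ-sum y (λ l → α l K.* co i l))) (trans (cong (y K.*_) (kills i)) (K.zeroʳ y)))

    co-spanning : K.Spanning co
    co-spanning = cases (K.annihilated-or-spanning n 7 co)
      where
      cases : K.Annihilated co ⊎ (7 ≤ n × K.Spanning co) → K.Spanning co
      cases (inj₁ annihilated)    = ⊥-elim (not-annihilated annihilated)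
      cases (inj₂ (_ , spanning)) = spanning

    spans : Mem H ⊆ T.LinearSpan X
    spans {v} v∈H =
      let z , v≗ = H-coordinates v∈H
          x , z≡ = co-spanning z
      in n , (λ i → proj₁ (Pt i)) , (λ i → proj₂ (Pt i)) , FromK.to ∘ x ,
         ⌊⌋-injective {v} {T.linComb (FromK.to ∘ x) (λ i → proj₁ (proj₁ (Pt i)))} λ j → begin
           ⌊ v ⌋ j                                     ≡⟨ v≗ j ⟩
           (z ⊙ h) j                                   ≡⟨ sum-cong-≗ (λ l → cong (λ y → ι y * h l j) (z≡ l)) ⟩
           (K.combination x co ⊙ h) j                  ≡⟨ ⊙-⊙ x co (λ i → ⌊ proj₁ (proj₁ (Pt i)) ⌋) h ⌊Pt⌋ j ⟨
           (x ⊙ (λ i → ⌊ proj₁ (proj₁ (Pt i)) ⌋)) j    ≡⟨ ⌊linComb-to⌋ x (λ i → proj₁ (proj₁ (Pt i))) j ⟨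
           ⌊ T.linComb (FromK.to ∘ x) (λ i → proj₁ (proj₁ (Pt i))) ⌋ j ∎

    -- As any five points are independent, leaving out one point with nonzero coefficient turns a
    -- dependent six into a basis of five vectors. Its span has projective dimension 4 and still
    -- contains all six points, as the excess condition for r = 4 and s = 3 demands.
    module Six (g : Fin 6 → Fin n) (g-inj : Inj g) (x : Fin 6 → K.Carrier) (j₀ : Fin 6) (xⱼ₀≢0 : x j₀ ≢ K.0#)
               (dependent : ∀ j → K.combination x (co ∘ g) j ≡ K.0#) where

      Q : Fin 6 → Carrierᴹ
      Q i = proj₁ (proj₁ (Pt (g i)))

      p : Fin 5 → Fin 6
      p = punchIn j₀

      B : Fin 5 → Carrierᴹ
      B k = Q (p k)

      subspace : T.Subspace
      subspace = record
        { Mem = λ v → ∃[ y ] v ≈ᴹ T.linComb y B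
        ; resp = λ {v} {w} v≈w (y , v≈) → y , Module.≈ᴹ-trans T.V {w} {v} {T.linComb y B} (Module.≈ᴹ-sym T.V {v} {w} v≈w) v≈
        ; 0-closed = (λ _ → E.K.0#) , ⌊⌋-injective {0ᴹ} {T.linComb (λ _ → E.K.0#) B} λ j → sym (trans (⌊linComb⌋ (λ _ → E.K.0#) B j)
            (sum-zero λ k → trans (cong (_* ⌊ B k ⌋ j) ι-0) (zeroˡ _)))
        ; +-closed = λ {v} {w} (y , v≈) (z , w≈) → (λ k → y k E.K.+ z k) ,
            ⌊⌋-injective {Module._+ᴹ_ T.V v w} {T.linComb (λ k → y k E.K.+ z k) B} λ j → begin
              ⌊ Module._+ᴹ_ T.V v w ⌋ j                    ≡⟨ FromF.from-+ (v j) (w j) ⟩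
              ⌊ v ⌋ j + ⌊ w ⌋ j                            ≡⟨ cong₂ _+_ (trans (⌊⌋-cong v≈ j) (⌊linComb⌋ y B j)) (trans (⌊⌋-cong w≈ j) (⌊linComb⌋ z B j)) ⟩
              ((⌊_⌋ᵏ ∘ y) ⊙ (⌊_⌋ ∘ B)) j + ((⌊_⌋ᵏ ∘ z) ⊙ (⌊_⌋ ∘ B)) j
                ≡⟨ ∑-distrib-+ (λ k → ι ⌊ y k ⌋ᵏ * ⌊ B k ⌋ j) (λ k → ι ⌊ z k ⌋ᵏ * ⌊ B k ⌋ j) ⟨
              sum (λ k → ι ⌊ y k ⌋ᵏ * ⌊ B k ⌋ j + ι ⌊ z k ⌋ᵏ * ⌊ B k ⌋ j)
                ≡⟨ sum-cong-≗ (λ k → trans (sym (distribʳ (⌊ B k ⌋ j) (ι ⌊ y k ⌋ᵏ) (ι ⌊ z k ⌋ᵏ)))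
                     (cong (_* ⌊ B k ⌋ j) (trans (sym (ι-+ ⌊ y k ⌋ᵏ ⌊ z k ⌋ᵏ)) (cong ι (sym (FromK.from-+ (y k) (z k))))))) ⟩
              ((λ k → ⌊ y k E.K.+ z k ⌋ᵏ) ⊙ (⌊_⌋ ∘ B)) j   ≡⟨ ⌊linComb⌋ (λ k → y k E.K.+ z k) B j ⟨
              ⌊ T.linComb (λ k → y k E.K.+ z k) B ⌋ j      ∎
        ; *-closed = λ r {v} (y , v≈) → (λ k → r E.K.* y k) ,
            ⌊⌋-injective {r *ₗ v} {T.linComb (λ k → r E.K.* y k) B} λ j → begin
              ⌊ r *ₗ v ⌋ j                                 ≡⟨ ⌊*ₗ⌋ r v j ⟩
              ι ⌊ r ⌋ᵏ * ⌊ v ⌋ j                           ≡⟨ cong (ι ⌊ r ⌋ᵏ *_) (trans (⌊⌋-cong v≈ j) (⌊linComb⌋ y B j)) ⟩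
              ι ⌊ r ⌋ᵏ * ((⌊_⌋ᵏ ∘ y) ⊙ (⌊_⌋ ∘ B)) j        ≡⟨ *-distribˡ-sum (ι ⌊ r ⌋ᵏ) (λ k → ι ⌊ y k ⌋ᵏ * ⌊ B k ⌋ j) ⟩
              sum (λ k → ι ⌊ r ⌋ᵏ * (ι ⌊ y k ⌋ᵏ * ⌊ B k ⌋ j))
                ≡⟨ sum-cong-≗ (λ k → trans (sym (*-assoc (ι ⌊ r ⌋ᵏ) (ι ⌊ y k ⌋ᵏ) (⌊ B k ⌋ j)))
                     (cong (_* ⌊ B k ⌋ j) (trans (sym (ι-* ⌊ r ⌋ᵏ ⌊ y k ⌋ᵏ)) (cong ι (sym (FromK.from-* r (y k))))))) ⟩
              ((λ k → ⌊ r E.K.* y k ⌋ᵏ) ⊙ (⌊_⌋ ∘ B)) j     ≡⟨ ⌊linComb⌋ (λ k → r E.K.* y k) B j ⟨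
              ⌊ T.linComb (λ k → r E.K.* y k) B ⌋ j        ∎
        }

      ⊙⇒Mem : ∀ v y → ⌊ v ⌋ ≗ y ⊙ (⌊_⌋ ∘ B) → Mem subspace v
      ⊙⇒Mem v y v≗ = FromK.to ∘ y , ⌊⌋-injective {v} {T.linComb (FromK.to ∘ y) B} λ j → trans (v≗ j) (sym (⌊linComb-to⌋ y B j))

      Q-relation : ∀ j → (x ⊙ (⌊_⌋ ∘ Q)) j ≡ 0#
      Q-relation j = trans (⊙-⊙ x (co ∘ g) (⌊_⌋ ∘ Q) h (λ i → ⌊Pt⌋ (g i)) j)
        (sum-zero λ l → trans (cong (λ y → ι y * h l j) (dependent l)) (trans (cong (_* h l j) ι-0) (zeroˡ (h l j))))

      δ : Fin 5 → Fin 5 → K.Carrier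
      δ k l = δ′ (l Fin.≟ k)
        where
        δ′ : ∀ {p} {P : Set p} → Dec P → K.Carrier
        δ′ (yes _) = K.1#
        δ′ (no _)  = K.0#

      δ-⊙ : ∀ k j → (δ k ⊙ (⌊_⌋ ∘ B)) j ≡ ⌊ B k ⌋ j
      δ-⊙ k j = trans (sum-single {f = λ l → ι (δ k l) * ⌊ B l ⌋ j} k off) on
        where
        off : ∀ l → l ≢ k → ι (δ k l) * ⌊ B l ⌋ j ≡ 0#
        off l l≢k with l Fin.≟ k
        ... | yes e = contradiction e l≢k
        ... | no _  = trans (cong (_* ⌊ B l ⌋ j) ι-0) (zeroˡ (⌊ B l ⌋ j))
        on : ι (δ k k) * ⌊ B k ⌋ j ≡ ⌊ B k ⌋ j
        on with k Fin.≟ k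
        ... | yes _ = trans (cong (_* ⌊ B k ⌋ j) ι-1) (*-identityˡ (⌊ B k ⌋ j))
        ... | no ≢  = contradiction refl ≢

      -- The relation is solved for the point `j₀`, whose coefficient is invertible; the other five
      -- are basis vectors with coordinates `δ`.
      Q∈ : ∀ i → Mem subspace (Q i)
      Q∈ i = cases (j₀ Fin.≟ i)
        where
        r = proj₁ (K.inverse (x j₀) xⱼ₀≢0)
        y : Fin 5 → K.Carrier
        y k = K.- (r K.* x (p k))
        ιr*ιx≡1 : ι (x j₀) * ι r ≡ 1#
        ιr*ιx≡1 = trans (sym (ι-* (x j₀) r)) (trans (cong ι (proj₂ (K.inverse (x j₀) xⱼ₀≢0))) ι-1)
        ι-neg : ∀ z → ι (K.- z) ≡ - ι z
        ι-neg z = trans (solve 2 (λ a b → b := (a :+ b) :- a) refl (ι z) (ι (K.- z)))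
          (trans (cong (_- ι z) (trans (sym (ι-+ z (K.- z))) (trans (cong ι (K.-‿inverseʳ z)) ι-0))) (+-identityˡ (- ι z)))
        pivot : ∀ j → ⌊ Q j₀ ⌋ j ≡ (y ⊙ (⌊_⌋ ∘ B)) j
        pivot j = begin
          ⌊ Q j₀ ⌋ j                      ≡⟨ *-identityˡ (⌊ Q j₀ ⌋ j) ⟨
          1# * ⌊ Q j₀ ⌋ j                 ≡⟨ cong (_* ⌊ Q j₀ ⌋ j) ιr*ιx≡1 ⟨
          ι (x j₀) * ι r * ⌊ Q j₀ ⌋ j
            ≡⟨ solve 4 (λ a r v s → a :* r :* v := r :* (a :* v :+ s) :+ :- r :* s) refl (ι (x j₀)) (ι r) (⌊ Q j₀ ⌋ j) rest ⟩
          ι r * (ι (x j₀) * ⌊ Q j₀ ⌋ j + rest) + - ι r * rest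
            ≡⟨ cong (λ z → ι r * z + - ι r * rest) (trans (sym (sum-remove {i = j₀} (λ i → ι (x i) * ⌊ Q i ⌋ j))) (Q-relation j)) ⟩
          ι r * 0# + - ι r * rest         ≡⟨ solve 2 (λ r s → r :* :0 :+ :- r :* s := :- r :* s) refl (ι r) rest ⟩
          - ι r * rest                    ≡⟨ *-distribˡ-sum (- ι r) (λ k → ι (x (p k)) * ⌊ B k ⌋ j) ⟩
          sum (λ k → - ι r * (ι (x (p k)) * ⌊ B k ⌋ j))
            ≡⟨ sum-cong-≗ (λ k → trans (solve 3 (λ r a v → :- r :* (a :* v) := :- (r :* a) :* v) refl (ι r) (ι (x (p k))) (⌊ B k ⌋ j))
                 (cong (_* ⌊ B k ⌋ j) (trans (cong -_ (sym (ι-* r (x (p k))))) (sym (ι-neg (r K.* x (p k))))))) ⟩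
          (y ⊙ (⌊_⌋ ∘ B)) j               ∎
          where rest = sum (λ k → ι (x (p k)) * ⌊ B k ⌋ j)
        cases : Dec (j₀ ≡ i) → Mem subspace (Q i)
        cases (yes j₀≡i) = subst (λ i → Mem subspace (Q i)) j₀≡i (⊙⇒Mem (Q j₀) y pivot)
        cases (no j₀≢i) = subst (λ i → Mem subspace (Q i)) (Fin.punchIn-punchOut j₀≢i)
          (⊙⇒Mem (B (punchOut j₀≢i)) (δ (punchOut j₀≢i)) λ j → sym (δ-⊙ (punchOut j₀≢i) j))

      B-indep : Independent (⌊_⌋ ∘ B)
      B-indep = five (λ k → Pt (g (p k))) (λ {k} {l} e → Fin.punchIn-injective j₀ k l (g-inj (Pt-injective e)))

      dimension : T.HasProjDimension subspace 4
      dimension = record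
        { basis = B
        ; basis∈ = λ k → Q∈ (p k)
        ; independent = λ y y⊙B≈0 k → FromK.from-injective (B-indep (⌊_⌋ᵏ ∘ y) (λ j → trans (sym (⌊linComb⌋ y B j)) (⌊⌋-cong y⊙B≈0 j)) k)
        ; spanning = λ v∈ → v∈
        }

      contained : Mem subspace ⊆ Mem H
      contained {v} (y , v≈) = T.Subspace.resp H {T.linComb y B} {v} (Module.≈ᴹ-sym T.V {v} {T.linComb y B} v≈)
        (linComb-member H y B (λ k → proj₁ (proj₂ (Pt (g (p k))))))

      six-points : Defs.HasAtLeast (T.setoidOf (X ∩ T.pointsOf subspace)) 6
      six-points = record
        { to = λ i → proj₁ (Pt (g i)) , proj₂ (Pt (g i)) , Q∈ i
        ; cong = λ {i} {j} e → subst (λ k → T._∼_ (proj₁ (Pt (g i))) (proj₁ (Pt (g k)))) e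
            (parallel⇒∼X (Pt (g i)) (Pt (g i)) (det-self (pt (g i))))
        ; injective = λ e → g-inj (Pt-injective e)
        }

    generality : T.IsGeneral 5 H X
    generality = record
      { inside = proj₁
      ; atMost = at-most-four
      ; spans = λ {v} → spans {v}
      ; excess =
          let g , g-inj , x , (j₀ , xⱼ₀≢0) , dependent = six-dependent K-field 4≤q (q²∸q+1+q 4≤q) co
          in Six.subspace g g-inj x j₀ xⱼ₀≢0 dependent , (λ {v} → Six.contained g g-inj x j₀ xⱼ₀≢0 dependent {v}) ,
             Six.dimension g g-inj x j₀ xⱼ₀≢0 dependent , Six.six-points g g-inj x j₀ xⱼ₀≢0 dependent
      }
      where
      K-field = FiniteCubicExtension.K extension

open import Defs
open import Data.Nat.Base using (ℕ; _≤_; _+_; _∸_; _^_)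
open import Relation.Unary using (_∩_)

mainTheorem9 : ∀ {c ℓ a} (q : ℕ) → IsPrimePower q → 4 ≤ q →
    (E : CubicExtension c ℓ a q) → let open Twisted E in
    (H₁ : Subspace) → IsHyperplane H₁ →
    HasCardinality (setoidOf (pointsOf H₁ ∩ O₁)) (q ^ 2 ∸ q + 1) →
    IsGeneral 5 H₁ (pointsOf H₁ ∩ O₁)
mainTheorem9 q q-power 4≤q E H₁ hyperplane enumeration =
  Generality.Main.generality q-power 4≤q E H₁ hyperplane enumeration
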